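{- Let $p$ be a prime, $q=p^e$, $m,k\ge1$, and let $f\in\mathbb{F}_{q^m}[x_1,\dots,x_k]$ be a polynomial of degree $d\ge1$. Then \[\nu_p\big(N(f=y^q-y)\big)\ge\Big\lceil\frac{em(q-1)}{q^m-1}\Big\lceil\frac{k(q^m-1)}{d(q-1)}\Big\rceil\Big\rceil.\]
   Context: $N(f=y^q-y)$ denotes the number of $(x_1,\dots,x_k,y)\in\mathbb{F}_{q^m}^{k+1}$ with $f(x_1,\dots,x_k)=y^q-y$; $\nu_p$ is the $p$-adic valuation. -}

module Defs where

open import Level using (_⊔_)
open import Algebra.Apartness.Bundles using (HeytingField; HeytingCommutativeRing)
open import Algebra.Bundles using (CommutativeRing; Semiring)
import Algebra.Definitions.RawSemiring as RawSemiringDefinitions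
open import Data.Bool.Base using (if_then_else_)
open import Data.Fin.Base using (Fin)
open import Data.Integer.Base using (ℤ; +_)
open import Data.List.Base as List
  using (List; []; _∷_; length; filter; cartesianProduct; cartesianProductWith)
open import Data.List.Membership.Propositional using (_∉_)
open import Data.List.Relation.Unary.Unique.Propositional using (Unique)
open import Data.Nat.Base
  using (ℕ; zero; suc; _*_; _∸_; _^_; _≤_; NonZero; NonTrivial; nonTrivial⇒n>1)
open import Data.Nat.Divisibility using (_∣?_)
open import Data.Nat.Primality using (Prime; prime⇒nonTrivial)
open import Data.Nat.Properties using (m<n⇒0<n∸m; m*n≢0; ^-monoʳ-<)
open import Data.Product.Base using (_×_; ∃-syntax; _,_)
open import Data.Rational.Unnormalised.Base as ℚᵘ using (ceiling)
open import Data.Vec.Base as Vec using (Vec; lookup)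
open import Function.Bundles using (Inverse)
open import Function.Properties.Inverse using (Inverse⇒Injection) renaming (sym to ↔-sym)
open import Relation.Binary.Definitions using (Decidable)
open import Relation.Binary.PropositionalEquality using (_≡_; setoid)
open import Relation.Nullary.Construct.Add.Supremum using (_⁺; [_]; ⊤⁺)
open import Relation.Nullary.Decidable using (does; via-injection)
open import Relation.Nullary.Negation using (¬_)
import Data.Fin.Properties as Fin
import Data.Nat.Base as ℕ

-- The largest j ≤ b with p ^ j ∣ n.
multiplicity≤ : (b p n : ℕ) → ℕ
multiplicity≤ zero    p n = 0
multiplicity≤ (suc b) p n =
  if does (p ^ suc b ∣? n) then suc b else multiplicity≤ b p n

-- The p-adic valuation on ℕ, with ν p 0 = ∞.  Searching up to n is enough:
-- for p ≥ 2 and n ≥ 1, p ^ j ∣ n forces j < n.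
ν : ℕ → ℕ → ℤ ⁺
ν p zero      = ⊤⁺
ν p n@(suc _) = [ + multiplicity≤ n p n ]

-- ⌈ e m (q - 1) / (q ^ m - 1) · ⌈ k (q ^ m - 1) / (d (q - 1)) ⌉ ⌉  with  q = p ^ e.
-- The arguments pr, e ≠ 0, m ≠ 0, d ≠ 0 only make the denominators nonzero.
bound : (p e m k d : ℕ) → Prime p →
        .{{NonZero e}} → .{{NonZero m}} → .{{NonZero d}} → ℤ
bound p e m k d pr =
  ceiling ((+ (e * m * (q ∸ 1)) ℚᵘ./ (q ^ m ∸ 1))
           ℚᵘ.* (ceiling (+ (k * (q ^ m ∸ 1)) ℚᵘ./ (d * (q ∸ 1))) ℚᵘ./ 1))
  where
  q = p ^ e

  1<b^i : ∀ b i → .{{NonTrivial b}} → .{{NonZero i}} → 1 ℕ.< b ^ i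
  1<b^i b i = ^-monoʳ-< b (nonTrivial⇒n>1 b) (ℕ.>-nonZero⁻¹ i)

  instance
    p-nonTrivial : NonTrivial p
    p-nonTrivial = prime⇒nonTrivial pr

    q-nonTrivial : NonTrivial q
    q-nonTrivial = ℕ.n>1⇒nonTrivial (1<b^i p e)

    q∸1-nonZero : NonZero (q ∸ 1)
    q∸1-nonZero = ℕ.>-nonZero (m<n⇒0<n∸m (1<b^i p e))

    q^m∸1-nonZero : NonZero (q ^ m ∸ 1)
    q^m∸1-nonZero = ℕ.>-nonZero (m<n⇒0<n∸m (1<b^i q m))

    d[q∸1]-nonZero : NonZero (d * (q ∸ 1))
    d[q∸1]-nonZero = m*n≢0 d (q ∸ 1)

module _ {c ℓ₁ ℓ₂} (F : HeytingField c ℓ₁ ℓ₂) where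

  private
    R : CommutativeRing c ℓ₁
    R = HeytingCommutativeRing.commutativeRing (HeytingField.heytingCommutativeRing F)

  open CommutativeRing R
    using (Carrier; _≈_; _+_; _-_; 0#; semiring)
    renaming (_*_ to _·_; setoid to setoidF)
  open RawSemiringDefinitions (Semiring.rawSemiring semiring)
    using (product) renaming (_^_ to _^ᶠ_)

  -- F has exactly n elements.  Equality on F is then decidable, and the Heyting
  -- field F is a field in the classical sense: if ¬ x ≈ 0#, tightness gives
  -- ¬ ¬ x # 0#, so an inverse of x cannot fail to exist among the n elements
  -- and is found by search.
  HasOrder : ℕ → Set (c ⊔ ℓ₁)
  HasOrder n = Inverse (setoid (Fin n)) setoidF

  -- F [ x₁ , … , x_k ] as finitely supported families of coefficients indexed by
  -- exponent vectors; coefficients on the support are allowed to vanish.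
  record Polynomial (k : ℕ) : Set (c ⊔ ℓ₁) where
    field
      coeff   : Vec ℕ k → Carrier
      support : List (Vec ℕ k)
      unique  : Unique support
      finite  : ∀ μ → μ ∉ support → coeff μ ≈ 0#

  open Polynomial

  monomial : ∀ {k} → Vec ℕ k → Vec Carrier k → Carrier
  monomial μ x = product (λ i → lookup x i ^ᶠ lookup μ i)

  eval : ∀ {k} → Polynomial k → Vec Carrier k → Carrier
  eval f x = List.foldr _+_ 0# (List.map (λ μ → coeff f μ · monomial μ x) (support f))

  -- f is nonzero of total degree d.
  HasDegree : ∀ {k} → Polynomial k → ℕ → Set ℓ₁
  HasDegree f d =
    (∀ μ → ¬ coeff f μ ≈ 0# → Vec.sum μ ≤ d) ×
    (∃[ μ ] Vec.sum μ ≡ d × ¬ coeff f μ ≈ 0#)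

  module _ {n} (F-order : HasOrder n) where

    _≟_ : Decidable _≈_
    _≟_ = via-injection (Inverse⇒Injection (↔-sym F-order)) Fin._≟_

    elements : List Carrier
    elements = List.tabulate (Inverse.to F-order)

    tuples : ∀ k → List (Vec Carrier k)
    tuples zero    = Vec.[] ∷ []
    tuples (suc k) = cartesianProductWith Vec._∷_ elements (tuples k)

    -- The number of (x , y) ∈ F ^ k × F with f (x) = y ^ q - y.
    N : ∀ {k} → Polynomial k → ℕ → ℕ
    N {k} f q = length (filter (λ (x , y) → eval f x ≟ ((y ^ᶠ q) - y))
                               (cartesianProduct (tuples k) elements))

{-# OPTIONS --safe #-}
module Submission where

-- Let A = ℤ[F] be the monoid ring of (F , ·), π : A → F the ring homomorphism
-- [ a ] ↦ a, and I its kernel; A / Iⁿ replaces the Witt vectors of length n, with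
-- Teichmüller lifts [ a ].  If φ [ a ] = [ aᵖ ], the p-derivation (φ x - xᵖ) / p
-- maps Iⁿ⁺¹ into Iⁿ, so an integer lies in I ^ B only if p ^ B divides it.
--
-- Modulo I ^ B the number of solutions is the sum of 1 - G ^ E over all points,
-- where G lifts f - y ^ q + y monomial by monomial and E = (q ^ m - 1) p ^ B.  Expand
-- G ^ E by the multinomial theorem.  Summed over all points, a monomial vanishes
-- modulo every power of I unless q ^ m - 1 divides each of its exponents, and then
-- every variable with exponent 0 contributes a factor q ^ m.  By Legendre's formula
-- the valuation of the multinomial coefficient is governed by the base-p digit sums
-- of the multiplicities j of the monomials.  Rotating these digits cyclically modulo
-- e m multiplies each j by a power of p modulo q ^ m - 1 and preserves all
-- divisibility conditions, so the rotated multiplicities of the monomials of f have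
-- a sum that is divisible by q - 1 and is at least k (q ^ m - 1) / d if all exponents
-- are positive.  Adding up the e m rotations bounds the digit sums from below.

open import Defs
open import Algebra.Apartness.Bundles using (HeytingField; HeytingCommutativeRing)
open import Algebra.Bundles using (CommutativeMonoid; CommutativeRing; CommutativeSemiring)
import Algebra.Construct.Pointwise as Pointwise
import Algebra.Properties.CommutativeMonoid.Sum
import Algebra.Properties.CommutativeSemiring.Exp
import Algebra.Properties.Semiring.Mult
import Algebra.Properties.Semiring.Sum
import Algebra.Solver.Ring
open import Algebra.Solver.Ring.AlmostCommutativeRing using (fromCommutativeRing; _-Raw-AlmostCommutative⟶_)
open import Data.Bool.Base using (if_then_else_)
open import Data.Empty using (⊥-elim)
open import Data.Fin.Base as Fin using (Fin; toℕ)
open import Data.Fin.Permutation using (Permutation′; permutation)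
import Data.Fin.Properties as Fin
open import Data.Integer.Base as ℤ using (ℤ; 0ℤ; 1ℤ)
import Data.Integer.DivMod as ℤ
import Data.Integer.Properties as ℤ
import Data.Integer.Tactic.RingSolver as ℤ-Solver
open import Data.List.Base as List
  using (List; []; _∷_; _++_; length; filter; replicate; cartesianProduct; cartesianProductWith)
import Data.List.Properties as List
open import Data.List.Relation.Unary.All as All using (All; []; _∷_)
import Data.List.Relation.Unary.All.Properties as All
import Data.Maybe.Base as Maybe
open import Data.Nat.Base as ℕ using (ℕ; zero; suc; _!; NonZero; s≤s; z≤n)
open import Data.Nat.Combinatorics using (_C_; nCk≡n!/k![n-k]!; k![n∸k]!∣n!; nCn≡1)
open import Data.Nat.Coprimality using (Coprime; coprime-Bézout)
open import Data.Nat.DivMod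
  using (m≡m%n+[m/n]*n; m%n<n; m/n<m; m/n*n≡m; m<n⇒m%n≡m; [m+n]%n≡m%n)
open import Data.Nat.Divisibility
open import Data.Nat.GCD using (module Bézout)
open import Data.Nat.Induction using (<-rec)
open import Data.Nat.Primality
  using (Prime; euclidsLemma; prime⇒nonZero; prime⇒nonTrivial; prime⇒irreducible; ¬prime[0])
import Data.Nat.Properties as ℕ
import Data.Nat.Tactic.RingSolver as ℕ-Solver
open import Data.Product.Base using (_×_; _,_; ∃-syntax; proj₁; proj₂)
open import Data.Rational.Unnormalised.Base as ℚᵘ using (ceiling)
open import Data.Sum.Base using (_⊎_; inj₁; inj₂)
open import Data.Vec.Base as Vec using (Vec; []; _∷_; lookup)
import Data.Vec.Properties as Vec
open import Function.Base using (_∘_)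
open import Function.Bundles using (Inverse)
open import Level using (_⊔_)
open import Relation.Binary.Consequences using (dec⇒weaklyDec)
open import Relation.Binary.Definitions using (Decidable)
open import Relation.Binary.PropositionalEquality using (_≡_)
import Relation.Binary.PropositionalEquality as ≡
open import Relation.Nullary.Decidable using (Dec; does; yes; no; ¬?)
open import Relation.Nullary.Negation using (¬_)
import Relation.Unary as Unary

-- Elementary number theory

-- The two monomials `y` and `- y ^ q` shape the estimate. By Legendre's formula a multinomial
-- coefficient of `E` has valuation (digit sums of the multiplicities minus digit sum of `E`) / (p -
-- 1), and the subtracted digit sum has to be paid for. The factor p ^ B of `E` sharpens Fermat's
-- congruence from modulo I to modulo I ^ B but only appends zeros, so the digit sum of `E` is e m
-- (p - 1) for every `B`. Let y and - y ^ q occur a and b times. Multiplication by q is a rotation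
-- by e places; hence, if a + q b is a positive multiple of q ^ m - 1, the digit sums of a and b
-- together are at least e m (p - 1), which pays for `E` in full. If a + q b = 0, the sum over y
-- contributes q ^ m = p ^ (e m) instead. Divisibility by q - 1 has the same source: a + b ≡ a + q b
-- ≡ 0 modulo q - 1, so the multiplicities of the monomials of f also add up to a multiple of q - 1,
-- and the inner ceiling can be taken for every rotation separately.

module Arithmetic where

  open import Data.Nat.Base
  open import Data.Nat.Properties
  open import Relation.Binary.PropositionalEquality

  binomial-factorials : ∀ i j → ((i + j) C i) * (i ! * j !) ≡ (i + j) !
  binomial-factorials i j = begin
    ((i + j) C i) * (i ! * j !)                ≡⟨ cong (λ t → ((i + j) C i) * (i ! * t !)) (m+n∸m≡n i j) ⟨
    ((i + j) C i) * (i ! * (i + j ∸ i) !)      ≡⟨ cong (_* (i ! * (i + j ∸ i) !)) (nCk≡n!/k![n-k]! (m≤m+n i j)) ⟩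
    ((i + j) ! / (i ! * (i + j ∸ i) !)) * (i ! * (i + j ∸ i) !)
                                               ≡⟨ m/n*n≡m (k![n∸k]!∣n! (m≤m+n i j)) ⟩
    (i + j) !                                  ∎
    where
    open ≡-Reasoning
    instance _ = i !* (i + j ∸ i) !≢0

  prime∤! : ∀ {p} → Prime p → ∀ {k} → k < p → ¬ p ∣ k !
  prime∤! pr {zero}  k<p p∣1 = <⇒≱ (nonTrivial⇒n>1 _ {{prime⇒nonTrivial pr}}) (∣⇒≤ p∣1)
  prime∤! pr {suc k} k<p p∣k! with euclidsLemma (suc k) (k !) pr p∣k!
  ... | inj₁ p∣k = <⇒≱ k<p (∣⇒≤ p∣k)
  ... | inj₂ p∣! = prime∤! pr (<-trans (n<1+n k) k<p) p∣!

  prime∣binomial : ∀ {p} → Prime p → ∀ {i j} → suc i + suc j ≡ p → p ∣ p C suc i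
  prime∣binomial pr {i} {j} refl
    with euclidsLemma ((suc i + suc j) C suc i) (suc i ! * suc j !) pr
           (subst (suc i + suc j ∣_) (sym (binomial-factorials (suc i) (suc j))) (m∣m*n _))
  ... | inj₁ p∣C = p∣C
  ... | inj₂ p∣f with euclidsLemma (suc i !) (suc j !) pr p∣f
  ...   | inj₁ p∣i! = ⊥-elim (prime∤! pr (m<m+n (suc i) (s≤s z≤n)) p∣i!)
  ...   | inj₂ p∣j! = ⊥-elim (prime∤! pr (m<n+m (suc j) (s≤s z≤n)) p∣j!)

  prime-power-cancel : ∀ {p} → Prime p → ∀ b {m a} → ¬ p ∣ a → p ^ b ∣ m * a → p ^ b ∣ m
  prime-power-cancel pr zero p∤a _ = 1∣ _
  prime-power-cancel {p} pr (suc b) {m} {a} p∤a (divides k eq)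
    with euclidsLemma m a pr (divides (k * p ^ b) (trans eq
           (trans (cong (k *_) (*-comm p _)) (sym (*-assoc k _ p)))))
  ... | inj₂ p∣a = ⊥-elim (p∤a p∣a)
  ... | inj₁ (divides-refl m′) = subst (p ^ suc b ∣_) (*-comm p m′) (*-monoʳ-∣ p
          (prime-power-cancel pr b {m′} p∤a (*-cancelˡ-∣ p {{prime⇒nonZero pr}} (divides k
            (trans (sym (*-assoc p m′ a)) (trans (cong (_* a) (*-comm p m′)) eq))))))

  module FiniteSums where

    ∑< : ℕ → (ℕ → ℕ) → ℕ
    ∑< zero    g = 0
    ∑< (suc n) g = ∑< n g + g n

    ∑<-head : ∀ n g → ∑< (suc n) g ≡ g 0 + ∑< n (g ∘ suc)
    ∑<-head zero    g = +-comm 0 (g 0)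
    ∑<-head (suc n) g = trans (cong (_+ g (suc n)) (∑<-head n g)) (+-assoc (g 0) _ _)

    ∑<-cong : ∀ n {g h} → (∀ l → l < n → g l ≡ h l) → ∑< n g ≡ ∑< n h
    ∑<-cong zero    e = refl
    ∑<-cong (suc n) e = cong₂ _+_ (∑<-cong n λ l l<n → e l (m<n⇒m<1+n l<n)) (e n (n<1+n n))

    ∑<-+ : ∀ n g h → ∑< n (λ l → g l + h l) ≡ ∑< n g + ∑< n h
    ∑<-+ zero    g h = refl
    ∑<-+ (suc n) g h = trans (cong (_+ (g n + h n)) (∑<-+ n g h)) (interchange (∑< n g) (∑< n h) (g n) (h n))
      where
      interchange : ∀ a b c d → (a + b) + (c + d) ≡ (a + c) + (b + d)
      interchange = ℕ-Solver.solve-∀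

    ∑<-const : ∀ n c → ∑< n (λ _ → c) ≡ n * c
    ∑<-const zero    c = refl
    ∑<-const (suc n) c = trans (cong (_+ c) (∑<-const n c)) (+-comm (n * c) c)

    ∑<-mono : ∀ n {g h} → (∀ l → g l ≤ h l) → ∑< n g ≤ ∑< n h
    ∑<-mono zero    le = z≤n
    ∑<-mono (suc n) le = +-mono-≤ (∑<-mono n le) (le n)

    -- Moving the window by one place drops `f a` and gains `f (a + n)`, which are equal.
    ∑<-rotate : ∀ n f → (∀ a → f (a + n) ≡ f a) → ∀ a → ∑< n (λ l → f (a + l)) ≡ ∑< n f
    ∑<-rotate n f periodic zero    = refl
    ∑<-rotate n f periodic (suc a) = begin
      ∑< n (λ l → f (suc a + l))       ≡⟨ ∑<-cong n (λ l _ → cong f (+-suc a l)) ⟨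
      ∑< n (λ l → f (a + suc l))       ≡⟨ +-cancelˡ-≡ (f (a + 0)) _ _ (begin
        f (a + 0) + ∑< n (λ l → f (a + suc l))  ≡⟨ ∑<-head n (λ l → f (a + l)) ⟨
        ∑< n (λ l → f (a + l)) + f (a + n)      ≡⟨ +-comm _ (f (a + n)) ⟩
        f (a + n) + ∑< n (λ l → f (a + l))      ≡⟨ cong (_+ ∑< n (λ l → f (a + l)))
                                                     (trans (periodic a) (cong f (sym (+-identityʳ a)))) ⟩
        f (a + 0) + ∑< n (λ l → f (a + l))      ∎) ⟩
      ∑< n (λ l → f (a + l))           ≡⟨ ∑<-rotate n f periodic a ⟩
      ∑< n f                           ∎
      where open ≡-Reasoning

    module _ {ℓ} {X : Set ℓ} where

      total : (X → ℕ) → List X → ℕ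
      total g []       = 0
      total g (x ∷ xs) = g x + total g xs

      total-+ : ∀ g h xs → total (λ x → g x + h x) xs ≡ total g xs + total h xs
      total-+ g h []       = refl
      total-+ g h (x ∷ xs) = trans (cong (g x + h x +_) (total-+ g h xs)) (interchange (g x) (h x) _ _)
        where
        interchange : ∀ a b c d → (a + b) + (c + d) ≡ (a + c) + (b + d)
        interchange = ℕ-Solver.solve-∀

      total-*ˡ : ∀ c g xs → total (λ x → c * g x) xs ≡ c * total g xs
      total-*ˡ c g []       = sym (*-zeroʳ c)
      total-*ˡ c g (x ∷ xs) = trans (cong (c * g x +_) (total-*ˡ c g xs)) (sym (*-distribˡ-+ c (g x) _))

      total-cong : ∀ {g h} → (∀ x → g x ≡ h x) → ∀ xs → total g xs ≡ total h xs
      total-cong e []       = refl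
      total-cong e (x ∷ xs) = cong₂ _+_ (e x) (total-cong e xs)

      total-++ : ∀ g xs ys → total g (xs ++ ys) ≡ total g xs + total g ys
      total-++ g []       ys = refl
      total-++ g (x ∷ xs) ys = trans (cong (g x +_) (total-++ g xs ys)) (sym (+-assoc (g x) _ _))

      ∑<-total : ∀ n (g : X → ℕ → ℕ) xs → ∑< n (λ l → total (λ x → g x l) xs) ≡ total (λ x → ∑< n (g x)) xs
      ∑<-total n g []       = trans (∑<-const n 0) (*-zeroʳ n)
      ∑<-total n g (x ∷ xs) = trans (∑<-+ n (g x) _) (cong (∑< n (g x) +_) (∑<-total n g xs))

    total-map : ∀ {ℓ ℓ′} {X : Set ℓ} {Y : Set ℓ′} (g : Y → ℕ) (f : X → Y) xs →
                total g (List.map f xs) ≡ total (g ∘ f) xs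
    total-map g f []       = refl
    total-map g f (x ∷ xs) = cong (g (f x) +_) (total-map g f xs)

  open FiniteSums

  n<m^n : ∀ {m} → 1 < m → ∀ n → n < m ^ n
  n<m^n {m} 1<m zero    = s≤s z≤n
  n<m^n {m} 1<m (suc n) = begin-strict
    suc n                 <⟨ s≤s (n<m^n 1<m n) ⟩
    1 + m ^ n             ≤⟨ +-monoˡ-≤ (m ^ n) (≤-trans (s≤s z≤n) (n<m^n 1<m n)) ⟩
    m ^ n + m ^ n         ≡⟨ cong (m ^ n +_) (+-identityʳ (m ^ n)) ⟨
    2 * m ^ n             ≤⟨ *-monoˡ-≤ (m ^ n) 1<m ⟩
    m * m ^ n             ∎
    where open ≤-Reasoning

  -- `c` is a geometric sum. With r = q ^ m - 1 this makes powers of p periodic modulo q ^ m - 1;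
  -- with r = q - 1 it produces (q ^ m - 1) / (q - 1).
  suc^≡1 : ∀ r i → ∃[ c ] suc r ^ i ≡ 1 + c * r
  suc^≡1 r zero    = 0 , refl
  suc^≡1 r (suc i) = let c , e = suc^≡1 r i in 1 + c + r * c , trans (cong (suc r *_) e) (step r c)
    where
    step : ∀ q c → (1 + q) * (1 + c * q) ≡ 1 + (1 + c + q * c) * q
    step = ℕ-Solver.solve-∀

  -- Base-p digits and the valuations of factorials and multinomial coefficients

  module Legendre (o : ℕ) (pr : Prime (suc o)) where

    p = suc o

    1<p : 1 < p
    1<p = nonTrivial⇒n>1 p {{prime⇒nonTrivial pr}}

    p∤1 : ¬ p ∣ 1
    p∤1 p∣1 = <⇒≱ 1<p (∣⇒≤ p∣1)

    p∤* : ∀ {a b} → ¬ p ∣ a → ¬ p ∣ b → ¬ p ∣ a * b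
    p∤* {a} {b} p∤a p∤b p∣ab with euclidsLemma a b pr p∣ab
    ... | inj₁ p∣a = p∤a p∣a
    ... | inj₂ p∣b = p∤b p∣b

    -- The factors divisible by p are p, 2 p, ..., n p, with product `p ^ n * n !`; all other
    -- factors are prime to p and are collected in `u`.
    !-block : ∀ n r → r < p → ∃[ u ] (r + p * n) ! ≡ p ^ n * n ! * u × ¬ p ∣ u
    !-block zero    zero    _   = 1 , cong _! (*-zeroʳ p) , p∤1
    !-block (suc n) zero    _   =
      let u , e , p∤u = !-block n o ≤-refl in
      u , (begin
        (p * suc n) !                        ≡⟨ cong _! (*-suc p n) ⟩
        suc (o + p * n) * (o + p * n) !      ≡⟨ cong (suc (o + p * n) *_) e ⟩
        suc (o + p * n) * (p ^ n * n ! * u)  ≡⟨ regroup o n (p ^ n) (n !) u ⟩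
        p * p ^ n * (suc n * n !) * u        ∎) , p∤u
      where
      open ≡-Reasoning
      regroup : ∀ o n a b u → (1 + (o + (1 + o) * n)) * (a * b * u) ≡ (1 + o) * a * ((1 + n) * b) * u
      regroup = ℕ-Solver.solve-∀
    !-block n (suc r) r<p =
      let u , e , p∤u = !-block n r (<-trans (n<1+n r) r<p) in
      (suc r + p * n) * u , trans (cong ((suc r + p * n) *_) e) (regroup (suc r + p * n) (p ^ n * n !) u) ,
      p∤* (λ p∣ → <⇒≱ r<p (∣⇒≤ (∣m+n∣n⇒∣m p∣ (m∣m*n n)))) p∤u
      where
      regroup : ∀ a b u → a * (b * u) ≡ b * (a * u)
      regroup = ℕ-Solver.solve-∀
      ∣m+n∣n⇒∣m : ∀ {i m n} → i ∣ m + n → i ∣ n → i ∣ m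
      ∣m+n∣n⇒∣m {i} {m} {n} i∣m+n = ∣m+n∣m⇒∣n (subst (i ∣_) (+-comm m n) i∣m+n)

    -- A list of exponents represents the sum of the corresponding powers of p; the
    -- base-p expansion of n lists exponent i as often as the i-th digit says.
    value : List ℕ → ℕ
    value = total (p ^_)

    -- `value≡` alone would admit wasteful lists such as n copies of exponent 0. Since `factorial`
    -- and `p∤unit` make `val-n!` the valuation of n !, `legendre` forces the length of `digits` to
    -- be the base-p digit sum. It is Legendre's formula with the denominator p - 1 = `o` cleared.
    record Expansion (n : ℕ) : Set where
      field
        digits    : List ℕ
        val-n!    : ℕ
        unit      : ℕ
        value≡    : value digits ≡ n
        factorial : n ! ≡ p ^ val-n! * unit
        p∤unit    : ¬ p ∣ unit
        legendre  : n ≡ length digits + o * val-n!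

    expansion : ∀ n → Expansion n
    expansion = <-rec Expansion step
      where
      step : ∀ n → (∀ {m} → m < n → Expansion m) → Expansion n
      step zero rec = record
        { digits = [] ; val-n! = 0 ; unit = 1 ; value≡ = refl ; factorial = refl
        ; p∤unit = p∤1 ; legendre = sym (*-zeroʳ o) }
      step n@(suc _) rec = record
        { digits    = replicate r 0 ++ List.map suc E.digits
        ; val-n!    = n′ + E.val-n!
        ; unit      = E.unit * u
        ; value≡    = begin
            value (replicate r 0 ++ List.map suc E.digits)   ≡⟨ total-++ (p ^_) (replicate r 0) _ ⟩
            value (replicate r 0) + value (List.map suc E.digits)
              ≡⟨ cong₂ _+_ (value-replicate r) (trans (total-map (p ^_) suc E.digits) (total-*ˡ p (p ^_) E.digits)) ⟩
            r + p * value E.digits                           ≡⟨ cong (λ t → r + p * t) E.value≡ ⟩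
            r + p * n′                                       ≡⟨ n≡ ⟨
            n                                                ∎
        ; factorial = begin
            n !                                              ≡⟨ cong _! n≡ ⟩
            (r + p * n′) !                                   ≡⟨ e ⟩
            p ^ n′ * n′ ! * u                                ≡⟨ cong (λ t → p ^ n′ * t * u) E.factorial ⟩
            p ^ n′ * (p ^ E.val-n! * E.unit) * u             ≡⟨ regroup (p ^ n′) (p ^ E.val-n!) E.unit u ⟩
            p ^ n′ * p ^ E.val-n! * (E.unit * u)             ≡⟨ cong (_* (E.unit * u)) (^-distribˡ-+-* p n′ E.val-n!) ⟨
            p ^ (n′ + E.val-n!) * (E.unit * u)               ∎
        ; p∤unit    = p∤* E.p∤unit p∤u
        ; legendre  = begin
            n                                                ≡⟨ n≡ ⟩
            r + (n′ + o * n′)                                ≡⟨ cong (λ t → r + (t + o * n′)) E.legendre ⟩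
            r + ((length E.digits + o * E.val-n!) + o * n′)  ≡⟨ collect r (length E.digits) o E.val-n! n′ ⟩
            r + length E.digits + o * (n′ + E.val-n!)        ≡⟨ cong (_+ o * (n′ + E.val-n!)) length≡ ⟨
            length (replicate r 0 ++ List.map suc E.digits) + o * (n′ + E.val-n!) ∎
        }
        where
        open ≡-Reasoning
        n′ = n / p
        r = n % p
        module E = Expansion (rec {n′} (m/n<m n p 1<p))
        block = !-block n′ r (m%n<n n p)
        u = proj₁ block
        e = proj₁ (proj₂ block)
        p∤u = proj₂ (proj₂ block)
        n≡ : n ≡ r + p * n′
        n≡ = trans (m≡m%n+[m/n]*n n p) (cong (r +_) (*-comm n′ p))
        value-replicate : ∀ r → value (replicate r 0) ≡ r
        value-replicate zero    = refl
        value-replicate (suc r) = cong suc (value-replicate r)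
        length≡ : length (replicate r 0 ++ List.map suc E.digits) ≡ r + length E.digits
        length≡ = trans (List.length-++ (replicate r 0))
                        (cong₂ _+_ (List.length-replicate r) (List.length-map suc E.digits))
        regroup : ∀ a b c d → a * (b * c) * d ≡ a * b * (c * d)
        regroup = ℕ-Solver.solve-∀
        collect : ∀ r l o v n → r + ((l + o * v) + o * n) ≡ r + l + o * (n + v)
        collect = ℕ-Solver.solve-∀

    module E n = Expansion (expansion n)

    -- One direction of Legendre's formula, v ≥ (n - s) / (p - 1) for n of digit sum s. It concerns
    -- the numerator n ! of a multinomial coefficient, whose valuation is to be bounded from below,
    -- and it passes to `r + p * n` by appending the digit r.
    ValuationBound : ℕ → ℕ → Set
    ValuationBound n s = ∃[ v ] (p ^ v ∣ n ! × n ≤ s + o * v)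

    valuationBound-block : ∀ {n s} r → r < p → ValuationBound n s → ValuationBound (r + p * n) (r + s)
    valuationBound-block {n} {s} r r<p (v , p^v∣n! , n≤) =
      let u , e , _ = !-block n r r<p in
      n + v ,
      subst₂ _∣_ (sym (^-distribˡ-+-* p n v)) (sym e) (∣m⇒∣m*n u (*-monoʳ-∣ (p ^ n) p^v∣n!)) ,
      (begin
        r + (n + o * n)            ≤⟨ +-monoʳ-≤ r (+-monoˡ-≤ (o * n) n≤) ⟩
        r + ((s + o * v) + o * n)  ≡⟨ collect r s o v n ⟩
        r + s + o * (n + v)        ∎)
      where
      open ≤-Reasoning
      collect : ∀ r s o v n → r + ((s + o * v) + o * n) ≡ r + s + o * (n + v)
      collect = ℕ-Solver.solve-∀

    -- The base-p digits of (p ^ L - 1) * p ^ n are L times p - 1 and n times 0.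
    valuationBound-[P-1]p^n : ∀ L {Q} → suc Q ≡ p ^ L → ∀ n → ValuationBound (Q * p ^ n) (L * o)
    valuationBound-[P-1]p^n L {Q} Q≡ (suc n) = subst (λ t → ValuationBound t (L * o)) (regroup p Q (p ^ n))
      (valuationBound-block 0 (s≤s z≤n) (valuationBound-[P-1]p^n L Q≡ n))
      where
      regroup : ∀ p Q a → p * (Q * a) ≡ Q * (p * a)
      regroup = ℕ-Solver.solve-∀
    valuationBound-[P-1]p^n L Q≡ zero = subst (λ t → ValuationBound t (L * o)) (sym (*-identityʳ _)) (go L Q≡)
      where
      go : ∀ L {Q} → suc Q ≡ p ^ L → ValuationBound Q (L * o)
      go zero    {zero} refl = 0 , 1∣ 1 , z≤n
      go (suc L) {Q} Q≡ = subst (λ t → ValuationBound t (o + L * o)) o+pQ′≡Q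
        (valuationBound-block o ≤-refl (go L (suc-pred (p ^ L) {{m^n≢0 p L}})))
        where
        Q′ = pred (p ^ L)
        o+pQ′≡Q : o + p * Q′ ≡ Q
        o+pQ′≡Q = suc-injective (trans (sym (*-suc p Q′))
          (trans (cong (p *_) (suc-pred (p ^ L) {{m^n≢0 p L}})) (sym Q≡)))

    -- The valuation of `w` is at least that of n ! minus those of all j !; as the j add up to n,
    -- Legendre's formula turns the difference into one of digit sums. The subtraction `vₙ ∸ V` may
    -- be truncated, because `vₙ ≤ V + (vₙ ∸ V)` holds in any case.
    multinomial-valuation : ∀ js {w n s} → ValuationBound n s → total (λ j → j) js ≡ n →
      w * List.foldr (λ j x → j ! * x) 1 js ≡ n ! →
      ∃[ v ] (p ^ v ∣ w × total (length ∘ E.digits) js ≤ s + o * v)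
    multinomial-valuation js {w} {n} {s} (vₙ , p^vₙ∣n! , n≤) ∑j≡n w∏≡n! = vₙ ∸ V , p^∣w , Λ≤
      where
      V = total E.val-n! js
      U = List.foldr (λ j x → E.unit j * x) 1 js
      Λ = total (length ∘ E.digits) js

      factor : ∀ js → List.foldr (λ j x → j ! * x) 1 js ≡
               p ^ total E.val-n! js * List.foldr (λ j x → E.unit j * x) 1 js
      factor []       = refl
      factor (j ∷ js) = begin
        j ! * List.foldr (λ j x → j ! * x) 1 js   ≡⟨ cong₂ _*_ (E.factorial j) (factor js) ⟩
        (p ^ E.val-n! j * E.unit j) * (p ^ total E.val-n! js * U′)
          ≡⟨ regroup (p ^ E.val-n! j) (E.unit j) (p ^ total E.val-n! js) U′ ⟩
        (p ^ E.val-n! j * p ^ total E.val-n! js) * (E.unit j * U′)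
          ≡⟨ cong (_* (E.unit j * U′)) (^-distribˡ-+-* p (E.val-n! j) _) ⟨
        p ^ (E.val-n! j + total E.val-n! js) * (E.unit j * U′) ∎
        where
        open ≡-Reasoning
        U′ = List.foldr (λ j x → E.unit j * x) 1 js
        regroup : ∀ a b c d → (a * b) * (c * d) ≡ (a * c) * (b * d)
        regroup = ℕ-Solver.solve-∀

      p∤U : ∀ js → ¬ p ∣ List.foldr (λ j x → E.unit j * x) 1 js
      p∤U []       = p∤1
      p∤U (j ∷ js) = p∤* (E.p∤unit j) (p∤U js)

      p^∣wp^V : p ^ vₙ ∣ w * p ^ V
      p^∣wp^V = prime-power-cancel pr vₙ {w * p ^ V} (p∤U js) (subst (p ^ vₙ ∣_)
        (trans (sym w∏≡n!) (trans (cong (w *_) (factor js)) (sym (*-assoc w (p ^ V) U)))) p^vₙ∣n!)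

      p^∣w : p ^ (vₙ ∸ V) ∣ w
      p^∣w with ≤-total V vₙ
      ... | inj₂ vₙ≤V = subst (λ t → p ^ t ∣ w) (sym (m≤n⇒m∸n≡0 vₙ≤V)) (1∣ w)
      ... | inj₁ V≤vₙ = *-cancelʳ-∣ (p ^ V) {{m^n≢0 p V}} (subst (_∣ w * p ^ V)
            (trans (cong (p ^_) (sym (m∸n+n≡m V≤vₙ))) (^-distribˡ-+-* p (vₙ ∸ V) V)) p^∣wp^V)

      Λ≤ : Λ ≤ s + o * (vₙ ∸ V)
      Λ≤ = +-cancelʳ-≤ (o * V) Λ _ (begin
        Λ + o * V                       ≡⟨ trans (total-cong E.legendre js) (trans (total-+ _ _ js)
                                             (cong (Λ +_) (total-*ˡ o E.val-n! js))) ⟨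
        total (λ j → j) js              ≡⟨ ∑j≡n ⟩
        n                               ≤⟨ n≤ ⟩
        s + o * vₙ                      ≤⟨ +-monoʳ-≤ s (*-monoʳ-≤ o (m≤n+m∸n vₙ V)) ⟩
        s + o * (V + (vₙ ∸ V))          ≡⟨ collect s o V (vₙ ∸ V) ⟩
        s + o * (vₙ ∸ V) + o * V        ∎)
        where
        open ≤-Reasoning
        collect : ∀ s o a b → s + o * (a + b) ≡ s + o * b + o * a
        collect = ℕ-Solver.solve-∀

  -- Exponent vectors of products of monomials

  isZero : ℕ → ℕ
  isZero zero    = 1
  isZero (suc _) = 0

  zeros : ∀ {k} → Vec ℕ k → ℕ
  zeros []       = 0
  zeros (m ∷ ms) = isZero m + zeros ms

  -- For g the identity this is the exponent vector of the product of the monomials with their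
  -- multiplicities; other g replace each multiplicity j by its rotation.
  combination : ∀ {k} → (ℕ → ℕ) → List (Vec ℕ k × ℕ) → Vec ℕ k
  combination g zs = Vec.tabulate (λ i → total (λ z → g (proj₂ z) * lookup (proj₁ z) i) zs)

  sum-combination : ∀ {k} g (zs : List (Vec ℕ k × ℕ)) →
    Vec.sum (combination g zs) ≡ total (λ z → g (proj₂ z) * Vec.sum (proj₁ z)) zs
  sum-combination {zero}  g zs = sym (trans (total-cong (λ { ([] , j) → *-zeroʳ (g j) }) zs) (total-zero zs))
    where
    total-zero : ∀ {ℓ} {X : Set ℓ} (xs : List X) → total (λ _ → 0) xs ≡ 0
    total-zero []       = refl
    total-zero (_ ∷ xs) = total-zero xs
  sum-combination {suc k} g zs = begin
    total (λ z → g (proj₂ z) * lookup (proj₁ z) Fin.zero) zs +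
      Vec.sum (Vec.tabulate λ i → total (λ z → g (proj₂ z) * lookup (proj₁ z) (Fin.suc i)) zs)
      ≡⟨ cong (total (λ z → g (proj₂ z) * lookup (proj₁ z) Fin.zero) zs +_) (cong Vec.sum (Vec.tabulate-cong λ i →
           trans (total-cong (λ { (_ ∷ _ , _) → refl }) zs)
                 (sym (total-map (λ z → g (proj₂ z) * lookup (proj₁ z) i) tails zs)))) ⟩
    total (λ z → g (proj₂ z) * lookup (proj₁ z) Fin.zero) zs + Vec.sum (combination g (List.map tails zs))
      ≡⟨ cong (total (λ z → g (proj₂ z) * lookup (proj₁ z) Fin.zero) zs +_)
           (trans (sum-combination g (List.map tails zs)) (total-map _ tails zs)) ⟩
    total (λ z → g (proj₂ z) * lookup (proj₁ z) Fin.zero) zs + total (λ z → g (proj₂ z) * Vec.sum (Vec.tail (proj₁ z))) zs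
      ≡⟨ total-+ _ _ zs ⟨
    total (λ z → g (proj₂ z) * lookup (proj₁ z) Fin.zero + g (proj₂ z) * Vec.sum (Vec.tail (proj₁ z))) zs
      ≡⟨ total-cong (λ { (m ∷ μ , j) → sym (*-distribˡ-+ (g j) m (Vec.sum μ)) }) zs ⟩
    total (λ z → g (proj₂ z) * Vec.sum (proj₁ z)) zs
      ∎
    where
    open ≡-Reasoning
    tails : Vec ℕ (suc k) × ℕ → Vec ℕ k × ℕ
    tails (μ , j) = Vec.tail μ , j

  -- Cyclic rotation of digits modulo L, and the bound for a single multinomial term

  module Rotation (o : ℕ) (pr : Prime (suc o)) (L : ℕ) .{{_ : NonZero L}} (Q : ℕ) (Q≡ : suc Q ≡ suc o ^ L) where

    open Legendre o pr

    cyclicPower : ℕ → ℕ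
    cyclicPower a = p ^ (a % L)

    -- The number whose base-p digits, read modulo L, are those of D moved up by l places.
    rotate : List ℕ → ℕ → ℕ
    rotate D l = total (λ a → cyclicPower (a + l)) D

    -- Modulo Q the power `p ^ L = 1 + Q` is 1, so only `a % L` matters. Reducing the exponent never
    -- increases the power, so the congruence can be stated with a natural multiple of Q.
    p^≡cyclic : ∀ a → ∃[ c ] p ^ a ≡ cyclicPower a + c * Q
    p^≡cyclic a = let c , e = suc^≡1 Q (a / L) in cyclicPower a * c , (begin
      p ^ a                                 ≡⟨ cong (p ^_) (m≡m%n+[m/n]*n a L) ⟩
      p ^ (a % L + a / L * L)               ≡⟨ ^-distribˡ-+-* p (a % L) _ ⟩
      cyclicPower a * p ^ (a / L * L)       ≡⟨ cong (λ t → cyclicPower a * p ^ t) (*-comm (a / L) L) ⟩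
      cyclicPower a * p ^ (L * (a / L))     ≡⟨ cong (cyclicPower a *_) (^-*-assoc p L (a / L)) ⟨
      cyclicPower a * (p ^ L) ^ (a / L)     ≡⟨ cong (λ t → cyclicPower a * t ^ (a / L)) Q≡ ⟨
      cyclicPower a * suc Q ^ (a / L)       ≡⟨ cong (cyclicPower a *_) e ⟩
      cyclicPower a * (1 + c * Q)           ≡⟨ regroup (cyclicPower a) c Q ⟩
      cyclicPower a + cyclicPower a * c * Q ∎)
      where
      open ≡-Reasoning
      regroup : ∀ a c q → a * (1 + c * q) ≡ a + a * c * q
      regroup = ℕ-Solver.solve-∀

    rotate-value : ∀ D l → ∃[ c ] p ^ l * value D ≡ rotate D l + c * Q
    rotate-value []      l = 0 , *-zeroʳ (p ^ l)
    rotate-value (a ∷ D) l =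
      let c , e = p^≡cyclic (a + l) ; c′ , e′ = rotate-value D l in
      c + c′ , (begin
        p ^ l * (p ^ a + value D)                                 ≡⟨ *-distribˡ-+ (p ^ l) (p ^ a) _ ⟩
        p ^ l * p ^ a + p ^ l * value D                           ≡⟨ cong (_+ p ^ l * value D) (trans (*-comm (p ^ l) (p ^ a))
                                                                       (sym (^-distribˡ-+-* p a l))) ⟩
        p ^ (a + l) + p ^ l * value D                             ≡⟨ cong₂ _+_ e e′ ⟩
        (cyclicPower (a + l) + c * Q) + (rotate D l + c′ * Q)     ≡⟨ regroup (cyclicPower (a + l)) c Q (rotate D l) c′ ⟩
        (cyclicPower (a + l) + rotate D l) + (c + c′) * Q         ∎)
      where
      open ≡-Reasoning
      regroup : ∀ x c q y c′ → (x + c * q) + (y + c′ * q) ≡ (x + y) + (c + c′) * q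
      regroup = ℕ-Solver.solve-∀

    -- A congruence modulo Q cannot tell 0 from Q. Rotation keeps positive numbers positive, so a
    -- rotated positive multiple of Q is still at least Q.
    rotate≡0 : ∀ D l → rotate D l ≡ 0 → value D ≡ 0
    rotate≡0 []      l _ = refl
    rotate≡0 (a ∷ D) l e = ⊥-elim (m^n≢0′ (m+n≡0⇒m≡0 _ e))
      where
      m^n≢0′ : ¬ cyclicPower (a + l) ≡ 0
      m^n≢0′ = ≢-nonZero⁻¹ _ {{m^n≢0 p ((a + l) % L)}}

    -- In the course of L rotations a digit visits every place once, and 1 + p + ... + p ^ (L - 1) =
    -- Q / (p - 1).
    ∑-cyclicPower : ∀ a → ∑< L (λ l → cyclicPower (a + l)) * o ≡ Q
    ∑-cyclicPower a = begin
      ∑< L (λ l → cyclicPower (a + l)) * o   ≡⟨ cong (_* o) (∑<-rotate L cyclicPower (λ b → cong (p ^_) ([m+n]%n≡m%n b L)) a) ⟩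
      ∑< L cyclicPower * o                   ≡⟨ cong (_* o) (∑<-cong L λ l l<L → cong (p ^_) (m<n⇒m%n≡m l<L)) ⟩
      ∑< L (p ^_) * o                        ≡⟨ suc-injective (trans (geometric L) (sym Q≡)) ⟩
      Q                                      ∎
      where
      open ≡-Reasoning
      geometric : ∀ n → suc (∑< n (p ^_) * o) ≡ p ^ n
      geometric zero    = refl
      geometric (suc n) = trans (cong suc (*-distribʳ-+ o (∑< n (p ^_)) (p ^ n)))
        (trans (cong (_+ p ^ n * o) (geometric n)) (trans (cong (p ^ n +_) (*-comm (p ^ n) o)) refl))

    -- Summed over all rotations, a number is remembered only through its digit sum. The offset s
    -- serves `y ^ q`, whose multiplicity is rotated by e further places.
    ∑-rotate : ∀ D s → ∑< L (λ l → rotate D (l + s)) * o ≡ length D * Q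
    ∑-rotate D s = trans (cong (_* o) (∑<-total L (λ a l → cyclicPower (a + (l + s))) D)) (go D)
      where
      go : ∀ D → total (λ a → ∑< L (λ l → cyclicPower (a + (l + s)))) D * o ≡ length D * Q
      go []      = refl
      go (a ∷ D) = trans (*-distribʳ-+ o (∑< L (λ l → cyclicPower (a + (l + s)))) _) (cong₂ _+_
        (trans (cong (_* o) (∑<-cong L λ l _ → cong cyclicPower (trans (cong (a +_) (+-comm l s)) (sym (+-assoc a s l)))))
               (∑-cyclicPower (a + s)))
        (go D))

    ρ : ℕ → ℕ → ℕ
    ρ j l = rotate (E.digits j) l

    ρ-value : ∀ j l → ∃[ c ] p ^ l * j ≡ ρ j l + c * Q
    ρ-value j l = let c , e = rotate-value (E.digits j) l in c , trans (cong (p ^ l *_) (sym (E.value≡ j))) e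

    ρ≡0 : ∀ j l → ρ j l ≡ 0 → j ≡ 0
    ρ≡0 j l e = trans (sym (E.value≡ j)) (rotate≡0 (E.digits j) l e)

    total-ρ : ∀ {ℓ} {X : Set ℓ} (g h : X → ℕ) l xs →
              ∃[ c ] p ^ l * total (λ x → g x * h x) xs ≡ total (λ x → ρ (g x) l * h x) xs + c * Q
    total-ρ g h l []       = 0 , *-zeroʳ (p ^ l)
    total-ρ g h l (x ∷ xs) =
      let c , e = ρ-value (g x) l ; c′ , e′ = total-ρ g h l xs in
      c * h x + c′ , (begin
        p ^ l * (g x * h x + total (λ x → g x * h x) xs)            ≡⟨ spread (p ^ l) (g x) (h x) _ ⟩
        (p ^ l * g x) * h x + p ^ l * total (λ x → g x * h x) xs    ≡⟨ cong₂ (λ s t → s * h x + t) e e′ ⟩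
        (ρ (g x) l + c * Q) * h x + (T + c′ * Q)                    ≡⟨ regroup (ρ (g x) l) c Q (h x) T c′ ⟩
        (ρ (g x) l * h x + T) + (c * h x + c′) * Q                  ∎)
      where
      open ≡-Reasoning
      T = total (λ x → ρ (g x) l * h x) xs
      spread : ∀ p g h t → p * (g * h + t) ≡ (p * g) * h + p * t
      spread = ℕ-Solver.solve-∀
      regroup : ∀ r c q h t c′ → (r + c * q) * h + (t + c′ * q) ≡ (r * h + t) + (c * h + c′) * q
      regroup = ℕ-Solver.solve-∀

    total-ρ≡0 : ∀ {ℓ} {X : Set ℓ} (g h : X → ℕ) l xs →
                total (λ x → ρ (g x) l * h x) xs ≡ 0 → total (λ x → g x * h x) xs ≡ 0
    total-ρ≡0 g h l []       _ = refl
    total-ρ≡0 g h l (x ∷ xs) e = cong₂ _+_ head≡0 (total-ρ≡0 g h l xs (m+n≡0⇒n≡0 (ρ (g x) l * h x) e))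
      where
      head≡0 : g x * h x ≡ 0
      head≡0 with m*n≡0⇒m≡0∨n≡0 (ρ (g x) l) (m+n≡0⇒m≡0 (ρ (g x) l * h x) e)
      ... | inj₁ ρ≡ = cong (_* h x) (ρ≡0 (g x) l ρ≡)
      ... | inj₂ h≡ = trans (cong (g x *_) h≡) (*-zeroʳ (g x))

    ∣-rotate : ∀ {m c r i} l → i ∣ Q → p ^ l * m ≡ r + c * Q → i ∣ m → i ∣ r
    ∣-rotate {m} {c} {r} {i} l i∣Q e i∣m = ∣m+n∣m⇒∣n
      (subst (i ∣_) (trans e (+-comm r (c * Q))) (∣n⇒∣m*n (p ^ l) i∣m)) (∣n⇒∣m*n c i∣Q)

    -- d, k, e, r = q - 1 and K = (q ^ m - 1) / (q - 1) are as in the theorem, L = e m, Q = q ^ m - 1;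
    -- C and B are the inner and the outer ceiling.
    module TermBound (e r K d k C B : ℕ) .{{_ : NonZero d}} .{{_ : NonZero Q}} (r≡ : suc r ≡ p ^ e) (Q≡Kr : Q ≡ K * r)
      (C-least : ∀ t → k * Q ≤ t * (d * r) → C ≤ t)
      (B-least : ∀ t → (L * r) * C ≤ t * Q → B ≤ t) where

      q = suc r

      r∣Q : r ∣ Q
      r∣Q = divides K Q≡Kr

      C≤kK : C ≤ k * K
      C≤kK = C-least (k * K) (begin
        k * Q              ≡⟨ cong (k *_) Q≡Kr ⟩
        k * (K * r)        ≤⟨ m≤n*m (k * (K * r)) d ⟩
        d * (k * (K * r))  ≡⟨ regroup d k K r ⟩
        k * K * (d * r)    ∎)
        where
        open ≤-Reasoning
        regroup : ∀ d k K r → d * (k * (K * r)) ≡ k * K * (d * r)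
        regroup = ℕ-Solver.solve-∀

      -- Ensures that the number of all points, p ^ (L (k + 1)), is 0 modulo I ^ B.
      B≤Lk : B ≤ L * k
      B≤Lk = B-least (L * k) (begin
        (L * r) * C          ≤⟨ *-monoʳ-≤ (L * r) C≤kK ⟩
        (L * r) * (k * K)    ≡⟨ regroup L r k K ⟩
        L * k * (K * r)      ≡⟨ cong (L * k *_) Q≡Kr ⟨
        L * k * Q            ∎)
        where
        open ≤-Reasoning
        regroup : ∀ L r k K → (L * r) * (k * K) ≡ L * k * (K * r)
        regroup = ℕ-Solver.solve-∀

      weight : List (Vec ℕ k × ℕ) → ℕ → ℕ
      weight zs l = total (λ z → ρ (proj₂ z) l) zs

      degreeLength : List (Vec ℕ k × ℕ) → ℕ
      degreeLength zs = total (λ z → length (E.digits (proj₂ z))) zs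

      -- Each of the k variables is worth Q: one with exponent 0 in M is counted by `zeros`, any
      -- other by its rotated exponent in W.
      count : ∀ {k} (M W : Vec ℕ k) → (∀ i → lookup M i ≡ 0 ⊎ Q ≤ lookup W i) → k * Q ≤ zeros M * Q + Vec.sum W
      count []      []      _ = z≤n
      count (m ∷ M) (w ∷ W) h = ≤-trans (+-mono-≤ (head m (h Fin.zero)) (count M W (h ∘ Fin.suc)))
        (≤-reflexive (regroup (isZero m) Q w (zeros M) (Vec.sum W)))
        where
        head : ∀ m → m ≡ 0 ⊎ Q ≤ w → Q ≤ isZero m * Q + w
        head zero    _          = ≤-trans (m≤m+n Q 0) (m≤m+n (Q + 0) w)
        head (suc _) (inj₂ Q≤w) = Q≤w
        regroup : ∀ a q w z s → (a * q + w) + (z * q + s) ≡ (a + z) * q + (w + s)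
        regroup = ℕ-Solver.solve-∀

      module _ (zs : List (Vec ℕ k × ℕ)) (deg : All (λ z → Vec.sum (proj₁ z) ≤ d) zs)
               (Q∣M : ∀ i → Q ∣ lookup (combination (λ j → j) zs) i)
               (r∣∑ : r ∣ total proj₂ zs) where

        private
          M = combination (λ j → j) zs

        -- The degree bound turns the rotated exponents counted by `count` into at most `d` times
        -- the weight. Weight and Q are both multiples of r = q - 1, so after division by d r the
        -- estimate bounds an integer from below and can be rounded up to the ceiling C.
        weight-bound : ∀ l → r * C ≤ weight zs l + zeros M * Q
        weight-bound l = begin
          r * C                              ≤⟨ *-monoʳ-≤ r (C-least (t + zeros M * K) kQ≤) ⟩
          r * (t + zeros M * K)              ≡⟨ regroup r t (zeros M) K ⟩
          t * r + zeros M * (K * r)          ≡⟨ cong₂ (λ x y → x + zeros M * y) (sym t≡) (sym Q≡Kr) ⟩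
          weight zs l + zeros M * Q          ∎
          where
          open ≤-Reasoning
          r∣weight : r ∣ weight zs l
          r∣weight = let c , e = total-ρ proj₂ (λ _ → 1) l zs in
            subst (r ∣_) (total-cong (λ z → *-identityʳ _) zs)
              (∣-rotate {total (λ z → proj₂ z * 1) zs} {c} l r∣Q e
                (subst (r ∣_) (sym (total-cong (λ z → *-identityʳ _) zs)) r∣∑))
          t = quotient r∣weight
          t≡ : weight zs l ≡ t * r
          t≡ = _∣_.equality r∣weight
          W = combination (λ j → ρ j l) zs

          coordinate : ∀ i → lookup M i ≡ 0 ⊎ Q ≤ lookup W i
          coordinate i with lookup W i in W≡ | Q ≤? lookup W i
          -- A rotated exponent is a sum of rotated multiplicities times exponents, so if it
          -- vanishes then the original exponent vanishes too; otherwise it is a positive multiple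
          -- of Q.
          ... | zero    | _ = inj₁ (trans (Vec.lookup∘tabulate _ i)
                  (total-ρ≡0 proj₂ (λ z → lookup (proj₁ z) i) l zs (trans (sym (Vec.lookup∘tabulate _ i)) W≡)))
          ... | suc w   | _ = inj₂ (subst (Q ≤_) W≡ (∣⇒≤ {{subst NonZero (sym W≡) _}} Q∣W))
            where
            Q∣W : Q ∣ lookup W i
            Q∣W = let c , e = total-ρ proj₂ (λ z → lookup (proj₁ z) i) l zs in
              subst (Q ∣_) (sym (Vec.lookup∘tabulate _ i))
                (∣-rotate {c = c} l ∣-refl e (subst (Q ∣_) (Vec.lookup∘tabulate _ i) (Q∣M i)))

          sum-W≤ : Vec.sum W ≤ weight zs l * d
          sum-W≤ = ≤-trans (≤-reflexive (sum-combination (λ j → ρ j l) zs)) (go zs deg)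
            where
            go : ∀ zs → All (λ z → Vec.sum (proj₁ z) ≤ d) zs →
                 total (λ z → ρ (proj₂ z) l * Vec.sum (proj₁ z)) zs ≤ weight zs l * d
            go []       []         = z≤n
            go (z ∷ zs) (le ∷ les) = ≤-trans (+-mono-≤ (*-monoʳ-≤ (ρ (proj₂ z) l) le) (go zs les))
              (≤-reflexive (sym (*-distribʳ-+ d (ρ (proj₂ z) l) _)))

          kQ≤ : k * Q ≤ (t + zeros M * K) * (d * r)
          kQ≤ = begin
            k * Q                                      ≤⟨ count M W coordinate ⟩
            -- The variables with exponent 0 are counted d times over, which makes both summands
            -- multiples of `d * r`.
            zeros M * Q + Vec.sum W                    ≤⟨ +-mono-≤ (m≤n*m (zeros M * Q) d) sum-W≤ ⟩
            d * (zeros M * Q) + weight zs l * d        ≡⟨ cong₂ (λ x y → d * (zeros M * x) + y * d) Q≡Kr t≡ ⟩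
            d * (zeros M * (K * r)) + (t * r) * d      ≡⟨ regroup₂ d (zeros M) K r t ⟩
            (t + zeros M * K) * (d * r)                ∎
            where
            regroup₂ : ∀ d z K r t → d * (z * (K * r)) + (t * r) * d ≡ (t + z * K) * (d * r)
            regroup₂ = ℕ-Solver.solve-∀
          regroup : ∀ r t z K → r * (t + z * K) ≡ t * r + z * (K * r)
          regroup = ℕ-Solver.solve-∀

        length-bound : o * ((L * r) * C) ≤ (degreeLength zs + o * (L * zeros M)) * Q
        length-bound = begin
          o * ((L * r) * C)                                      ≡⟨ cong (o *_) (*-assoc L r C) ⟩
          o * (L * (r * C))                                      ≡⟨ cong (o *_) (∑<-const L (r * C)) ⟨
          o * ∑< L (λ _ → r * C)                                 ≤⟨ *-monoʳ-≤ o (∑<-mono L weight-bound) ⟩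
          o * ∑< L (λ l → weight zs l + zeros M * Q)             ≡⟨ cong (o *_) (trans (∑<-+ L (weight zs) _)
                                                                      (cong (∑< L (weight zs) +_) (∑<-const L (zeros M * Q)))) ⟩
          o * (∑< L (weight zs) + L * (zeros M * Q))             ≡⟨ regroup o (∑< L (weight zs)) L (zeros M) Q ⟩
          ∑< L (weight zs) * o + o * (L * zeros M) * Q           ≡⟨ cong (_+ o * (L * zeros M) * Q) (∑weight zs) ⟩
          degreeLength zs * Q + o * (L * zeros M) * Q            ≡⟨ *-distribʳ-+ Q (degreeLength zs) _ ⟨
          (degreeLength zs + o * (L * zeros M)) * Q              ∎
          where
          open ≤-Reasoning
          regroup : ∀ o s L z q → o * (s + L * (z * q)) ≡ s * o + o * (L * z) * q
          regroup = ℕ-Solver.solve-∀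
          ∑weight : ∀ zs → ∑< L (weight zs) * o ≡ degreeLength zs * Q
          ∑weight zs = trans (cong (_* o) (∑<-total L (λ z l → ρ (proj₂ z) l) zs)) (go zs)
            where
            go : ∀ zs → total (λ z → ∑< L (ρ (proj₂ z))) zs * o ≡ degreeLength zs * Q
            go []       = refl
            go (z ∷ zs) = trans (*-distribʳ-+ o (∑< L (ρ (proj₂ z))) _)
              (trans (cong₂ _+_ (trans (cong (_* o) (∑<-cong L λ l _ → cong (ρ (proj₂ z)) (sym (+-identityʳ l)))) (∑-rotate (E.digits (proj₂ z)) 0)) (go zs))
                     (sym (*-distribʳ-+ Q (length (E.digits (proj₂ z))) _)))

      -- Since q = p ^ e, the number `ρ a l + ρ b (l + e)` is congruent to p ^ l (a + q b) modulo Q.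
      -- For a + q b positive it is thus a positive multiple of Q for each of the L values of l, and
      -- summing over l yields the digit sums. For a + q b = 0 the `isZero` term alone gives the
      -- bound.
      y-bound : ∀ a b → Q ∣ a + q * b →
                L * o ≤ (length (E.digits a) + length (E.digits b)) + isZero (a + q * b) * (L * o)
      y-bound a b Q∣M with a + q * b in M≡
      ... | zero  = ≤-trans (m≤m+n (L * o) 0) (m≤n+m (L * o + 0) (length (E.digits a) + length (E.digits b)))
      ... | suc M = ≤-trans (*-cancelʳ-≤ _ _ Q (begin
        L * o * Q                                                ≡⟨ regroup₁ L o Q ⟩
        (L * Q) * o                                              ≡⟨ cong (_* o) (∑<-const L Q) ⟨
        ∑< L (λ _ → Q) * o                                       ≤⟨ *-monoˡ-≤ o (∑<-mono L Q≤) ⟩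
        ∑< L (λ l → ρ a (l + 0) + ρ b (l + e)) * o               ≡⟨ cong (_* o) (∑<-+ L (λ l → ρ a (l + 0)) (λ l → ρ b (l + e))) ⟩
        (∑< L (λ l → ρ a (l + 0)) + ∑< L (λ l → ρ b (l + e))) * o ≡⟨ *-distribʳ-+ o (∑< L (λ l → ρ a (l + 0))) _ ⟩
        ∑< L (λ l → ρ a (l + 0)) * o + ∑< L (λ l → ρ b (l + e)) * o
          ≡⟨ cong₂ _+_ (∑-rotate (E.digits a) 0) (∑-rotate (E.digits b) e) ⟩
        length (E.digits a) * Q + length (E.digits b) * Q        ≡⟨ *-distribʳ-+ Q (length (E.digits a)) _ ⟨
        (length (E.digits a) + length (E.digits b)) * Q          ∎)) (m≤m+n _ 0)
        where
        open ≤-Reasoning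
        regroup₁ : ∀ L o q → L * o * q ≡ (L * q) * o
        regroup₁ = ℕ-Solver.solve-∀

        Q≤ : ∀ l → Q ≤ ρ a (l + 0) + ρ b (l + e)
        Q≤ l with ρ a (l + 0) + ρ b (l + e) in s≡
        ... | zero  = ⊥-elim (1+n≢0 (trans (sym M≡) (trans (cong₂ (λ x y → x + q * y)
                (ρ≡0 a (l + 0) (m+n≡0⇒m≡0 _ s≡)) (ρ≡0 b (l + e) (m+n≡0⇒n≡0 (ρ a (l + 0)) s≡)))
                (*-zeroʳ q))))
        ... | suc s = ∣⇒≤ (subst (Q ∣_) s≡ Q∣s)
          where
          Q∣s : Q ∣ ρ a (l + 0) + ρ b (l + e)
          Q∣s = ∣-rotate {a + q * b} {c + c′} l ∣-refl (begin-equality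
            p ^ l * (a + q * b)                                  ≡⟨ cong (λ t → p ^ l * (a + t * b)) r≡ ⟩
            p ^ l * (a + p ^ e * b)                              ≡⟨ spread (p ^ l) (p ^ e) a b ⟩
            p ^ l * a + p ^ l * p ^ e * b                        ≡⟨ cong₂ (λ x y → x * a + y * b) (cong (p ^_) (+-identityʳ l))
                                                                      (^-distribˡ-+-* p l e) ⟨
            p ^ (l + 0) * a + p ^ (l + e) * b                    ≡⟨ cong₂ _+_ (proj₂ (ρ-value a (l + 0))) (proj₂ (ρ-value b (l + e))) ⟩
            (ρ a (l + 0) + c * Q) + (ρ b (l + e) + c′ * Q)       ≡⟨ regroup₂ (ρ a (l + 0)) (ρ b (l + e)) c c′ Q ⟩
            (ρ a (l + 0) + ρ b (l + e)) + (c + c′) * Q           ∎) (subst (Q ∣_) (sym M≡) Q∣M)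
            where
            c  = proj₁ (ρ-value a (l + 0))
            c′ = proj₁ (ρ-value b (l + e))
            regroup₂ : ∀ x y c c′ Q → (x + c * Q) + (y + c′ * Q) ≡ (x + y) + (c + c′) * Q
            regroup₂ = ℕ-Solver.solve-∀
            spread : ∀ x y a b → x * (a + y * b) ≡ x * a + x * y * b
            spread = ℕ-Solver.solve-∀

      -- `y-bound` cancels the digit sum `L * o` of `Q * p ^ n`, so the digits of the multiplicities
      -- in `zs` count in full towards `v`, and `length-bound` bounds their number. Each variable
      -- with exponent 0 is credited with L, the valuation of q ^ m.
      term-bound : ∀ n zs a b w → All (λ z → Vec.sum (proj₁ z) ≤ d) zs →
        Q ∣ a + q * b → (∀ i → Q ∣ lookup (combination (λ j → j) zs) i) →
        a + (b + total proj₂ zs) ≡ Q * p ^ n →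
        w * (a ! * (b ! * List.foldr (λ z x → proj₂ z ! * x) 1 zs)) ≡ (Q * p ^ n) ! →
        ∃[ v ] (p ^ v ∣ w × B ≤ v + L * (isZero (a + q * b) + zeros (combination (λ j → j) zs)))
      term-bound n zs a b w deg Q∣My Q∣M ∑≡ w≡ = v , p^v∣w , B-least _ (*-cancelˡ-≤ o {{o≢0}} (begin
          o * ((L * r) * C)                                ≤⟨ length-bound zs deg Q∣M r∣∑ ⟩
          (degreeLength zs + o * (L * zeros M)) * Q        ≤⟨ *-monoˡ-≤ Q (+-monoˡ-≤ (o * (L * zeros M)) len≤) ⟩
          (o * (v + zy * L) + o * (L * zeros M)) * Q       ≡⟨ regroup o v zy L (zeros M) Q ⟩
          o * ((v + L * (zy + zeros M)) * Q)               ∎))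
        where
        open ≤-Reasoning
        M  = combination (λ j → j) zs
        zy = isZero (a + q * b)
        js = a ∷ b ∷ List.map proj₂ zs
        valuation = multinomial-valuation js {w} (valuationBound-[P-1]p^n L Q≡ n)
          (trans (cong (λ t → a + (b + t)) (total-map (λ j → j) proj₂ zs)) ∑≡)
          (trans (cong (λ t → w * (a ! * (b ! * t))) (foldr-map zs)) w≡)
          where
          foldr-map : ∀ (zs : List (Vec ℕ k × ℕ)) → List.foldr (λ j x → j ! * x) 1 (List.map proj₂ zs) ≡ List.foldr (λ z x → proj₂ z ! * x) 1 zs
          foldr-map []       = refl
          foldr-map (z ∷ zs) = cong (proj₂ z ! *_) (foldr-map zs)
        v = proj₁ valuation
        p^v∣w = proj₁ (proj₂ valuation)
        la = length (E.digits a)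
        lb = length (E.digits b)

        o≢0 : NonZero o
        o≢0 = >-nonZero (≤-pred 1<p)

        len≤ : degreeLength zs ≤ o * (v + zy * L)
        len≤ = +-cancelʳ-≤ (L * o) _ _ (begin
          degreeLength zs + L * o                              ≤⟨ +-monoʳ-≤ (degreeLength zs) (y-bound a b Q∣My) ⟩
          degreeLength zs + (la + lb + zy * (L * o))           ≡⟨ regroup₁ (degreeLength zs) la lb (zy * (L * o)) ⟩
          (la + (lb + degreeLength zs)) + zy * (L * o)         ≡⟨ cong (λ t → la + (lb + t) + zy * (L * o)) (total-map (length ∘ E.digits) proj₂ zs) ⟨
          total (length ∘ E.digits) js + zy * (L * o)          ≤⟨ +-monoˡ-≤ (zy * (L * o)) (proj₂ (proj₂ valuation)) ⟩
          (L * o + o * v) + zy * (L * o)                       ≡⟨ regroup₂ L o v zy ⟩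
          o * (v + zy * L) + L * o                             ∎)
          where
          regroup₁ : ∀ x a b y → x + (a + b + y) ≡ (a + (b + x)) + y
          regroup₁ = ℕ-Solver.solve-∀
          regroup₂ : ∀ L o v z → (L * o + o * v) + z * (L * o) ≡ o * (v + z * L) + L * o
          regroup₂ = ℕ-Solver.solve-∀

        -- Modulo r = q - 1 the numbers a + b and a + q b agree; r divides the latter and
        -- `Q * p ^ n`, hence the remaining multiplicities.
        r∣∑ : r ∣ total proj₂ zs
        r∣∑ = ∣m+n∣m⇒∣n (subst (r ∣_) (trans (sym ∑≡) (sym (+-assoc a b _))) (∣m⇒∣m*n (p ^ n) r∣Q)) r∣a+b
          where
          r∣a+b : r ∣ a + b
          r∣a+b = ∣m+n∣m⇒∣n (subst (r ∣_) (regroup₃ a b r) (∣-trans r∣Q Q∣My)) (m∣m*n b)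
            where
            regroup₃ : ∀ a b r → a + (1 + r) * b ≡ r * b + (a + b)
            regroup₃ = ℕ-Solver.solve-∀

        regroup : ∀ o v z L m q → (o * (v + z * L) + o * (L * m)) * q ≡ o * ((v + L * (z + m)) * q)
        regroup = ℕ-Solver.solve-∀

open Arithmetic
open FiniteSums using (total)
open import Data.Integer.Base using (+_; -[1+_])

-- Commutative rings and the powers of an ideal

module Integers {c ℓ} (R : CommutativeRing c ℓ) where

  open CommutativeRing R
  open import Algebra.Properties.Ring ring
    using (-0#≈0#; -‿involutive; -‿+-comm; -‿distribˡ-*)
  open import Algebra.Properties.Semiring.Mult semiring using (×-homo-+; ×-homo-1)
    renaming (_×_ to infixr 8 _×ⁿ_)
  open import Relation.Binary.Reasoning.Setoid setoid

  -- The canonical homomorphism from ℤ. Coefficients with decidable equality let the ring solver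
  -- cancel terms in rings whose own equality is not known to be decidable, such as the monoid ring.
  ι : ℤ → Carrier
  ι (+ n)    = n ×ⁿ 1#
  ι -[1+ n ] = - (suc n ×ⁿ 1#)

  ι-⊖ : ∀ m n → ι (m ℤ.⊖ n) ≈ m ×ⁿ 1# - n ×ⁿ 1#
  ι-⊖ zero    zero    = sym (-‿inverseʳ 0#)
  ι-⊖ zero    (suc n) = sym (+-identityˡ _)
  ι-⊖ (suc m) zero    = sym (trans (+-congˡ -0#≈0#) (+-identityʳ _))
  ι-⊖ (suc m) (suc n) = begin
    ι (suc m ℤ.⊖ suc n)                 ≡⟨ ≡.cong ι (ℤ.[1+m]⊖[1+n]≡m⊖n m n) ⟩
    ι (m ℤ.⊖ n)                         ≈⟨ ι-⊖ m n ⟩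
    a - b                               ≈⟨ +-congʳ (+-identityʳ a) ⟨
    (a + 0#) - b                        ≈⟨ +-congʳ (+-congˡ (-‿inverseʳ 1#)) ⟨
    (a + (1# - 1#)) - b                 ≈⟨ +-congʳ (+-assoc a 1# (- 1#)) ⟨
    ((a + 1#) - 1#) - b                 ≈⟨ +-congʳ (+-congʳ (+-comm a 1#)) ⟩
    ((1# + a) - 1#) - b                 ≈⟨ +-assoc _ _ _ ⟩
    (1# + a) + (- 1# - b)               ≈⟨ +-congˡ (-‿+-comm 1# b) ⟩
    (1# + a) - (1# + b)                 ∎
    where
    a = m ×ⁿ 1#
    b = n ×ⁿ 1#

  ι-+ : ∀ i j → ι (i ℤ.+ j) ≈ ι i + ι j
  ι-+ (+ m)    (+ n)    = ×-homo-+ 1# m n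
  ι-+ (+ m)    -[1+ n ] = ι-⊖ m (suc n)
  ι-+ -[1+ m ] (+ n)    = trans (ι-⊖ n (suc m)) (+-comm _ _)
  ι-+ -[1+ m ] -[1+ n ] = trans (-‿cong (trans (reflexive (≡.cong (λ t → suc t ×ⁿ 1#) (≡.sym (ℕ.+-suc m n))))
                                               (×-homo-+ 1# (suc m) (suc n))))
                                (sym (-‿+-comm _ _))

  ι-neg : ∀ i → ι (ℤ.- i) ≈ - ι i
  ι-neg (+ zero)  = sym -0#≈0#
  ι-neg (+ suc n) = refl
  ι-neg -[1+ n ]  = sym (-‿involutive _)

  private
    ι-*ⁿ : ∀ m j → ι (+ m ℤ.* j) ≈ m ×ⁿ 1# * ι j
    ι-*ⁿ zero    j = trans (reflexive (≡.cong ι (ℤ.*-zeroˡ j))) (sym (zeroˡ _))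
    ι-*ⁿ (suc m) j = begin
      ι (+ suc m ℤ.* j)                ≡⟨ ≡.cong ι (ℤ.suc-* (+ m) j) ⟩
      ι (j ℤ.+ + m ℤ.* j)              ≈⟨ ι-+ j (+ m ℤ.* j) ⟩
      ι j + ι (+ m ℤ.* j)              ≈⟨ +-cong (sym (*-identityˡ _)) (ι-*ⁿ m j) ⟩
      1# * ι j + m ×ⁿ 1# * ι j         ≈⟨ distribʳ _ _ _ ⟨
      (1# + m ×ⁿ 1#) * ι j             ∎

  ι-* : ∀ i j → ι (i ℤ.* j) ≈ ι i * ι j
  ι-* (+ m)    j = ι-*ⁿ m j
  ι-* -[1+ m ] j = begin
    ι (-[1+ m ] ℤ.* j)                 ≡⟨ ≡.cong ι (ℤ.neg-distribˡ-* (+ suc m) j) ⟨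
    ι (ℤ.- (+ suc m ℤ.* j))            ≈⟨ ι-neg (+ suc m ℤ.* j) ⟩
    - ι (+ suc m ℤ.* j)                ≈⟨ -‿cong (ι-*ⁿ (suc m) j) ⟩
    - (suc m ×ⁿ 1# * ι j)              ≈⟨ -‿distribˡ-* _ _ ⟩
    - (suc m ×ⁿ 1#) * ι j              ∎

  ι-morphism : CommutativeRing.rawRing ℤ.+-*-commutativeRing -Raw-AlmostCommutative⟶ fromCommutativeRing R
  ι-morphism = record
    { ⟦_⟧    = ι
    ; +-homo = ι-+
    ; *-homo = ι-*
    ; -‿homo = ι-neg
    ; 0-homo = refl
    ; 1-homo = ×-homo-1 1#
    }

  module Solver = Algebra.Solver.Ring (CommutativeRing.rawRing ℤ.+-*-commutativeRing)
    (fromCommutativeRing R) ι-morphism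
    (λ i j → Maybe.map (λ i≡j → reflexive (≡.cong ι i≡j)) (dec⇒weaklyDec ℤ._≟_ i j))

module BinomialExpansion {c ℓ} (R : CommutativeSemiring c ℓ) where

  open CommutativeSemiring R
  open import Algebra.Properties.CommutativeSemiring.Exp R using (_^_)
  open import Algebra.Properties.CommutativeSemiring.Binomial R using (theorem)
  open import Algebra.Properties.Semiring.Mult semiring
    renaming (_×_ to infixr 8 _×ⁿ_)
  open import Algebra.Properties.Semiring.Sum semiring using (sum; sum-init-last)
  open import Relation.Binary.Reasoning.Setoid setoid

  sum-closed : ∀ {ℓ′} (Q : Carrier → Set ℓ′) → Q 0# → (∀ {x y} → Q x → Q y → Q (x + y)) →
               ∀ {n} (t : Fin n → Carrier) → (∀ i → Q (t i)) → Q (sum t)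
  sum-closed Q q0 q+ {zero}  t qt = q0
  sum-closed Q q0 q+ {suc n} t qt = q+ (qt Fin.zero) (sum-closed Q q0 q+ (t ∘ Fin.suc) (qt ∘ Fin.suc))

  -- Phrasing the expansion through a predicate closed under sums allows it to be iterated to the
  -- multinomial theorem without writing down a sum over all tuples of multiplicities.
  binomial-closed : ∀ {ℓ′} (Q : Carrier → Set ℓ′) → (∀ {x y} → x ≈ y → Q x → Q y) →
                    Q 0# → (∀ {x y} → Q x → Q y → Q (x + y)) →
                    ∀ n x y → (∀ i j → i ℕ.+ j ≡ n → Q ((n C i) ×ⁿ (x ^ i * y ^ j))) → Q ((x + y) ^ n)
  binomial-closed Q resp q0 q+ n x y terms =
    resp (sym (theorem n x y)) (sum-closed Q q0 q+ _ λ i →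
      terms (toℕ i) _ (ℕ.m+[n∸m]≡n (ℕ.≤-pred (Fin.toℕ<n i))))

  -- Every middle term contains x at least once. The explicit factor x in the correction is what
  -- keeps corrections in a power of I when x lies in it.
  freshman : ∀ {p} → Prime p → ∀ x y → ∃[ z ] (x + y) ^ p ≈ x ^ p + y ^ p + p ×ⁿ (x * z)
  freshman {zero} pr x y = ⊥-elim (ℕ.≢-nonZero⁻¹ 0 {{prime⇒nonZero pr}} ≡.refl)
  freshman {p@(suc p′)} pr x y = proj₁ middle , (begin
    (x + y) ^ p
      ≈⟨ theorem p x y ⟩
    t Fin.zero + sum (t ∘ Fin.suc)
      ≈⟨ +-cong first (trans (sum-init-last (t ∘ Fin.suc)) (+-cong (proj₂ middle) last-term)) ⟩
    y ^ p + (p ×ⁿ (x * proj₁ middle) + x ^ p)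
      ≈⟨ +-congˡ (+-comm _ _) ⟩
    y ^ p + (x ^ p + p ×ⁿ (x * proj₁ middle))
      ≈⟨ +-assoc _ _ _ ⟨
    (y ^ p + x ^ p) + p ×ⁿ (x * proj₁ middle)
      ≈⟨ +-congʳ (+-comm _ _) ⟩
    x ^ p + y ^ p + p ×ⁿ (x * proj₁ middle)
      ∎)
    where
    t : Fin (suc p) → Carrier
    t i = (p C toℕ i) ×ⁿ (x ^ toℕ i * y ^ (p ℕ.∸ toℕ i))

    first : t Fin.zero ≈ y ^ p
    first = trans (+-identityʳ _) (*-identityˡ _)

    last-term : t (Fin.suc (Fin.fromℕ p′)) ≈ x ^ p
    last-term rewrite Fin.toℕ-fromℕ p′ | nCn≡1 p = trans (+-identityʳ _)
      (trans (*-congˡ (reflexive (≡.cong (y ^_) (ℕ.n∸n≡0 p′)))) (*-identityʳ _))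

    Multiple : Carrier → Set _
    Multiple s = ∃[ z ] s ≈ p ×ⁿ (x * z)

    multiple-+ : ∀ {s s′} → Multiple s → Multiple s′ → Multiple (s + s′)
    multiple-+ {s} {s′} (z , e) (z′ , e′) = z + z′ , (begin
      s + s′                              ≈⟨ +-cong e e′ ⟩
      p ×ⁿ (x * z) + p ×ⁿ (x * z′)        ≈⟨ +-cong (×-comm-* p x z) (×-comm-* p x z′) ⟨
      x * (p ×ⁿ z) + x * (p ×ⁿ z′)        ≈⟨ distribˡ _ _ _ ⟨
      x * (p ×ⁿ z + p ×ⁿ z′)              ≈⟨ *-congˡ (+-cong (p×1* z) (p×1* z′)) ⟩
      x * ((p ×ⁿ 1#) * z + (p ×ⁿ 1#) * z′) ≈⟨ *-congˡ (distribˡ _ _ _) ⟨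
      x * ((p ×ⁿ 1#) * (z + z′))          ≈⟨ *-congˡ (p×1* _) ⟨
      x * (p ×ⁿ (z + z′))                 ≈⟨ ×-comm-* p x _ ⟩
      p ×ⁿ (x * (z + z′))                 ∎)
      where
      p×1* : ∀ w → p ×ⁿ w ≈ (p ×ⁿ 1#) * w
      p×1* w = sym (trans (×-assoc-* p 1# w) (×-congʳ p (*-identityˡ w)))

    middle-term : ∀ (j : Fin p′) → Multiple (t (Fin.suc (Fin.inject₁ j)))
    middle-term j rewrite Fin.toℕ-inject₁ j with prime∣binomial pr {toℕ j} {p′ ℕ.∸ suc (toℕ j)}
      (≡.trans (≡.cong suc (ℕ.+-suc (toℕ j) _)) (≡.cong suc (ℕ.m+[n∸m]≡n (Fin.toℕ<n j))))
    ... | divides q eq rewrite eq = _ , (begin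
      (q ℕ.* p) ×ⁿ (x * x ^ toℕ j * Y)   ≈⟨ ×-congˡ (ℕ.*-comm q p) ⟩
      (p ℕ.* q) ×ⁿ (x * x ^ toℕ j * Y)   ≈⟨ ×-assocˡ _ p q ⟨
      p ×ⁿ q ×ⁿ (x * x ^ toℕ j * Y)      ≈⟨ ×-congʳ p (×-congʳ q (*-assoc _ _ _)) ⟩
      p ×ⁿ q ×ⁿ (x * (x ^ toℕ j * Y))    ≈⟨ ×-congʳ p (×-comm-* q _ _) ⟨
      p ×ⁿ (x * q ×ⁿ (x ^ toℕ j * Y))    ∎)
      where Y = y ^ (p′ ℕ.∸ toℕ j)

    middle : Multiple (sum (λ j → t (Fin.suc (Fin.inject₁ j))))
    middle = sum-closed Multiple
      (0# , sym (trans (×-congʳ p (zeroʳ x)) (n×0 p))) multiple-+ _ middle-term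
      where
      n×0 : ∀ n → n ×ⁿ 0# ≈ 0#
      n×0 zero    = refl
      n×0 (suc n) = trans (+-identityˡ _) (n×0 n)

module IdealPowers {c ℓ i} (A : CommutativeRing c ℓ) (I : CommutativeRing.Carrier A → Set i)
  (I-absorb : ∀ a {x} → I x → I (CommutativeRing._*_ A a x)) where

  open CommutativeRing A
  open import Algebra.Properties.Ring ring using (-1*x≈-x)
  open import Algebra.Properties.CommutativeSemiring.Exp commutativeSemiring
    using (_^_; ^-congˡ; ^-congʳ; ^-assocʳ)
  open import Algebra.Properties.Semiring.Mult semiring
    renaming (_×_ to infixr 8 _×ⁿ_)
  open BinomialExpansion commutativeSemiring using (freshman)

  infix 4 _∈I^_

  -- Generated inductively by sums and products with elements of I, so that the Frobenius lift and
  -- the p-derivation can be followed by recursion on a membership proof.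
  data _∈I^_ : Carrier → ℕ → Set (c ⊔ ℓ ⊔ i) where
    whole : ∀ {x} → x ∈I^ 0
    0∈    : ∀ {n} → 0# ∈I^ n
    +∈    : ∀ {n x y} → x ∈I^ n → y ∈I^ n → x + y ∈I^ n
    *∈    : ∀ {n x y} → I x → y ∈I^ n → x * y ∈I^ suc n
    resp  : ∀ {n x y} → x ≈ y → x ∈I^ n → y ∈I^ n

  absorb : ∀ {n} a {x} → x ∈I^ n → a * x ∈I^ n
  absorb a whole      = whole
  absorb a 0∈         = resp (sym (zeroʳ a)) 0∈
  absorb a (+∈ p q)   = resp (sym (distribˡ _ _ _)) (+∈ (absorb a p) (absorb a q))
  absorb a (*∈ i q)   = resp (*-assoc _ _ _) (*∈ (I-absorb a i) q)
  absorb a (resp e p) = resp (*-congˡ e) (absorb a p)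

  neg∈ : ∀ {n x} → x ∈I^ n → - x ∈I^ n
  neg∈ p = resp (-1*x≈-x _) (absorb (- 1#) p)

  -∈ : ∀ {n x y} → x ∈I^ n → y ∈I^ n → x - y ∈I^ n
  -∈ p q = +∈ p (neg∈ q)

  ×∈ : ∀ {n} k {x} → x ∈I^ n → k ×ⁿ x ∈I^ n
  ×∈ zero    p = 0∈
  ×∈ (suc k) p = +∈ p (×∈ k p)

  pred∈ : ∀ {n x} → x ∈I^ suc n → x ∈I^ n
  pred∈ 0∈         = 0∈
  pred∈ (+∈ p q)   = +∈ (pred∈ p) (pred∈ q)
  pred∈ (*∈ i q)   = absorb _ q
  pred∈ (resp e p) = resp e (pred∈ p)

  *∈^ : ∀ {m n x y} → x ∈I^ m → y ∈I^ n → x * y ∈I^ (m ℕ.+ n)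
  *∈^ whole      q = absorb _ q
  *∈^ 0∈         q = resp (sym (zeroˡ _)) 0∈
  *∈^ (+∈ p p′)  q = resp (sym (distribʳ _ _ _)) (+∈ (*∈^ p q) (*∈^ p′ q))
  *∈^ (*∈ i p)   q = resp (sym (*-assoc _ _ _)) (*∈ i (*∈^ p q))
  *∈^ (resp e p) q = resp (*-congʳ e) (*∈^ p q)

  ≤∈ : ∀ {m n x} → m ℕ.≤ n → x ∈I^ n → x ∈I^ m
  ≤∈ {m} {n} m≤n p = go (ℕ.≤⇒≤′ m≤n) p
    where
    go : ∀ {n x} → m ℕ.≤′ n → x ∈I^ n → x ∈I^ m
    go (ℕ.≤′-reflexive ≡.refl) p = p
    go (ℕ.≤′-step m≤n)         p = go m≤n (pred∈ p)

  I⇒∈I^1 : ∀ {x} → I x → x ∈I^ 1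
  I⇒∈I^1 i = resp (*-identityʳ _) (*∈ i whole)

  ^∈ : ∀ {x} → I x → ∀ n → x ^ n ∈I^ n
  ^∈ i zero    = whole
  ^∈ i (suc n) = *∈ i (^∈ i n)

  ^k∈ : ∀ {n k x} → 2 ℕ.≤ k → x ∈I^ suc n → x ^ k ∈I^ suc (suc n)
  ^k∈ {n} {suc (suc k)} {x} _ x∈ = ≤∈ (s≤s (ℕ.≤-reflexive (ℕ.+-comm 1 n)))
    (*∈^ x∈ (resp (*-comm _ _) (absorb (x ^ k) (≤∈ (s≤s z≤n) x∈))))
  ^k∈ {k = suc zero} (s≤s ()) _

  module _ {p} (I-p : I (p ×ⁿ 1#)) where

    p×∈ : ∀ {n x} → x ∈I^ n → p ×ⁿ x ∈I^ suc n
    p×∈ q = resp (trans (×-assoc-* p 1# _) (×-congʳ p (*-identityˡ _))) (*∈ I-p q)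

    p^×∈ : ∀ v {n x} → x ∈I^ n → (p ℕ.^ v) ×ⁿ x ∈I^ (v ℕ.+ n)
    p^×∈ zero    q = resp (sym (×-homo-1 _)) q
    p^×∈ (suc v) q = resp (×-assocˡ _ p (p ℕ.^ v)) (p×∈ (p^×∈ v q))

    ∣×∈ : ∀ v {w n x} → p ℕ.^ v ∣ w → x ∈I^ n → w ×ⁿ x ∈I^ (v ℕ.+ n)
    ∣×∈ v (divides-refl k) q = resp (×-assocˡ _ k (p ℕ.^ v)) (×∈ k (p^×∈ v q))

    -- x = 1 + z gives x ^ p ≡ 1 + z ^ p modulo p z.
    ^p≡1 : Prime p → ∀ {n x} → x - 1# ∈I^ suc n → x ^ p - 1# ∈I^ suc (suc n)
    ^p≡1 pr {n} {x} z∈ = let w , e = freshman pr z 1# in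
      resp (begin
        z ^ p + p ×ⁿ (z * w)                        ≈⟨ rearrange ⟩
        (z ^ p + 1# + p ×ⁿ (z * w)) - 1#            ≈⟨ +-congʳ (+-congʳ (+-congˡ (1^ p))) ⟨
        (z ^ p + 1# ^ p + p ×ⁿ (z * w)) - 1#        ≈⟨ +-congʳ e ⟨
        (z + 1#) ^ p - 1#                           ≈⟨ +-congʳ (^-congˡ p z+1) ⟩
        x ^ p - 1#                                  ∎)
      (+∈ (^k∈ 2≤p z∈) (p×∈ (resp (*-comm _ _) (absorb w z∈))))
      where
      open import Relation.Binary.Reasoning.Setoid setoid
      z = x - 1#
      z+1 : z + 1# ≈ x
      z+1 = trans (+-assoc _ _ _) (trans (+-congˡ (-‿inverseˡ 1#)) (+-identityʳ x))
      1^ : ∀ n → 1# ^ n ≈ 1#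
      1^ zero    = refl
      1^ (suc n) = trans (*-identityˡ _) (1^ n)
      rearrange : ∀ {a b} → a + b ≈ (a + 1# + b) - 1#
      rearrange {a} {b} = sym (begin
        (a + 1# + b) - 1#     ≈⟨ +-congʳ (trans (+-assoc _ _ _) (trans (+-congˡ (+-comm _ _)) (sym (+-assoc _ _ _)))) ⟩
        (a + b + 1#) - 1#     ≈⟨ trans (+-assoc _ _ _) (trans (+-congˡ (-‿inverseʳ 1#)) (+-identityʳ _)) ⟩
        a + b                 ∎)
      2≤p = ℕ.nonTrivial⇒n>1 p {{prime⇒nonTrivial pr}}

    ^p^n≡1 : Prime p → ∀ n {x} → I (x - 1#) → x ^ (p ℕ.^ n) - 1# ∈I^ suc n
    ^p^n≡1 pr zero {x} i = resp (+-congʳ (sym (*-identityʳ x))) (I⇒∈I^1 i)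
    ^p^n≡1 pr (suc n) {x} i = resp (+-congʳ e) (^p≡1 pr (^p^n≡1 pr n i))
      where
      e : (x ^ (p ℕ.^ n)) ^ p ≈ x ^ (p ℕ.* p ℕ.^ n)
      e = trans (^-assocʳ x (p ℕ.^ n) p) (^-congʳ x (ℕ.*-comm (p ℕ.^ n) p))

-- The monoid ring and its p-derivation

module MonoidRing {c ℓ} (M : CommutativeMonoid c ℓ) where

  open CommutativeMonoid M using (Carrier; _≈_; _∙_; ε; assoc; comm; identityˡ; ∙-congˡ; ∙-congʳ)

  infixl 6 _⊕_
  infixl 7 _⊗_ _▹_
  infix  8 ⊖_

  -- Formal expressions, so that linear maps and the existence of p-derivations are obtained by
  -- structural recursion; the identifications of ℤ[M] are left to `_≋_`.
  data Element : Set c where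
    0ᴱ  : Element
    [_] : Carrier → Element
    _⊕_ : Element → Element → Element
    ⊖_  : Element → Element

  ⟦_⟧ : Element → (Carrier → ℤ) → ℤ
  ⟦ 0ᴱ    ⟧ h = 0ℤ
  ⟦ [ a ] ⟧ h = h a
  ⟦ x ⊕ y ⟧ h = ⟦ x ⟧ h ℤ.+ ⟦ y ⟧ h
  ⟦ ⊖ x   ⟧ h = ℤ.- ⟦ x ⟧ h

  infix 4 _≋_

  -- Two formal sums agree in ℤ[M] iff every function M → ℤ, extended
  -- linearly, takes the same value on them.
  record _≋_ (x y : Element) : Set (c ⊔ ℓ) where
    constructor mk≋
    field
      at : ∀ h → (∀ {a b} → a ≈ b → h a ≡ h b) → ⟦ x ⟧ h ≡ ⟦ y ⟧ h

  open _≋_ public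

  _▹_ : Carrier → Element → Element
  a ▹ 0ᴱ      = 0ᴱ
  a ▹ [ b ]   = [ a ∙ b ]
  a ▹ (x ⊕ y) = (a ▹ x) ⊕ (a ▹ y)
  a ▹ (⊖ x)   = ⊖ (a ▹ x)

  _⊗_ : Element → Element → Element
  0ᴱ      ⊗ z = 0ᴱ
  [ a ]   ⊗ z = a ▹ z
  (x ⊕ y) ⊗ z = (x ⊗ z) ⊕ (y ⊗ z)
  (⊖ x)   ⊗ z = ⊖ (x ⊗ z)

  ⟦⟧-ext : ∀ x {h k} → (∀ a → h a ≡ k a) → ⟦ x ⟧ h ≡ ⟦ x ⟧ k
  ⟦⟧-ext 0ᴱ      e = ≡.refl
  ⟦⟧-ext [ a ]   e = e a
  ⟦⟧-ext (x ⊕ y) e = ≡.cong₂ ℤ._+_ (⟦⟧-ext x e) (⟦⟧-ext y e)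
  ⟦⟧-ext (⊖ x)   e = ≡.cong ℤ.-_ (⟦⟧-ext x e)

  ⟦⟧-zero : ∀ x → ⟦ x ⟧ (λ _ → 0ℤ) ≡ 0ℤ
  ⟦⟧-zero 0ᴱ      = ≡.refl
  ⟦⟧-zero [ a ]   = ≡.refl
  ⟦⟧-zero (x ⊕ y) = ≡.cong₂ ℤ._+_ (⟦⟧-zero x) (⟦⟧-zero y)
  ⟦⟧-zero (⊖ x)   = ≡.cong ℤ.-_ (⟦⟧-zero x)

  private
    +-interchange : ∀ a b c d → (a ℤ.+ b) ℤ.+ (c ℤ.+ d) ≡ (a ℤ.+ c) ℤ.+ (b ℤ.+ d)
    +-interchange = ℤ-Solver.solve-∀

  ⟦⟧-+ : ∀ x h k → ⟦ x ⟧ (λ a → h a ℤ.+ k a) ≡ ⟦ x ⟧ h ℤ.+ ⟦ x ⟧ k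
  ⟦⟧-+ 0ᴱ      h k = ≡.refl
  ⟦⟧-+ [ a ]   h k = ≡.refl
  ⟦⟧-+ (x ⊕ y) h k = ≡.trans (≡.cong₂ ℤ._+_ (⟦⟧-+ x h k) (⟦⟧-+ y h k))
                             (+-interchange (⟦ x ⟧ h) (⟦ x ⟧ k) (⟦ y ⟧ h) (⟦ y ⟧ k))
  ⟦⟧-+ (⊖ x)   h k = ≡.trans (≡.cong ℤ.-_ (⟦⟧-+ x h k)) (ℤ.neg-distrib-+ (⟦ x ⟧ h) (⟦ x ⟧ k))

  ⟦⟧-neg : ∀ x h → ⟦ x ⟧ (λ a → ℤ.- h a) ≡ ℤ.- ⟦ x ⟧ h
  ⟦⟧-neg 0ᴱ      h = ≡.refl
  ⟦⟧-neg [ a ]   h = ≡.refl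
  ⟦⟧-neg (x ⊕ y) h = ≡.trans (≡.cong₂ ℤ._+_ (⟦⟧-neg x h) (⟦⟧-neg y h))
                             (≡.sym (ℤ.neg-distrib-+ (⟦ x ⟧ h) (⟦ y ⟧ h)))
  ⟦⟧-neg (⊖ x)   h = ≡.cong ℤ.-_ (⟦⟧-neg x h)

  ⟦⟧-swap : ∀ x y (k : Carrier → Carrier → ℤ) →
            ⟦ x ⟧ (λ a → ⟦ y ⟧ (k a)) ≡ ⟦ y ⟧ (λ b → ⟦ x ⟧ (λ a → k a b))
  ⟦⟧-swap 0ᴱ       y k = ≡.sym (⟦⟧-zero y)
  ⟦⟧-swap [ a ]    y k = ≡.refl
  ⟦⟧-swap (x ⊕ x′) y k = ≡.trans (≡.cong₂ ℤ._+_ (⟦⟧-swap x y k) (⟦⟧-swap x′ y k)) (≡.sym (⟦⟧-+ y _ _))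
  ⟦⟧-swap (⊖ x)    y k = ≡.trans (≡.cong ℤ.-_ (⟦⟧-swap x y k)) (≡.sym (⟦⟧-neg y _))

  ⟦▹⟧ : ∀ a y h → ⟦ a ▹ y ⟧ h ≡ ⟦ y ⟧ (λ b → h (a ∙ b))
  ⟦▹⟧ a 0ᴱ      h = ≡.refl
  ⟦▹⟧ a [ b ]   h = ≡.refl
  ⟦▹⟧ a (x ⊕ y) h = ≡.cong₂ ℤ._+_ (⟦▹⟧ a x h) (⟦▹⟧ a y h)
  ⟦▹⟧ a (⊖ x)   h = ≡.cong ℤ.-_ (⟦▹⟧ a x h)

  ⟦⊗⟧ : ∀ x y h → ⟦ x ⊗ y ⟧ h ≡ ⟦ x ⟧ (λ a → ⟦ y ⟧ (λ b → h (a ∙ b)))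
  ⟦⊗⟧ 0ᴱ       y h = ≡.refl
  ⟦⊗⟧ [ a ]    y h = ⟦▹⟧ a y h
  ⟦⊗⟧ (x ⊕ x′) y h = ≡.cong₂ ℤ._+_ (⟦⊗⟧ x y h) (⟦⊗⟧ x′ y h)
  ⟦⊗⟧ (⊖ x)    y h = ≡.cong ℤ.-_ (⟦⊗⟧ x y h)

  ⊗-cong : ∀ {x x′ y y′} → x ≋ x′ → y ≋ y′ → x ⊗ y ≋ x′ ⊗ y′
  ⊗-cong {x} {x′} {y} {y′} p q = mk≋ λ h h-cong → begin
    ⟦ x ⊗ y ⟧ h                                  ≡⟨ ⟦⊗⟧ x y h ⟩
    ⟦ x ⟧ (λ a → ⟦ y ⟧ (λ b → h (a ∙ b)))        ≡⟨ ⟦⟧-ext x (λ a → at q _ (λ e → h-cong (∙-congˡ e))) ⟩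
    ⟦ x ⟧ (λ a → ⟦ y′ ⟧ (λ b → h (a ∙ b)))       ≡⟨ at p _ (λ e → ⟦⟧-ext y′ λ b → h-cong (∙-congʳ e)) ⟩
    ⟦ x′ ⟧ (λ a → ⟦ y′ ⟧ (λ b → h (a ∙ b)))      ≡⟨ ⟦⊗⟧ x′ y′ h ⟨
    ⟦ x′ ⊗ y′ ⟧ h                                ∎
    where open ≡.≡-Reasoning

  ⊗-comm : ∀ x y → x ⊗ y ≋ y ⊗ x
  ⊗-comm x y = mk≋ λ h h-cong → begin
    ⟦ x ⊗ y ⟧ h                            ≡⟨ ⟦⊗⟧ x y h ⟩
    ⟦ x ⟧ (λ a → ⟦ y ⟧ (λ b → h (a ∙ b)))  ≡⟨ ⟦⟧-swap x y _ ⟩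
    ⟦ y ⟧ (λ b → ⟦ x ⟧ (λ a → h (a ∙ b)))  ≡⟨ ⟦⟧-ext y (λ b → ⟦⟧-ext x λ a → h-cong (comm a b)) ⟩
    ⟦ y ⟧ (λ b → ⟦ x ⟧ (λ a → h (b ∙ a)))  ≡⟨ ⟦⊗⟧ y x h ⟨
    ⟦ y ⊗ x ⟧ h                            ∎
    where open ≡.≡-Reasoning

  ⊗-assoc : ∀ x y z → (x ⊗ y) ⊗ z ≋ x ⊗ (y ⊗ z)
  ⊗-assoc x y z = mk≋ λ h h-cong → begin
    ⟦ (x ⊗ y) ⊗ z ⟧ h
      ≡⟨ ⟦⊗⟧ (x ⊗ y) z h ⟩
    ⟦ x ⊗ y ⟧ (λ a → ⟦ z ⟧ (λ c → h (a ∙ c)))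
      ≡⟨ ⟦⊗⟧ x y _ ⟩
    ⟦ x ⟧ (λ a → ⟦ y ⟧ (λ b → ⟦ z ⟧ (λ c → h ((a ∙ b) ∙ c))))
      ≡⟨ ⟦⟧-ext x (λ a → ⟦⟧-ext y λ b → ⟦⟧-ext z λ c → h-cong (assoc a b c)) ⟩
    ⟦ x ⟧ (λ a → ⟦ y ⟧ (λ b → ⟦ z ⟧ (λ c → h (a ∙ (b ∙ c)))))
      ≡⟨ ⟦⟧-ext x (λ a → ⟦⊗⟧ y z _) ⟨
    ⟦ x ⟧ (λ a → ⟦ y ⊗ z ⟧ (λ b → h (a ∙ b)))
      ≡⟨ ⟦⊗⟧ x (y ⊗ z) h ⟨
    ⟦ x ⊗ (y ⊗ z) ⟧ h
      ∎
    where open ≡.≡-Reasoning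

  ⊗-identityˡ : ∀ x → [ ε ] ⊗ x ≋ x
  ⊗-identityˡ x = mk≋ λ h h-cong →
    ≡.trans (⟦▹⟧ ε x h) (⟦⟧-ext x λ a → h-cong (identityˡ a))

  ⊗-distribʳ : ∀ x y z → (y ⊕ z) ⊗ x ≋ (y ⊗ x) ⊕ (z ⊗ x)
  ⊗-distribʳ x y z = mk≋ λ _ _ → ≡.refl

  ≋-trans : ∀ {x y z} → x ≋ y → y ≋ z → x ≋ z
  ≋-trans p q = mk≋ λ h hc → ≡.trans (at p h hc) (at q h hc)

  ⊕-cong : ∀ {x x′ y y′} → x ≋ x′ → y ≋ y′ → x ⊕ y ≋ x′ ⊕ y′
  ⊕-cong p q = mk≋ λ h hc → ≡.cong₂ ℤ._+_ (at p h hc) (at q h hc)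

  ⊗-identityʳ : ∀ x → x ⊗ [ ε ] ≋ x
  ⊗-identityʳ x = ≋-trans (⊗-comm x [ ε ]) (⊗-identityˡ x)

  ⊗-distribˡ : ∀ x y z → x ⊗ (y ⊕ z) ≋ (x ⊗ y) ⊕ (x ⊗ z)
  ⊗-distribˡ x y z = ≋-trans (⊗-comm x (y ⊕ z)) (⊕-cong (⊗-comm y x) (⊗-comm z x))

  monoidRing : CommutativeRing c (c ⊔ ℓ)
  monoidRing = record
    { Carrier = Element
    ; _≈_ = _≋_ ; _+_ = _⊕_ ; _*_ = _⊗_ ; -_ = ⊖_ ; 0# = 0ᴱ ; 1# = [ ε ]
    ; isCommutativeRing = record
      { isRing = record
        { +-isAbelianGroup = record
          { isGroup = record
            { isMonoid = record
              { isSemigroup = record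
                { isMagma = record
                  { isEquivalence = record
                    { refl  = mk≋ λ _ _ → ≡.refl
                    ; sym   = λ p → mk≋ λ h hc → ≡.sym (at p h hc)
                    ; trans = ≋-trans
                    }
                  ; ∙-cong = ⊕-cong
                  }
                ; assoc = λ x y z → mk≋ λ h _ → ℤ.+-assoc (⟦ x ⟧ h) (⟦ y ⟧ h) (⟦ z ⟧ h)
                }
              ; identity = (λ x → mk≋ λ h _ → ℤ.+-identityˡ (⟦ x ⟧ h))
                         , (λ x → mk≋ λ h _ → ℤ.+-identityʳ (⟦ x ⟧ h))
              }
            ; inverse = (λ x → mk≋ λ h _ → ℤ.+-inverseˡ (⟦ x ⟧ h))
                      , (λ x → mk≋ λ h _ → ℤ.+-inverseʳ (⟦ x ⟧ h))
            ; ⁻¹-cong = λ p → mk≋ λ h hc → ≡.cong ℤ.-_ (at p h hc)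
            }
          ; comm = λ x y → mk≋ λ h _ → ℤ.+-comm (⟦ x ⟧ h) (⟦ y ⟧ h)
          }
        ; *-cong = ⊗-cong
        ; *-assoc = ⊗-assoc
        ; *-identity = ⊗-identityˡ , ⊗-identityʳ
        ; distrib = ⊗-distribˡ , ⊗-distribʳ
        }
      ; *-comm = ⊗-comm
      }
    }

  []-cong : ∀ {a b} → a ≈ b → [ a ] ≋ [ b ]
  []-cong e = mk≋ λ h hc → hc e

  module Map (f : Carrier → Carrier) (f-cong : ∀ {a b} → a ≈ b → f a ≈ f b)
             (f-homo : ∀ a b → f (a ∙ b) ≈ f a ∙ f b) where

    map : Element → Element
    map 0ᴱ      = 0ᴱ
    map [ a ]   = [ f a ]
    map (x ⊕ y) = map x ⊕ map y
    map (⊖ x)   = ⊖ map x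

    ⟦map⟧ : ∀ x h → ⟦ map x ⟧ h ≡ ⟦ x ⟧ (λ a → h (f a))
    ⟦map⟧ 0ᴱ      h = ≡.refl
    ⟦map⟧ [ a ]   h = ≡.refl
    ⟦map⟧ (x ⊕ y) h = ≡.cong₂ ℤ._+_ (⟦map⟧ x h) (⟦map⟧ y h)
    ⟦map⟧ (⊖ x)   h = ≡.cong ℤ.-_ (⟦map⟧ x h)

    map-cong : ∀ {x y} → x ≋ y → map x ≋ map y
    map-cong {x} {y} p = mk≋ λ h hc →
      ≡.trans (⟦map⟧ x h) (≡.trans (at p _ (λ e → hc (f-cong e))) (≡.sym (⟦map⟧ y h)))

    map-⊗ : ∀ x y → map (x ⊗ y) ≋ map x ⊗ map y
    map-⊗ x y = mk≋ λ h hc → begin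
      ⟦ map (x ⊗ y) ⟧ h                               ≡⟨ ⟦map⟧ (x ⊗ y) h ⟩
      ⟦ x ⊗ y ⟧ (λ a → h (f a))                       ≡⟨ ⟦⊗⟧ x y _ ⟩
      ⟦ x ⟧ (λ a → ⟦ y ⟧ (λ b → h (f (a ∙ b))))       ≡⟨ ⟦⟧-ext x (λ a → ⟦⟧-ext y λ b → hc (f-homo a b)) ⟩
      ⟦ x ⟧ (λ a → ⟦ y ⟧ (λ b → h (f a ∙ f b)))       ≡⟨ ⟦⟧-ext x (λ a → ⟦map⟧ y _) ⟨
      ⟦ x ⟧ (λ a → ⟦ map y ⟧ (λ b → h (f a ∙ b)))     ≡⟨ ⟦map⟧ x _ ⟨
      ⟦ map x ⟧ (λ a → ⟦ map y ⟧ (λ b → h (a ∙ b)))   ≡⟨ ⟦⊗⟧ (map x) (map y) h ⟨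
      ⟦ map x ⊗ map y ⟧ h                             ∎
      where open ≡.≡-Reasoning

-- Reduction to the field, its kernel, and the p-derivation

module Teichmüller {c ℓ n} (R : CommutativeRing c ℓ)
  (order : Inverse (≡.setoid (Fin n)) (CommutativeRing.setoid R)) where

  open CommutativeRing R
  open Inverse order using (to; from; from-cong; strictlyInverseˡ)
  open MonoidRing *-commutativeMonoid public
  open Integers R using (ι; ι-+; ι-neg)
  open import Algebra.Properties.Ring ring using (-‿distribˡ-*; -‿+-comm; -0#≈0#)
  open import Algebra.Properties.CommutativeSemiring.Exp commutativeSemiring
    using (^-congˡ; ^-distrib-*) renaming (_^_ to _^ᶠ_)
  open import Algebra.Properties.Semiring.Mult semiring using (×-congʳ; ×-assoc-*)
    renaming (_×_ to infixr 8 _×ᶠ_)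
  open import Algebra.Properties.Semiring.Sum semiring
    using (sum; sum-cong-≋; ∑-distrib-+; sum-replicate-zero)
  module A = CommutativeRing monoidRing
  open import Algebra.Properties.CommutativeSemiring.Exp A.commutativeSemiring public
    using (_^_)
  open import Algebra.Properties.Semiring.Mult A.semiring public
    using () renaming (_×_ to infixr 8 _×ᴬ_)
  private
    module A^ = Algebra.Properties.CommutativeSemiring.Exp A.commutativeSemiring
    module A× = Algebra.Properties.Semiring.Mult A.semiring

  π : Element → Carrier
  π 0ᴱ      = 0#
  π [ a ]   = a
  π (x ⊕ y) = π x + π y
  π (⊖ x)   = - π x

  π-⊗ : ∀ x y → π (x ⊗ y) ≈ π x * π y
  π-⊗ 0ᴱ      z = sym (zeroˡ _)
  π-⊗ [ a ]   z = π-▹ z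
    where
    π-▹ : ∀ z → π (a ▹ z) ≈ a * π z
    π-▹ 0ᴱ      = sym (zeroʳ a)
    π-▹ [ b ]   = refl
    π-▹ (y ⊕ z) = trans (+-cong (π-▹ y) (π-▹ z)) (sym (distribˡ a _ _))
    π-▹ (⊖ y)   = trans (-‿cong (π-▹ y)) (-‿distribʳ-* a _)
      where open import Algebra.Properties.Ring ring using (-‿distribʳ-*)
  π-⊗ (x ⊕ y) z = trans (+-cong (π-⊗ x z) (π-⊗ y z)) (sym (distribʳ _ _ _))
  π-⊗ (⊖ x)   z = trans (-‿cong (π-⊗ x z)) (-‿distribˡ-* _ _)

  π-^ : ∀ x k → π (x ^ k) ≈ π x ^ᶠ k
  π-^ x zero    = refl
  π-^ x (suc k) = trans (π-⊗ x (x ^ k)) (*-congˡ (π-^ x k))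

  π-× : ∀ k x → π (k ×ᴬ x) ≈ k ×ᶠ π x
  π-× zero    x = refl
  π-× (suc k) x = +-congˡ (π-× k x)

  indicator : Fin n → Carrier → ℤ
  indicator i a = if does (from a Fin.≟ i) then 1ℤ else 0ℤ

  private
    indicator-cong : ∀ i {a b} → a ≈ b → indicator i a ≡ indicator i b
    indicator-cong i a≈b = ≡.cong (λ j → if does (j Fin.≟ i) then 1ℤ else 0ℤ) (from-cong a≈b)

    sum-neg : ∀ {m} (t : Fin m → Carrier) → sum (λ i → - t i) ≈ - sum t
    sum-neg {zero}  t = sym -0#≈0#
    sum-neg {suc m} t = trans (+-congˡ (sum-neg (t ∘ Fin.suc))) (-‿+-comm _ _)

    sum-kronecker : ∀ {m} (j : Fin m) (v : Fin m → Carrier) →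
                    sum (λ i → ι (if does (j Fin.≟ i) then 1ℤ else 0ℤ) * v i) ≈ v j
    sum-kronecker {suc m} Fin.zero v = begin
      (1# + 0#) * v Fin.zero + sum (λ i → 0# * v (Fin.suc i))
        ≈⟨ +-cong (trans (*-congʳ (+-identityʳ 1#)) (*-identityˡ _))
                  (trans (sum-cong-≋ {m} (λ i → zeroˡ (v (Fin.suc i)))) (sum-replicate-zero m)) ⟩
      v Fin.zero + 0#
        ≈⟨ +-identityʳ _ ⟩
      v Fin.zero
        ∎
      where open import Relation.Binary.Reasoning.Setoid setoid
    sum-kronecker {suc m} (Fin.suc j) v =
      trans (+-cong (zeroˡ _) (sum-kronecker j (v ∘ Fin.suc))) (+-identityˡ _)

  -- π is recovered from the values of the ℤ-valued test functions, so it respects _≋_.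
  π-expand : ∀ x → π x ≈ sum (λ i → ι (⟦ x ⟧ (indicator i)) * to i)
  π-expand 0ᴱ      = sym (trans (sum-cong-≋ {n} (λ i → zeroˡ _)) (sum-replicate-zero n))
  π-expand [ a ]   = sym (trans (sum-kronecker (from a) to) (strictlyInverseˡ a))
  π-expand (x ⊕ y) = begin
    π x + π y
      ≈⟨ +-cong (π-expand x) (π-expand y) ⟩
    sum (λ i → ι (⟦ x ⟧ (indicator i)) * to i) + sum (λ i → ι (⟦ y ⟧ (indicator i)) * to i)
      ≈⟨ ∑-distrib-+ {n} _ _ ⟨
    sum (λ i → ι (⟦ x ⟧ (indicator i)) * to i + ι (⟦ y ⟧ (indicator i)) * to i)
      ≈⟨ sum-cong-≋ {n} (λ i → trans (*-congʳ (ι-+ (⟦ x ⟧ (indicator i)) _)) (distribʳ (to i) _ _)) ⟨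
    sum (λ i → ι (⟦ x ⟧ (indicator i) ℤ.+ ⟦ y ⟧ (indicator i)) * to i)
      ∎
    where open import Relation.Binary.Reasoning.Setoid setoid
  π-expand (⊖ x)   = begin
    - π x
      ≈⟨ -‿cong (π-expand x) ⟩
    - sum (λ i → ι (⟦ x ⟧ (indicator i)) * to i)
      ≈⟨ sum-neg {n} _ ⟨
    sum (λ i → - (ι (⟦ x ⟧ (indicator i)) * to i))
      ≈⟨ sum-cong-≋ {n} (λ i → trans (*-congʳ (ι-neg (⟦ x ⟧ (indicator i)))) (sym (-‿distribˡ-* _ _))) ⟨
    sum (λ i → ι (ℤ.- ⟦ x ⟧ (indicator i)) * to i)
      ∎
    where open import Relation.Binary.Reasoning.Setoid setoid

  π-cong : ∀ {x y} → x ≋ y → π x ≈ π y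
  π-cong {x} {y} x≋y = trans (π-expand x) (trans
    (sum-cong-≋ {n} (λ i → *-congʳ (reflexive (≡.cong ι (at x≋y (indicator i) (indicator-cong i))))))
    (sym (π-expand y)))

  I : Element → Set ℓ
  I x = π x ≈ 0#

  I-absorb : ∀ a {x} → I x → I (a ⊗ x)
  I-absorb a {x} i = trans (π-⊗ a x) (trans (*-congˡ i) (zeroʳ _))

  open IdealPowers monoidRing I I-absorb public

  ∈I^suc⇒I : ∀ {k x} → x ∈I^ suc k → I x
  ∈I^suc⇒I 0∈               = refl
  ∈I^suc⇒I (+∈ p q)         = trans (+-cong (∈I^suc⇒I p) (∈I^suc⇒I q)) (+-identityʳ 0#)
  ∈I^suc⇒I (*∈ {x = x} {y} i _) = trans (π-⊗ x y) (trans (*-congʳ i) (zeroˡ _))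
  ∈I^suc⇒I (resp e p)       = trans (sym (π-cong e)) (∈I^suc⇒I p)

  []-^ : ∀ a k → [ a ] ^ k ≋ [ a ^ᶠ k ]
  []-^ a zero    = A.refl
  []-^ a (suc k) = A.*-congˡ {[ a ]} ([]-^ a k)

  module Characteristic {p} (pr : Prime p) (p×1≈0 : p ×ᶠ 1# ≈ 0#) (1≉0 : ¬ 1# ≈ 0#) where

    open BinomialExpansion commutativeSemiring using () renaming (freshman to freshmanᶠ)
    open BinomialExpansion A.commutativeSemiring using (freshman)
    open Integers.Solver monoidRing using (solve; _:=_; _:+_; _:*_; _:-_; :-_)
    open Map (_^ᶠ p) (^-congˡ p) (λ a b → ^-distrib-* a b p) renaming (map to φ; map-cong to φ-cong; map-⊗ to φ-⊗)

    private
      p≢0 : NonZero p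
      p≢0 = prime⇒nonZero pr

      p×≈0 : ∀ x → p ×ᶠ x ≈ 0#
      p×≈0 x = trans (×-congʳ p (sym (*-identityˡ x)))
                     (trans (sym (×-assoc-* p 1# x)) (trans (*-congʳ p×1≈0) (zeroˡ x)))

      0^p : 0# ^ᶠ p ≈ 0#
      0^p = 0^ p {{p≢0}}
        where
        0^ : ∀ k → .{{NonZero k}} → 0# ^ᶠ k ≈ 0#
        0^ (suc k) = zeroˡ _

      0ᴬ^p : 0ᴱ ^ p ≋ 0ᴱ
      0ᴬ^p = 0^ p {{p≢0}}
        where
        0^ : ∀ k → .{{NonZero k}} → 0ᴱ ^ k ≋ 0ᴱ
        0^ (suc k) = A.zeroˡ (0ᴱ ^ k)

    frobenius-+ : ∀ x y → (x + y) ^ᶠ p ≈ x ^ᶠ p + y ^ᶠ p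
    frobenius-+ x y = let z , e = freshmanᶠ pr x y in
      trans e (trans (+-congˡ (p×≈0 _)) (+-identityʳ _))

    frobenius-neg : ∀ x → (- x) ^ᶠ p ≈ - (x ^ᶠ p)
    frobenius-neg x = inverseʳ-unique (x ^ᶠ p) ((- x) ^ᶠ p) (begin
      x ^ᶠ p + (- x) ^ᶠ p   ≈⟨ frobenius-+ x (- x) ⟨
      (x - x) ^ᶠ p          ≈⟨ ^-congˡ p (-‿inverseʳ x) ⟩
      0# ^ᶠ p               ≈⟨ 0^p ⟩
      0#                    ∎)
      where
      open import Algebra.Properties.Group +-group using (inverseʳ-unique)
      open import Relation.Binary.Reasoning.Setoid setoid

    -- φ lifts the Frobenius map, which fixes 0; therefore φ maps I, and with it every power of I,
    -- into itself.
    π-φ : ∀ x → π (φ x) ≈ π x ^ᶠ p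
    π-φ 0ᴱ      = sym 0^p
    π-φ [ a ]   = refl
    π-φ (x ⊕ y) = trans (+-cong (π-φ x) (π-φ y)) (sym (frobenius-+ _ _))
    π-φ (⊖ x)   = trans (-‿cong (π-φ x)) (sym (frobenius-neg _))

    φ∈ : ∀ {k x} → x ∈I^ k → φ x ∈I^ k
    φ∈ whole      = whole
    φ∈ 0∈         = 0∈
    φ∈ (+∈ p q)   = +∈ (φ∈ p) (φ∈ q)
    φ∈ (*∈ {x = x} {y} i q) = resp (A.sym (φ-⊗ x y))
      (*∈ {x = φ x} (trans (π-φ x) (trans (^-congˡ p i) 0^p)) (φ∈ q))
    φ∈ (resp e p) = resp (φ-cong e) (φ∈ p)

    open import Relation.Binary.Reasoning.Setoid A.setoid

    -- y is the p-derivation of x: the difference between the Frobenius lift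
    -- and the p-th power, divided by p.
    _δ_ : Element → Element → Set (c ⊔ ℓ)
    x δ y = p ×ᴬ y ≋ φ x A.- x ^ p

    private
      p× : ∀ x → p ×ᴬ x ≋ (p ×ᴬ A.1#) ⊗ x
      p× x = A.sym (A.trans (A×.×-assoc-* p A.1# x) (A×.×-congʳ p (A.*-identityˡ x)))

      P = p ×ᴬ A.1#

    δ-+ : ∀ {x x′ y y′} → x δ y → x′ δ y′ → (x ⊕ x′) δ (y ⊕ y′ A.- x ⊗ proj₁ (freshman pr x x′))
    δ-+ {x} {x′} {y} {y′} d d′ = begin
      p ×ᴬ (y ⊕ y′ A.- x ⊗ z)                        ≈⟨ p× _ ⟩
      P ⊗ (y ⊕ y′ A.- x ⊗ z)                         ≈⟨ spread P y y′ (x ⊗ z) ⟩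
      P ⊗ y ⊕ P ⊗ y′ A.- P ⊗ (x ⊗ z)                 ≈⟨ A.+-cong (A.+-cong (p× y) (p× y′)) (A.-‿cong (p× _)) ⟨
      p ×ᴬ y ⊕ p ×ᴬ y′ A.- p ×ᴬ (x ⊗ z)              ≈⟨ A.+-congʳ (A.+-cong d d′) ⟩
      (φ x A.- x ^ p) ⊕ (φ x′ A.- x′ ^ p) A.- p ×ᴬ (x ⊗ z)
        ≈⟨ collect (φ x) (x ^ p) (φ x′) (x′ ^ p) _ ⟩
      φ x ⊕ φ x′ A.- (x ^ p ⊕ x′ ^ p ⊕ p ×ᴬ (x ⊗ z)) ≈⟨ A.+-congˡ (A.-‿cong (proj₂ (freshman pr x x′))) ⟨
      φ x ⊕ φ x′ A.- (x ⊕ x′) ^ p                    ∎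
      where
      z = proj₁ (freshman pr x x′)
      spread : ∀ a b c d → a ⊗ (b ⊕ c A.- d) ≋ a ⊗ b ⊕ a ⊗ c A.- a ⊗ d
      spread = solve 4 (λ a b c d → a :* (b :+ c :- d) := a :* b :+ a :* c :- a :* d) A.refl
      collect : ∀ a b c d e → (a A.- b) ⊕ (c A.- d) A.- e ≋ a ⊕ c A.- (b ⊕ d ⊕ e)
      collect = solve 5 (λ a b c d e → (a :- b) :+ (c :- d) :- e := a :+ c :- (b :+ d :+ e)) A.refl

    -- Of the equivalent forms of the product rule, this one pairs `y` with `φ x′` and `y′` with
    -- `x ^ p`: if x is in I, then so is its p-th power.
    δ-* : ∀ {x x′ y y′} → x δ y → x′ δ y′ → (x ⊗ x′) δ (y ⊗ φ x′ ⊕ x ^ p ⊗ y′)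
    δ-* {x} {x′} {y} {y′} d d′ = begin
      p ×ᴬ (y ⊗ φ x′ ⊕ x ^ p ⊗ y′)                   ≈⟨ p× _ ⟩
      P ⊗ (y ⊗ φ x′ ⊕ x ^ p ⊗ y′)                    ≈⟨ spread P y (φ x′) (x ^ p) y′ ⟩
      (P ⊗ y) ⊗ φ x′ ⊕ x ^ p ⊗ (P ⊗ y′)              ≈⟨ A.+-cong (A.*-congʳ (A.trans (A.sym (p× y)) d))
                                                                    (A.*-congˡ {x ^ p} (A.trans (A.sym (p× y′)) d′)) ⟩
      (φ x A.- x ^ p) ⊗ φ x′ ⊕ x ^ p ⊗ (φ x′ A.- x′ ^ p)
        ≈⟨ collect (φ x) (x ^ p) (φ x′) (x′ ^ p) ⟩
      φ x ⊗ φ x′ A.- x ^ p ⊗ x′ ^ p                  ≈⟨ A.+-cong (φ-⊗ x x′) (A.-‿cong (A^.^-distrib-* x x′ p)) ⟨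
      φ (x ⊗ x′) A.- (x ⊗ x′) ^ p                    ∎
      where
      spread : ∀ a b c d e → a ⊗ (b ⊗ c ⊕ d ⊗ e) ≋ (a ⊗ b) ⊗ c ⊕ d ⊗ (a ⊗ e)
      spread = solve 5 (λ a b c d e → a :* (b :* c :+ d :* e) := (a :* b) :* c :+ d :* (a :* e)) A.refl
      collect : ∀ a b c d → (a A.- b) ⊗ c ⊕ b ⊗ (c A.- d) ≋ a ⊗ c A.- b ⊗ d
      collect = solve 4 (λ a b c d → (a :- b) :* c :+ b :* (c :- d) := a :* c :- b :* d) A.refl

    δ-0 : 0ᴱ δ 0ᴱ
    δ-0 = A.trans (A.trans (p× 0ᴱ) (A.zeroʳ P)) (A.sym (A.trans (A.+-congˡ (A.-‿cong 0ᴬ^p)) (A.-‿inverseʳ 0ᴱ)))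

    δ-[] : ∀ a → [ a ] δ 0ᴱ
    δ-[] a = A.trans (A.trans (p× 0ᴱ) (A.zeroʳ P))
      (A.sym (A.trans (A.+-congˡ {[ a ^ᶠ p ]} (A.-‿cong ([]-^ a p))) (A.-‿inverseʳ [ a ^ᶠ p ])))

    δ-resp : ∀ {x x′ y} → x ≋ x′ → x δ y → x′ δ y
    δ-resp e d = A.trans d (A.+-cong (φ-cong e) (A.-‿cong (A^.^-congˡ p e)))

    δ-neg : ∀ {x y} → x δ y → (⊖ x) δ (x ⊗ proj₁ (freshman pr x (⊖ x)) A.- y)
    δ-neg {x} {y} d = begin
      p ×ᴬ (x ⊗ z A.- y)                             ≈⟨ p× _ ⟩
      P ⊗ (x ⊗ z A.- y)                              ≈⟨ spread P (x ⊗ z) y ⟩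
      P ⊗ (x ⊗ z) A.- P ⊗ y                          ≈⟨ A.+-cong (p× _) (A.-‿cong (p× y)) ⟨
      p ×ᴬ (x ⊗ z) A.- p ×ᴬ y                        ≈⟨ A.+-congˡ (A.-‿cong d) ⟩
      p ×ᴬ (x ⊗ z) A.- (φ x A.- x ^ p)               ≈⟨ collect _ (φ x) (x ^ p) ((⊖ x) ^ p) ⟩
      (⊖ φ x A.- (⊖ x) ^ p) ⊕ (x ^ p ⊕ (⊖ x) ^ p ⊕ p ×ᴬ (x ⊗ z))
        ≈⟨ A.+-congˡ (proj₂ (freshman pr x (⊖ x))) ⟨
      (⊖ φ x A.- (⊖ x) ^ p) ⊕ (x ⊕ ⊖ x) ^ p
        ≈⟨ A.+-congˡ (A.trans (A^.^-congˡ p (A.-‿inverseʳ x)) 0ᴬ^p) ⟩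
      (⊖ φ x A.- (⊖ x) ^ p) ⊕ 0ᴱ                     ≈⟨ A.+-identityʳ _ ⟩
      ⊖ φ x A.- (⊖ x) ^ p                            ∎
      where
      z = proj₁ (freshman pr x (⊖ x))
      spread : ∀ a b c → a ⊗ (b A.- c) ≋ a ⊗ b A.- a ⊗ c
      spread = solve 3 (λ a b c → a :* (b :- c) := a :* b :- a :* c) A.refl
      collect : ∀ a b c d → a A.- (b A.- c) ≋ (⊖ b A.- d) ⊕ (c ⊕ d ⊕ a)
      collect = solve 4 (λ a b c d → a :- (b :- c) := (:- b :- d) :+ (c :+ d :+ a)) A.refl

    -- On brackets φ is the p-th power, so 0 is a p-derivation there; sums and negatives follow from
    -- their rules. Division by p is replaced throughout by exhibiting the quotient.
    δ-total : ∀ x → ∃[ y ] x δ y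
    δ-total 0ᴱ      = 0ᴱ , δ-0
    δ-total [ a ]   = 0ᴱ , δ-[] a
    δ-total (x ⊕ x′) = _ , δ-+ (proj₂ (δ-total x)) (proj₂ (δ-total x′))
    δ-total (⊖ x)   = _ , δ-neg (proj₂ (δ-total x))

    -- For x in I and x′ in I ^ (k + 1), the product rule gives `y ⊗ φ x′` in I ^ (k + 1) and
    -- `x ^ p ⊗ y′` in I · I ^ k, so just one power of I is lost. In a sum the correction is a
    -- multiple of x and loses none.
    δ-∈ : ∀ {k x} → x ∈I^ suc k → ∃[ y ] (x δ y × y ∈I^ k)
    δ-∈ 0∈ = 0ᴱ , δ-0 , 0∈
    δ-∈ (+∈ {x = x} {x′} x∈ x′∈) =
      let y , d , y∈ = δ-∈ x∈ ; y′ , d′ , y′∈ = δ-∈ x′∈ in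
      _ , δ-+ d d′ , -∈ (+∈ y∈ y′∈) (resp (A.*-comm (proj₁ (freshman pr x x′)) x) (absorb (proj₁ (freshman pr x x′)) (pred∈ x∈)))
    -- Here x′ is only known to lie in I ^ 0, which the recursion does not cover; membership of the
    -- result in I ^ 0 says nothing, so any p-derivation will do.
    δ-∈ {zero}  (*∈ {x = x} {x′} _ _) = _ , proj₂ (δ-total (x ⊗ x′)) , whole
    δ-∈ {suc k} (*∈ {x = x} {x′} i x′∈) =
      let y , d = δ-total x ; y′ , d′ , y′∈ = δ-∈ x′∈ in
      _ , δ-* d d′ , +∈ (absorb y (φ∈ x′∈))
        (*∈ {x = x ^ p} (trans (π-^ x p) (trans (^-congˡ p i) 0^p)) y′∈)
    δ-∈ (resp e x∈) = let y , d , y∈ = δ-∈ x∈ in y , δ-resp e d , y∈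

    φ-×1 : ∀ k → φ (k ×ᴬ A.1#) ≋ k ×ᴬ A.1#
    φ-×1 zero    = A.refl
    φ-×1 (suc k) = A.+-cong ([]-cong (1^ p)) (φ-×1 k)
      where
      1^ : ∀ k → 1# ^ᶠ k ≈ 1#
      1^ zero    = refl
      1^ (suc k) = trans (*-identityˡ _) (1^ k)

    ×1-^ : ∀ m k → (m ×ᴬ A.1#) ^ k ≋ (m ℕ.^ k) ×ᴬ A.1#
    ×1-^ m zero    = A.sym (A.+-identityʳ A.1#)
    ×1-^ m (suc k) = A.trans (A.*-congˡ {m ×ᴬ A.1#} (×1-^ m k)) (A.sym (A×.×1-homo-* m (m ℕ.^ k)))

    -- Equality is tested by functions with values in ℤ, which is torsion-free. This makes
    -- p-derivations unique.
    ×-torsion-free : ∀ k .{{_ : NonZero k}} {x y} → k ×ᴬ x ≋ k ×ᴬ y → x ≋ y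
    ×-torsion-free k {x} {y} e = mk≋ λ h hc → ℤ.*-cancelˡ-≡ (+ k) _ _ {{nonZero k}}
      (≡.trans (≡.sym (⟦×⟧ k x h)) (≡.trans (at e h hc) (⟦×⟧ k y h)))
      where
      nonZero : ∀ k → .{{NonZero k}} → ℤ.NonZero (+ k)
      nonZero (suc _) = _
      ⟦×⟧ : ∀ k x h → ⟦ k ×ᴬ x ⟧ h ≡ + k ℤ.* ⟦ x ⟧ h
      ⟦×⟧ zero    x h = ≡.sym (ℤ.*-zeroˡ (⟦ x ⟧ h))
      ⟦×⟧ (suc k) x h = ≡.trans (≡.cong (ℤ._+_ (⟦ x ⟧ h)) (⟦×⟧ k x h)) (≡.sym (ℤ.suc-* (+ k) (⟦ x ⟧ h)))

    ×1≈0⇒∣ : ∀ k → k ×ᶠ 1# ≈ 0# → p ∣ k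
    ×1≈0⇒∣ k k×1≈0 with p ∣? k
    ... | yes p∣k = p∣k
    ... | no  p∤k = ⊥-elim (1≉0 1≈0)
      where
      open import Algebra.Properties.Semiring.Mult semiring using (×-assocˡ)

      coprime : Coprime k p
      coprime {d} (d∣k , d∣p) with prime⇒irreducible pr d∣p
      ... | inj₁ d≡1 = d≡1
      ... | inj₂ ≡.refl = ⊥-elim (p∤k d∣k)

      multiple : ∀ a b → b ×ᶠ 1# ≈ 0# → (a ℕ.* b) ×ᶠ 1# ≈ 0#
      multiple a b e = trans (sym (×-assocˡ 1# a b)) (trans (×-congʳ a e) (a×0 a))
        where
        a×0 : ∀ a → a ×ᶠ 0# ≈ 0#
        a×0 zero    = refl
        a×0 (suc a) = trans (+-identityˡ _) (a×0 a)

      one : ∀ a b → 1 ℕ.+ a ≡ b → a ×ᶠ 1# ≈ 0# → b ×ᶠ 1# ≈ 0# → 1# ≈ 0#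
      one a b ≡.refl ea eb = trans (sym (trans (+-congˡ ea) (+-identityʳ 1#))) eb

      1≈0 : 1# ≈ 0#
      1≈0 with coprime-Bézout coprime
      ... | Bézout.+- x y eq = one _ _ eq (multiple y p p×1≈0) (multiple x k k×1≈0)
      ... | Bézout.-+ x y eq = one _ _ eq (multiple x k k×1≈0) (multiple y p p×1≈0)

    -- For N = p M ≠ 0 the p-derivation of N is M - N ^ p / p = - M (N ^ (p - 1) - 1),
    -- which has one factor p less than N.
    ∈I^⇒∣ : ∀ b N → N ×ᴬ A.1# ∈I^ b → p ℕ.^ b ∣ N
    ∈I^⇒∣ zero    N _ = 1∣ N
    ∈I^⇒∣ (suc b) N N∈ with ×1≈0⇒∣ N (trans (sym (π-× N A.1#)) (∈I^suc⇒I N∈)) | δ-∈ N∈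
    ... | divides-refl zero       | _ = _ ∣0
    ... | divides-refl M@(suc M′) | y , d , y∈ =
      ≡.subst (p ℕ.^ suc b ∣_) (ℕ.*-comm p M) (*-monoʳ-∣ p
        (prime-power-cancel pr b {M} p∤K (∈I^⇒∣ b (M ℕ.* K) (resp (A.trans (A.-‿cong y≋) (⊖⊖ _)) (neg∈ y∈)))))
      where
      open import Algebra.Properties.Ring A.ring using () renaming (-‿involutive to ⊖⊖)
      M*p = M ℕ.* p
      K = ℕ.pred (M*p ℕ.^ ℕ.pred p)

      sucK≡ : suc K ≡ M*p ℕ.^ ℕ.pred p
      sucK≡ = ℕ.suc-pred _ {{ℕ.m^n≢0 M*p (ℕ.pred p) {{ℕ.m*n≢0 M p {{_}} {{p≢0}}}}}}

      -- `suc K` is a power of a multiple of p with exponent p - 1 ≥ 1, so K ≡ -1 modulo p.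
      p∤K : ¬ p ∣ K
      p∤K p∣K = ℕ.<⇒≱ 1<p (∣⇒≤ (∣m+n∣m⇒∣n (≡.subst (p ∣_) (≡.trans (≡.sym sucK≡) (ℕ.+-comm 1 K))
        (p∣^ (ℕ.pred p) (ℕ.≤-pred (≡.subst (1 ℕ.<_) (≡.sym (ℕ.suc-pred p {{p≢0}})) 1<p)))) p∣K))
        where
        1<p : 1 ℕ.< p
        1<p = ℕ.nonTrivial⇒n>1 p {{prime⇒nonTrivial pr}}
        p∣^ : ∀ k → 1 ℕ.≤ k → p ∣ M*p ℕ.^ k
        p∣^ (suc k) _ = ∣m⇒∣m*n (M*p ℕ.^ k) (divides-refl M)

      N^p : M*p ℕ.^ p ≡ M*p ℕ.+ p ℕ.* (M ℕ.* K)
      N^p = ≡.trans (≡.cong (M*p ℕ.^_) (≡.sym (ℕ.suc-pred p {{p≢0}})))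
        (≡.trans (≡.cong (M*p ℕ.*_) (≡.sym sucK≡)) (expand M p K))
        where
        expand : ∀ m p k → (m ℕ.* p) ℕ.* (1 ℕ.+ k) ≡ m ℕ.* p ℕ.+ p ℕ.* (m ℕ.* k)
        expand = ℕ-Solver.solve-∀

      y≋ : y ≋ ⊖ ((M ℕ.* K) ×ᴬ A.1#)
      y≋ = ×-torsion-free p {{p≢0}} (begin
        p ×ᴬ y
          ≈⟨ d ⟩
        φ (M*p ×ᴬ A.1#) A.- (M*p ×ᴬ A.1#) ^ p
          ≈⟨ A.+-cong (φ-×1 M*p) (A.-‿cong (A.trans (×1-^ M*p p) (A×.×-congˡ N^p))) ⟩
        M*p ×ᴬ A.1# A.- (M*p ℕ.+ p ℕ.* (M ℕ.* K)) ×ᴬ A.1#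
          ≈⟨ A.+-congˡ (A.-‿cong (A×.×-homo-+ A.1# M*p _)) ⟩
        M*p ×ᴬ A.1# A.- (M*p ×ᴬ A.1# ⊕ (p ℕ.* (M ℕ.* K)) ×ᴬ A.1#)
          ≈⟨ cancel _ _ ⟩
        ⊖ ((p ℕ.* (M ℕ.* K)) ×ᴬ A.1#)
          ≈⟨ A.-‿cong (A.trans (A.sym (A×.×-assocˡ A.1# p _)) (p× _)) ⟩
        ⊖ (P ⊗ (M ℕ.* K) ×ᴬ A.1#)
          ≈⟨ neg-*  P _ ⟩
        P ⊗ (⊖ ((M ℕ.* K) ×ᴬ A.1#))
          ≈⟨ p× _ ⟨
        p ×ᴬ (⊖ ((M ℕ.* K) ×ᴬ A.1#))
          ∎)
        where
        cancel : ∀ a b → a A.- (a ⊕ b) ≋ ⊖ b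
        cancel = solve 2 (λ a b → a :- (a :+ b) := :- b) A.refl
        neg-* : ∀ a b → ⊖ (a ⊗ b) ≋ a ⊗ ⊖ b
        neg-* = solve 2 (λ a b → :- (a :* b) := a :* (:- b)) A.refl

-- Finite fields

module _ {c ℓ} (R : CommutativeRing c ℓ) where

  open CommutativeRing R

  Nontrivial : Set ℓ
  Nontrivial = ¬ 1# ≈ 0#

  NonzeroCancellable NonzeroInvertible : Set (c ⊔ ℓ)
  NonzeroCancellable = ∀ {x y} → ¬ x ≈ 0# → x * y ≈ 0# → y ≈ 0#
  NonzeroInvertible  = ∀ x → ¬ x ≈ 0# → ∃[ y ] x * y ≈ 1#

-- Polynomial functions and the number of their roots

module RootBound {c ℓ} (R : CommutativeRing c ℓ) (cancel : NonzeroCancellable R) where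

  open CommutativeRing R
  open Integers.Solver R using (solve; _:=_; _:+_; _:*_; _:-_)
  open import Algebra.Properties.Semiring.Exp semiring using (_^_)
  open import Algebra.Properties.Group +-group using (x∙y⁻¹≈ε⇒x≈y)

  -- f is a polynomial function of degree ≤ n with coefficient a at xⁿ, expressed
  -- through its divided differences g(x) = (f(x) - f(r)) / (x - r).
  HasLead : ℕ → Carrier → (Carrier → Carrier) → Set (c ⊔ ℓ)
  HasLead zero    a f = Level.Lift c (∀ x → f x ≈ a)
  HasLead (suc n) a f = ∀ r → ∃[ g ] (HasLead n a g × (∀ x → f x ≈ f r + (x - r) * g x))

  lead-+ : ∀ n {a b f g} → HasLead n a f → HasLead n b g → HasLead n (a + b) (λ x → f x + g x)
  lead-+ zero    (Level.lift p) (Level.lift q) = Level.lift λ x → +-cong (p x) (q x)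
  lead-+ (suc n) {f = f} {g} p q r =
    let f′ , p′ , e = p r ; g′ , q′ , e′ = q r in
    _ , lead-+ n p′ q′ , λ x → trans (+-cong (e x) (e′ x)) (collect (f r) (x - r) (f′ x) (g r) (g′ x))
    where
    collect : ∀ a d b a′ b′ → (a + d * b) + (a′ + d * b′) ≈ (a + a′) + d * (b + b′)
    collect = solve 5 (λ a d b a′ b′ → (a :+ d :* b) :+ (a′ :+ d :* b′) := (a :+ a′) :+ d :* (b :+ b′)) refl

  lead-* : ∀ n k {a f} → HasLead n a f → HasLead n (k * a) (λ x → k * f x)
  lead-* zero    k (Level.lift p) = Level.lift λ x → *-congˡ (p x)
  lead-* (suc n) k {f = f} p r =
    let f′ , p′ , e = p r in
    _ , lead-* n k p′ , λ x → trans (*-congˡ (e x)) (collect k (f r) (x - r) (f′ x))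
    where
    collect : ∀ k a d b → k * (a + d * b) ≈ k * a + d * (k * b)
    collect = solve 4 (λ k a d b → k :* (a :+ d :* b) := k :* a :+ d :* (k :* b)) refl

  lead-raise : ∀ n {a f} → HasLead n a f → HasLead (suc n) 0# f
  lead-raise zero    (Level.lift p) r = (λ _ → 0#) , Level.lift (λ _ → refl) , λ x →
    trans (p x) (trans (sym (p r)) (sym (trans (+-congˡ (zeroʳ _)) (+-identityʳ _))))
  lead-raise (suc n) p r = let f′ , p′ , e = p r in f′ , lead-raise n p′ , e

  lead-resp : ∀ n {a b f} → a ≈ b → HasLead n a f → HasLead n b f
  lead-resp zero    e (Level.lift p) = Level.lift λ x → trans (p x) e
  lead-resp (suc n) e p r = let f′ , p′ , e′ = p r in f′ , lead-resp n e p′ , e′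

  lead-^ : ∀ n → HasLead n 1# (_^ n)
  lead-^ zero    = Level.lift λ _ → refl
  lead-^ (suc zero) r = (λ _ → 1#) , Level.lift (λ _ → refl) , λ x → identity x r 1#
    where
    identity : ∀ x r e → x * e ≈ r * e + (x - r) * e
    identity = solve 3 (λ x r e → x :* e := r :* e :+ (x :- r) :* e) refl
  lead-^ (suc (suc n)) r =
    let g , p , e = lead-^ (suc n) r in
    (λ x → x ^ suc n + r * g x) ,
    lead-resp (suc n) (trans (+-congˡ (zeroʳ r)) (+-identityʳ 1#))
      (lead-+ (suc n) (lead-^ (suc n)) (lead-* (suc n) r (lead-raise n p))) ,
    λ x → trans (split x r (x ^ suc n)) (trans (+-congʳ (*-congˡ (e x)))
      (collect (x ^ suc n) r (r ^ suc n) (x - r) (g x)))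
    where
    split : ∀ x r y → x * y ≈ r * y + (x - r) * y
    split = solve 3 (λ x r y → x :* y := r :* y :+ (x :- r) :* y) refl
    collect : ∀ y r s d g → r * (s + d * g) + d * y ≈ r * s + d * (y + r * g)
    collect = solve 5 (λ y r s d g → r :* (s :+ d :* g) :+ d :* y := r :* s :+ d :* (y :+ r :* g)) refl

  -- The divided difference at the first root has the same leading coefficient and vanishes at the
  -- other roots, where the factor `x - r` is nonzero and cancels.
  roots : ∀ n {a f} → HasLead n a f → (ρ : Fin (suc n) → Carrier) →
          (∀ {i j} → ρ i ≈ ρ j → i ≡ j) → (∀ i → f (ρ i) ≈ 0#) → a ≈ 0#
  roots zero    (Level.lift p) ρ ρ-inj zeros = trans (sym (p (ρ Fin.zero))) (zeros Fin.zero)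
  roots (suc n) p ρ ρ-inj zeros =
    let g , p′ , e = p (ρ Fin.zero) in
    roots n p′ (ρ ∘ Fin.suc) (Fin.suc-injective ∘ ρ-inj) λ i →
      cancel (λ d≈0 → Fin.0≢1+n (≡.sym (ρ-inj (x∙y⁻¹≈ε⇒x≈y _ _ d≈0))))
        (trans (sym (+-identityˡ _)) (trans (+-congʳ (sym (zeros Fin.zero)))
          (trans (sym (e (ρ (Fin.suc i)))) (zeros (Fin.suc i)))))

module FiniteField {c ℓ n′} (R : CommutativeRing c ℓ)
  (order : Inverse (≡.setoid (Fin (suc n′))) (CommutativeRing.setoid R))
  (_≟_ : Decidable (CommutativeRing._≈_ R))
  (1≉0 : Nontrivial R) (invert : NonzeroInvertible R) where

  open CommutativeRing R

  private n = suc n′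

  open Inverse order using (to; from; from-cong; strictlyInverseˡ; strictlyInverseʳ)
  open Teichmüller R order
  open import Algebra.Properties.CommutativeSemiring.Exp commutativeSemiring
    using (^-congˡ; ^-congʳ; ^-distrib-*; ^-homo-*; ^-assocʳ) renaming (_^_ to _^ᶠ_)
  open import Algebra.Properties.Semiring.Mult semiring using (×1-homo-*)
    renaming (_×_ to infixr 8 _×ᶠ_)
  open import Algebra.Properties.Group +-group using (∙-cancelʳ; x∙y⁻¹≈ε⇒x≈y)
  open import Algebra.Properties.Semiring.Sum semiring
    using (sum; ∑-distrib-+; sum-replicate; sum-cong-≋; sum-permute)
  private module ∏ = Algebra.Properties.CommutativeMonoid.Sum *-commutativeMonoid

  cancel-≉0 : ∀ {x y} → ¬ x ≈ 0# → x * y ≈ 0# → y ≈ 0#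
  cancel-≉0 {x} {y} x≉0 xy≈0 = let x⁻¹ , e = invert x x≉0 in begin
    y               ≈⟨ *-identityˡ y ⟨
    1# * y          ≈⟨ *-congʳ (trans (*-comm x⁻¹ x) e) ⟨
    (x⁻¹ * x) * y   ≈⟨ *-assoc _ _ _ ⟩
    x⁻¹ * (x * y)   ≈⟨ *-congˡ xy≈0 ⟩
    x⁻¹ * 0#        ≈⟨ zeroʳ _ ⟩
    0#              ∎
    where open import Relation.Binary.Reasoning.Setoid setoid

  ^≈0 : ∀ {x} k → x ^ᶠ k ≈ 0# → x ≈ 0#
  ^≈0 zero    1≈0 = ⊥-elim (1≉0 1≈0)
  ^≈0 {x} (suc k) e with x ≟ 0#
  ... | yes x≈0 = x≈0
  ... | no  x≉0 = ^≈0 k (cancel-≉0 x≉0 e)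

  translation : Carrier → Permutation′ n
  translation a = permutation (λ i → from (a + to i)) (λ i → from (- a + to i))
    (λ i → inverse a (- a) (-‿inverseʳ a) i) (λ i → inverse (- a) a (-‿inverseˡ a) i)
    where
    inverse : ∀ a b → a + b ≈ 0# → ∀ i → from (a + to (from (b + to i))) ≡ i
    inverse a b e i = ≡.trans (from-cong (trans (+-congˡ (strictlyInverseˡ _))
      (trans (sym (+-assoc a b _)) (trans (+-congʳ e) (+-identityˡ _))))) (strictlyInverseʳ i)

  scaling : ∀ {x y} → x * y ≈ 1# → Permutation′ n
  scaling {x} {y} e = permutation (λ i → from (x * to i)) (λ i → from (y * to i))
    (inverse x y e) (inverse y x (trans (*-comm y x) e))
    where
    inverse : ∀ a b → a * b ≈ 1# → ∀ i → from (a * to (from (b * to i))) ≡ i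
    inverse a b e i = ≡.trans (from-cong (trans (*-congˡ (strictlyInverseˡ _))
      (trans (sym (*-assoc a b _)) (trans (*-congʳ e) (*-identityˡ _))))) (strictlyInverseʳ i)

  -- Translation by 1 permutes the field, so adding n · 1 to the sum of all elements does not change
  -- it.
  n×1≈0 : n ×ᶠ 1# ≈ 0#
  n×1≈0 = ∙-cancelʳ (sum to) (n ×ᶠ 1#) 0# (begin
    n ×ᶠ 1# + sum to                     ≈⟨ +-congʳ (sum-replicate n) ⟨
    sum {n} (λ _ → 1#) + sum to          ≈⟨ ∑-distrib-+ {n} (λ _ → 1#) to ⟨
    sum (λ i → 1# + to i)                ≈⟨ sum-cong-≋ {n} (λ i → strictlyInverseˡ (1# + to i)) ⟨
    sum (λ i → to (from (1# + to i)))    ≈⟨ sum-permute to (translation 1#) ⟨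
    sum to                               ≈⟨ +-identityˡ _ ⟨
    0# + sum to                          ∎)
    where open import Relation.Binary.Reasoning.Setoid setoid

  characteristic : ∀ p k → n ≡ p ℕ.^ k → p ×ᶠ 1# ≈ 0#
  characteristic p k n≡p^k = ^≈0 k (trans (sym (×1-^ᶠ k)) (trans (reflexive (≡.cong (_×ᶠ 1#) (≡.sym n≡p^k))) n×1≈0))
    where
    ×1-^ᶠ : ∀ k → (p ℕ.^ k) ×ᶠ 1# ≈ (p ×ᶠ 1#) ^ᶠ k
    ×1-^ᶠ zero    = +-identityʳ 1#
    ×1-^ᶠ (suc k) = trans (×1-homo-* p (p ℕ.^ k)) (*-congˡ (×1-^ᶠ k))

  -- Multiplication by x permutes the nonzero elements, so their product is
  -- multiplied by x ^ (n - 1); on 0 both g and its factor are set to 1.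
  fermat : ∀ {x} → ¬ x ≈ 0# → x ^ᶠ n′ ≈ 1#
  fermat {x} x≉0 = begin
    x ^ᶠ n′                  ≈⟨ *-identityʳ _ ⟨
    x ^ᶠ n′ * 1#             ≈⟨ *-congˡ e ⟨
    x ^ᶠ n′ * (G * G⁻¹)      ≈⟨ *-assoc _ _ _ ⟨
    (x ^ᶠ n′ * G) * G⁻¹      ≈⟨ *-congʳ x^n′*G ⟩
    G * G⁻¹                  ≈⟨ e ⟩
    1#                       ∎
    where
    open import Relation.Binary.Reasoning.Setoid setoid

    orOne : ∀ {y} → Carrier → Dec (y ≈ 0#) → Carrier
    orOne z (yes _) = 1#
    orOne z (no  _) = z

    g h : Fin n → Carrier
    g i = orOne (to i) (to i ≟ 0#)
    h i = orOne x (to i ≟ 0#)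

    G = ∏.sum g

    ∏≉0 : ∀ {m} (t : Fin m → Carrier) → (∀ i → ¬ t i ≈ 0#) → ¬ ∏.sum t ≈ 0#
    ∏≉0 {zero}  t t≉0 = 1≉0
    ∏≉0 {suc m} t t≉0 ∏≈0 = ∏≉0 (t ∘ Fin.suc) (t≉0 ∘ Fin.suc) (cancel-≉0 (t≉0 Fin.zero) ∏≈0)

    g≉0 : ∀ i → ¬ g i ≈ 0#
    g≉0 i with to i ≟ 0#
    ... | yes _ = 1≉0
    ... | no  q = q

    G⁻¹ = proj₁ (invert G (∏≉0 g g≉0))
    e   = proj₂ (invert G (∏≉0 g g≉0))

    g-scale : ∀ i → g (from (x * to i)) ≈ h i * g i
    g-scale i with to i ≟ 0# | to (from (x * to i)) ≟ 0#
    ... | yes _    | yes _    = sym (*-identityˡ 1#)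
    ... | yes y≈0  | no  xy≉0 = ⊥-elim (xy≉0 (trans (strictlyInverseˡ _) (trans (*-congˡ y≈0) (zeroʳ x))))
    ... | no  y≉0  | yes xy≈0 = ⊥-elim (y≉0 (cancel-≉0 x≉0 (trans (sym (strictlyInverseˡ _)) xy≈0)))
    ... | no  _    | no  _    = strictlyInverseˡ _

    ∏h : ∏.sum h ≈ x ^ᶠ n′
    ∏h = begin
      ∏.sum h                                             ≈⟨ ∏.sum-remove {n′} {from 0#} h ⟩
      h (from 0#) * ∏.sum (λ j → h (Fin.punchIn (from 0#) j)) ≈⟨ *-cong h-zero (∏.sum-cong-≋ {n′} h-nonzero) ⟩
      1# * ∏.sum {n′} (λ _ → x)                           ≈⟨ *-identityˡ _ ⟩
      ∏.sum {n′} (λ _ → x)                                ≈⟨ ∏.sum-replicate n′ ⟩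
      x ^ᶠ n′                                             ∎
      where
      h-zero : h (from 0#) ≈ 1#
      h-zero with to (from 0#) ≟ 0#
      ... | yes _ = refl
      ... | no  q = ⊥-elim (q (strictlyInverseˡ 0#))
      h-nonzero : ∀ j → h (Fin.punchIn (from 0#) j) ≈ x
      h-nonzero j with to (Fin.punchIn (from 0#) j) ≟ 0#
      ... | yes q = ⊥-elim (Fin.punchInᵢ≢i (from 0#) j (≡.trans (≡.sym (strictlyInverseʳ _)) (from-cong q)))
      ... | no  _ = refl

    x^n′*G : x ^ᶠ n′ * G ≈ G
    x^n′*G = begin
      x ^ᶠ n′ * G                       ≈⟨ *-congʳ ∏h ⟨
      ∏.sum h * ∏.sum g                 ≈⟨ ∏.∑-distrib-+ {n} h g ⟨
      ∏.sum (λ i → h i * g i)           ≈⟨ ∏.sum-cong-≋ {n} g-scale ⟨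
      ∏.sum (λ i → g (from (x * to i))) ≈⟨ ∏.sum-permute g (scaling (proj₂ (invert x x≉0))) ⟨
      ∏.sum g                           ∎

  open RootBound R cancel-≉0

  -- Stands in for a primitive root. The monic polynomial X ^ (r + 2) - X has degree at most n′ and
  -- cannot vanish at all n′ + 1 elements; an element where it does not vanish is nonzero and
  -- violates u ^ (r + 1) = 1.
  non-root : ∀ r → suc (suc r) ℕ.≤ n′ → ∃[ u ] (¬ u ≈ 0# × ¬ u ^ᶠ suc r ≈ 1#)
  non-root r r<n′ with Fin.all? (λ i → (to i ^ᶠ suc (suc r)) ≟ to i)
  ... | no  ¬all = let i , q = Fin.¬∀⟶∃¬ n _ (λ i → (to i ^ᶠ suc (suc r)) ≟ to i) ¬all in
        to i , (λ u≈0 → q (trans (*-congʳ u≈0) (trans (zeroˡ _) (sym u≈0))))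
             , (λ u^≈1 → q (trans (*-congˡ u^≈1) (*-identityʳ _)))
  ... | yes all = ⊥-elim (1≉0 (roots (suc (suc r)) lead (λ i → to (Fin.inject≤ i (s≤s r<n′)))
          (λ e → Fin.inject≤-injective _ _ _ _ (≡.trans (≡.sym (strictlyInverseʳ _))
                   (≡.trans (from-cong e) (strictlyInverseʳ _))))
          (λ i → vanishes (to _) (all _))))
    where
    low : ∀ k → HasLead (suc (suc k)) 0# (λ x → - 1# * x ^ᶠ 1)
    low zero    = lead-raise 1 (lead-* 1 (- 1#) (lead-^ 1))
    low (suc k) = lead-raise (suc (suc k)) (low k)
    lead : HasLead (suc (suc r)) 1# (λ x → x ^ᶠ suc (suc r) + - 1# * x ^ᶠ 1)
    lead = lead-resp (suc (suc r)) (+-identityʳ 1#) (lead-+ (suc (suc r)) (lead-^ (suc (suc r))) (low r))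
    vanishes : ∀ u → u ^ᶠ suc (suc r) ≈ u → u ^ᶠ suc (suc r) + - 1# * u ^ᶠ 1 ≈ 0#
    vanishes u e = trans (+-cong e (trans (*-congˡ (*-identityʳ u)) (-1*x≈-x u))) (-‿inverseʳ u)
      where open import Algebra.Properties.Ring ring using (-1*x≈-x)

  ∤⇒non-root : .{{_ : NonZero n′}} → ∀ t → ¬ n′ ∣ t → ∃[ u ] (¬ u ≈ 0# × ¬ u ^ᶠ t ≈ 1#)
  ∤⇒non-root t n′∤t with t ℕ.% n′ in eq | m≡m%n+[m/n]*n t n′ | m%n<n t n′
  ... | zero  | _   | _    = ⊥-elim (n′∤t (m%n≡0⇒n∣m t n′ eq))
  ... | suc r | t≡  | r<n′ = let u , u≉0 , q = non-root r r<n′ in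
    u , u≉0 , λ e → q (begin
      u ^ᶠ suc r                              ≈⟨ *-identityʳ _ ⟨
      u ^ᶠ suc r * 1#                         ≈⟨ *-congˡ (1^ (t ℕ./ n′)) ⟨
      u ^ᶠ suc r * 1# ^ᶠ (t ℕ./ n′)           ≈⟨ *-congˡ (^-congˡ (t ℕ./ n′) (fermat u≉0)) ⟨
      u ^ᶠ suc r * (u ^ᶠ n′) ^ᶠ (t ℕ./ n′)    ≈⟨ *-congˡ (^-assocʳ u n′ (t ℕ./ n′)) ⟩
      u ^ᶠ suc r * u ^ᶠ (n′ ℕ.* (t ℕ./ n′))   ≈⟨ *-congˡ (^-congʳ u (ℕ.*-comm n′ (t ℕ./ n′))) ⟩
      u ^ᶠ suc r * u ^ᶠ (t ℕ./ n′ ℕ.* n′)     ≈⟨ ^-homo-* u (suc r) (t ℕ./ n′ ℕ.* n′) ⟨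
      u ^ᶠ (suc r ℕ.+ t ℕ./ n′ ℕ.* n′)        ≈⟨ ^-congʳ u t≡ ⟨
      u ^ᶠ t                                  ≈⟨ e ⟩
      1#                                      ∎)
    where
    open import Relation.Binary.Reasoning.Setoid setoid
    1^ : ∀ k → 1# ^ᶠ k ≈ 1#
    1^ zero    = refl
    1^ (suc k) = trans (*-identityˡ _) (1^ k)

  private
    module ∑ᴬ = Algebra.Properties.Semiring.Sum A.semiring
    module A^ = Algebra.Properties.CommutativeSemiring.Exp A.commutativeSemiring

  powerSum : ℕ → Element
  powerSum t = ∑ᴬ.sum (λ i → [ to i ] ^ t)

  powerSum-0 : powerSum 0 ≋ n ×ᴬ A.1#
  powerSum-0 = ∑ᴬ.sum-replicate n

  -- If u ^ t ≠ 1, scaling by u shows (1 - [ u ] ^ t) S = 0, and 1 - [ u ] ^ t is a unit modulo I.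
  powerSum-∤ : .{{_ : NonZero n′}} → ∀ t → ¬ n′ ∣ t → ∀ k → powerSum t ∈I^ k
  powerSum-∤ t n′∤t = go
    where
    open import Relation.Binary.Reasoning.Setoid A.setoid
    open Integers.Solver monoidRing using () renaming (solve to solveᴬ; _:=_ to _:=ᴬ_; _:*_ to _:*ᴬ_; _:-_ to _:-ᴬ_)
    u   = proj₁ (∤⇒non-root t n′∤t)
    u≉0 = proj₁ (proj₂ (∤⇒non-root t n′∤t))
    d   = 1# - u ^ᶠ t
    d≉0 : ¬ d ≈ 0#
    d≉0 d≈0 = proj₂ (proj₂ (∤⇒non-root t n′∤t)) (sym (x∙y⁻¹≈ε⇒x≈y _ _ d≈0))
    v   = proj₁ (invert d d≉0)
    S   = powerSum t
    U   = [ u ] ^ t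

    US≋S : U ⊗ S ≋ S
    US≋S = begin
      U ⊗ S                                          ≈⟨ ∑ᴬ.*-distribˡ-sum {n} U (λ i → [ to i ] ^ t) ⟩
      ∑ᴬ.sum (λ i → U ⊗ [ to i ] ^ t)                ≈⟨ ∑ᴬ.sum-cong-≋ {n} (λ i → A^.^-distrib-* [ u ] [ to i ] t) ⟨
      ∑ᴬ.sum (λ i → [ u * to i ] ^ t)                ≈⟨ ∑ᴬ.sum-cong-≋ {n} (λ i → A^.^-congˡ t ([]-cong (strictlyInverseˡ (u * to i)))) ⟨
      ∑ᴬ.sum (λ i → [ to (from (u * to i)) ] ^ t)    ≈⟨ ∑ᴬ.sum-permute {n} {n} (λ i → [ to i ] ^ t) (scaling (proj₂ (invert u u≉0))) ⟨
      S                                              ∎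

    -- `v` is the inverse of 1 - u ^ t, so J lies in I; since J fixes S, every multiplication by J
    -- shows S in one more power of I.
    J = A.1# A.- [ v ] ⊗ (A.1# A.- U)

    J∈ : I J
    J∈ = trans (+-congˡ (-‿cong (trans (π-⊗ [ v ] (A.1# A.- U)) (trans (*-congˡ (+-congˡ (-‿cong (π-^ [ u ] t))))
           (trans (*-comm v d) (proj₂ (invert d d≉0))))))) (-‿inverseʳ 1#)

    S≋JS : J ⊗ S ≋ S
    S≋JS = begin
      J ⊗ S                                        ≈⟨ spread A.1# [ v ] U S ⟩
      A.1# ⊗ S A.- [ v ] ⊗ (A.1# ⊗ S A.- U ⊗ S)      ≈⟨ A.+-cong (A.*-identityˡ S) (A.-‿cong (A.*-congˡ {[ v ]} (A.+-cong (A.*-identityˡ S) (A.-‿cong US≋S)))) ⟩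
      S A.- [ v ] ⊗ (S A.- S)                      ≈⟨ cancel [ v ] S ⟩
      S                                            ∎
      where
      cancel : ∀ v s → s A.- v ⊗ (s A.- s) ≋ s
      cancel = solveᴬ 2 (λ v s → s :-ᴬ v :*ᴬ (s :-ᴬ s) :=ᴬ s) A.refl
      spread : ∀ e v u s → (e A.- v ⊗ (e A.- u)) ⊗ s ≋ e ⊗ s A.- v ⊗ (e ⊗ s A.- u ⊗ s)
      spread = solveᴬ 4 (λ e v u s → (e :-ᴬ v :*ᴬ (e :-ᴬ u)) :*ᴬ s :=ᴬ e :*ᴬ s :-ᴬ v :*ᴬ (e :*ᴬ s :-ᴬ u :*ᴬ s)) A.refl

    go : ∀ k → S ∈I^ k
    go zero    = whole
    go (suc k) = resp S≋JS (*∈ {x = J} J∈ (go k))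

-- Counting solutions

module Multinomial {c ℓ ℓ′} (R : CommutativeSemiring c ℓ)
  (Q : CommutativeSemiring.Carrier R → Set ℓ′)
  (Q-resp : ∀ {x y} → CommutativeSemiring._≈_ R x y → Q x → Q y)
  (Q-0 : Q (CommutativeSemiring.0# R))
  (Q-+ : ∀ {x y} → Q x → Q y → Q (CommutativeSemiring._+_ R x y)) where

  open CommutativeSemiring R
  open import Algebra.Properties.CommutativeSemiring.Exp R using (_^_)
  open import Algebra.Properties.Semiring.Mult semiring
    using (×-comm-*; ×-assocˡ; ×-congʳ)
    renaming (_×_ to infixr 8 _×ⁿ_)
  open import Algebra.Properties.CommutativeMonoid.Mult +-commutativeMonoid using (×-distrib-+)
  open import Relation.Binary.Reasoning.Setoid setoid

  private
    ×-zero : ∀ w {x} → x ≈ 0# → w ×ⁿ x ≈ 0#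
    ×-zero w {x} x≈0 = trans (×-congʳ w (trans x≈0 (sym (zeroˡ 0#))))
      (trans (sym (×-comm-* w 0# 0#)) (zeroˡ _))

  -- `w` and `Ψ` carry the coefficient and the powers already split off. The new coefficient is
  -- described by an equation between products of factorials, the form in which
  -- `multinomial-valuation` takes it.
  binomial-step : ∀ w Ψ x y n →
    (∀ i j w′ → i ℕ.+ j ≡ n → w′ ℕ.* (i ! ℕ.* j !) ≡ w ℕ.* n ! → Q (w′ ×ⁿ ((Ψ * x ^ i) * y ^ j))) →
    Q (w ×ⁿ (Ψ * (x + y) ^ n))
  binomial-step w Ψ x y n terms = BinomialExpansion.binomial-closed R
    (λ z → Q (w ×ⁿ (Ψ * z)))
    (λ e → Q-resp (×-congʳ w (*-congˡ e)))
    (Q-resp (sym (×-zero w (zeroʳ Ψ))) Q-0)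
    (λ p q → Q-resp (trans (sym (×-distrib-+ _ _ w)) (×-congʳ w (sym (distribˡ Ψ _ _)))) (Q-+ p q))
    n x y
    (λ { i j ≡.refl → Q-resp (regroup i j) (terms i j (w ℕ.* ((i ℕ.+ j) C i)) ≡.refl
      (≡.trans (ℕ.*-assoc w _ _) (≡.cong (w ℕ.*_) (binomial-factorials i j)))) })
    where
    regroup : ∀ i j → (w ℕ.* ((i ℕ.+ j) C i)) ×ⁿ ((Ψ * x ^ i) * y ^ j) ≈
                      w ×ⁿ (Ψ * ((i ℕ.+ j) C i) ×ⁿ (x ^ i * y ^ j))
    regroup i j = begin
      (w ℕ.* b) ×ⁿ ((Ψ * x ^ i) * y ^ j)     ≈⟨ ×-assocˡ _ w b ⟨
      w ×ⁿ b ×ⁿ ((Ψ * x ^ i) * y ^ j)        ≈⟨ ×-congʳ w (×-congʳ b (*-assoc _ _ _)) ⟩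
      w ×ⁿ b ×ⁿ (Ψ * (x ^ i * y ^ j))        ≈⟨ ×-congʳ w (×-comm-* b _ _) ⟨
      w ×ⁿ (Ψ * b ×ⁿ (x ^ i * y ^ j))        ∎
      where b = (i ℕ.+ j) C i

  module _ {ℓ″} {X : Set ℓ″} (m : X → Carrier) where

    powers : List (X × ℕ) → Carrier
    powers = List.foldr (λ z y → m (proj₁ z) ^ proj₂ z * y) 1#

    multinomial-closed : ∀ xs n w Ψ →
      (∀ zs w′ → List.map proj₁ zs ≡ xs → total proj₂ zs ≡ n →
         w′ ℕ.* List.foldr (λ z a → proj₂ z ! ℕ.* a) 1 zs ≡ w ℕ.* n ! → Q (w′ ×ⁿ (Ψ * powers zs))) →
      Q (w ×ⁿ (Ψ * List.foldr _+_ 0# (List.map m xs) ^ n))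
    -- The empty sum has 0-th power 1, the single empty term, while its positive powers vanish.
    multinomial-closed []       zero    w Ψ terms = terms [] w ≡.refl ≡.refl ≡.refl
    multinomial-closed []       (suc n) w Ψ terms =
      Q-resp (sym (×-zero w (trans (*-congˡ (zeroˡ _)) (zeroʳ Ψ)))) Q-0
    multinomial-closed (x ∷ xs) n       w Ψ terms = binomial-step w Ψ (m x) _ n λ i j w₁ i+j≡n w₁≡ →
      multinomial-closed xs j w₁ (Ψ * m x ^ i) λ zs w₂ map≡ ∑≡j w₂≡ →
        Q-resp (×-congʳ w₂ (sym (*-assoc _ _ _)))
          (terms ((x , i) ∷ zs) w₂ (≡.cong (x ∷_) map≡) (≡.trans (≡.cong (i ℕ.+_) ∑≡j) i+j≡n) (factorials i j w₁ w₂ w₁≡ w₂≡))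
      where
      factorials : ∀ i j w₁ w₂ {a} → w₁ ℕ.* (i ! ℕ.* j !) ≡ w ℕ.* n ! → w₂ ℕ.* a ≡ w₁ ℕ.* j ! →
                   w₂ ℕ.* (i ! ℕ.* a) ≡ w ℕ.* n !
      factorials i j w₁ w₂ {a} e₁ e₂ = ≡.trans (swap w₂ (i !) a) (≡.trans (≡.cong (i ! ℕ.*_) e₂)
        (≡.trans (swap (i !) w₁ (j !)) e₁))
        where
        swap : ∀ x y z → x ℕ.* (y ℕ.* z) ≡ y ℕ.* (x ℕ.* z)
        swap = ℕ-Solver.solve-∀

module ListSum {c ℓ} (R : CommutativeRing c ℓ) where

  open CommutativeRing R
  open import Algebra.Properties.Semiring.Mult semiring using ()
    renaming (_×_ to infixr 8 _×ⁿ_)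
  open import Algebra.Properties.CommutativeSemigroup +-commutativeSemigroup using (interchange)

  module _ {a} {X : Set a} where

    ∑ : List X → (X → Carrier) → Carrier
    ∑ []       Φ = 0#
    ∑ (x ∷ xs) Φ = Φ x + ∑ xs Φ

    ∑-cong : ∀ xs {Φ Ψ} → (∀ x → Φ x ≈ Ψ x) → ∑ xs Φ ≈ ∑ xs Ψ
    ∑-cong []       e = refl
    ∑-cong (x ∷ xs) e = +-cong (e x) (∑-cong xs e)

    ∑-zero : ∀ xs → ∑ xs (λ _ → 0#) ≈ 0#
    ∑-zero []       = refl
    ∑-zero (x ∷ xs) = trans (+-identityˡ _) (∑-zero xs)

    ∑-+ : ∀ xs Φ Ψ → ∑ xs (λ x → Φ x + Ψ x) ≈ ∑ xs Φ + ∑ xs Ψ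
    ∑-+ []       Φ Ψ = sym (+-identityˡ 0#)
    ∑-+ (x ∷ xs) Φ Ψ = trans (+-congˡ (∑-+ xs Φ Ψ)) (interchange _ _ _ _)

    ∑-*ˡ : ∀ a xs Φ → ∑ xs (λ x → a * Φ x) ≈ a * ∑ xs Φ
    ∑-*ˡ a []       Φ = sym (zeroʳ a)
    ∑-*ˡ a (x ∷ xs) Φ = trans (+-congˡ (∑-*ˡ a xs Φ)) (sym (distribˡ a _ _))

    ∑-× : ∀ w xs Φ → ∑ xs (λ x → w ×ⁿ Φ x) ≈ w ×ⁿ ∑ xs Φ
    ∑-× zero    xs Φ = ∑-zero xs
    ∑-× (suc w) xs Φ = trans (∑-+ xs Φ _) (+-congˡ (∑-× w xs Φ))

    ∑-++ : ∀ xs ys Φ → ∑ (xs ++ ys) Φ ≈ ∑ xs Φ + ∑ ys Φ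
    ∑-++ []       ys Φ = sym (+-identityˡ _)
    ∑-++ (x ∷ xs) ys Φ = trans (+-congˡ (∑-++ xs ys Φ)) (sym (+-assoc _ _ _))

    ∑-closed : ∀ {ℓ′} (Q : Carrier → Set ℓ′) → Q 0# → (∀ {x y} → Q x → Q y → Q (x + y)) →
               ∀ xs Φ → (∀ x → Q (Φ x)) → Q (∑ xs Φ)
    ∑-closed Q q0 q+ []       Φ q = q0
    ∑-closed Q q0 q+ (x ∷ xs) Φ q = q+ (q x) (∑-closed Q q0 q+ xs Φ q)

    length-filter : ∀ {ℓ′} {P : X → Set ℓ′} (P? : Unary.Decidable P) xs (χ : X → Carrier) →
                    (∀ x → P x → χ x ≈ 1#) → (∀ x → ¬ P x → χ x ≈ 0#) →
                    length (filter P? xs) ×ⁿ 1# ≈ ∑ xs χ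
    length-filter P? []       χ χ₁ χ₀ = refl
    length-filter P? (x ∷ xs) χ χ₁ χ₀ with P? x
    ... | yes p = +-cong (sym (χ₁ x p)) (length-filter P? xs χ χ₁ χ₀)
    ... | no ¬p = trans (length-filter P? xs χ χ₁ χ₀) (sym (trans (+-congʳ (χ₀ x ¬p)) (+-identityˡ _)))

  ∑-map : ∀ {a b} {X : Set a} {Y : Set b} (f : X → Y) xs Φ → ∑ (List.map f xs) Φ ≈ ∑ xs (Φ ∘ f)
  ∑-map f []       Φ = refl
  ∑-map f (x ∷ xs) Φ = +-congˡ (∑-map f xs Φ)

  ∑-cartesianProductWith : ∀ {a b d} {X : Set a} {Y : Set b} {Z : Set d} (f : X → Y → Z) xs ys Φ (Ψ : X → Carrier) (Θ : Y → Carrier) →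
    (∀ x y → Φ (f x y) ≈ Ψ x * Θ y) → ∑ (cartesianProductWith f xs ys) Φ ≈ ∑ xs Ψ * ∑ ys Θ
  ∑-cartesianProductWith f []       ys Φ Ψ Θ e = sym (zeroˡ _)
  ∑-cartesianProductWith f (x ∷ xs) ys Φ Ψ Θ e =
    trans (∑-++ (List.map (f x) ys) _ Φ)
      (trans (+-cong (trans (∑-map (f x) ys Φ) (trans (∑-cong ys (e x)) (∑-*ˡ (Ψ x) ys Θ)))
                     (∑-cartesianProductWith f xs ys Φ Ψ Θ e))
             (sym (distribʳ _ _ _)))

module Counting {c ℓ₁ ℓ₂} (F : HeytingField c ℓ₁ ℓ₂) {Q : ℕ} .{{_ : NonZero Q}} (F-order : HasOrder F (suc Q))
  (o : ℕ) (pr : Prime (suc o)) (L : ℕ) .{{_ : NonZero L}} (Q≡ : suc Q ≡ suc o ℕ.^ L) where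

  private
    R : CommutativeRing c ℓ₁
    R = HeytingCommutativeRing.commutativeRing (HeytingField.heytingCommutativeRing F)

  open CommutativeRing R hiding (zero)
  open HeytingField F using (#-irrefl; #⇒invertible; invertible⇒#; tight)
  open Inverse F-order using (to; from; strictlyInverseˡ)

  private
    p = suc o

  1≉0 : ¬ 1# ≈ 0#
  1≉0 1≈0 = #-irrefl 1≈0 (invertible⇒# (1# , trans (*-identityˡ _) 1-0 , trans (*-identityʳ _) 1-0))
    where
    open import Algebra.Properties.Ring ring using (-0#≈0#)
    1-0 : 1# - 0# ≈ 1#
    1-0 = trans (+-congˡ -0#≈0#) (+-identityʳ 1#)

  invert : ∀ x → ¬ x ≈ 0# → ∃[ y ] x * y ≈ 1#
  invert x x≉0 with Fin.any? (λ i → _≟_ F F-order (x * to i) 1#)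
  ... | yes (i , e) = to i , e
  ... | no  ¬inv    = ⊥-elim (x≉0 (proj₁ (tight x 0#) λ x#0 →
          let y , _ , e = #⇒invertible x#0 in
          ¬inv (from y , trans (*-cong (sym x-0) (strictlyInverseˡ y)) e)))
    where
    open import Algebra.Properties.Ring ring using (-0#≈0#)
    x-0 : x - 0# ≈ x
    x-0 = trans (+-congˡ -0#≈0#) (+-identityʳ x)

  open FiniteField R F-order (_≟_ F F-order) 1≉0 invert
  open Teichmüller R F-order
  open Characteristic pr (characteristic p L Q≡) 1≉0
  open ListSum monoidRing
  open import Algebra.Properties.CommutativeSemiring.Exp commutativeSemiring
    using (^-congʳ; ^-distrib-*; ^-homo-*; ^-assocʳ) renaming (_^_ to _^ᶠ_)
  private
    module A^ = Algebra.Properties.CommutativeSemiring.Exp A.commutativeSemiring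
    module A× = Algebra.Properties.Semiring.Mult A.semiring
    module ∏ = Algebra.Properties.CommutativeMonoid.Sum *-commutativeMonoid

  I-p : I (p ×ᴬ A.1#)
  I-p = trans (π-× p A.1#) (characteristic p L Q≡)

  -- As 0 ^ 0 = 1, exponent 0 gives q ^ m = p ^ L rather than q ^ m - 1, and p lies in I. For a
  -- positive multiple of Q only membership in I ^ 0 is claimed.
  powerSum-∣ : ∀ t → Q ∣ t → powerSum t ∈I^ (L ℕ.* isZero t)
  powerSum-∣ zero    _ = resp (A.sym powerSum-0) (≡.subst₂ (λ m b → m ×ᴬ A.1# ∈I^ b) (≡.sym Q≡)
    (≡.trans (ℕ.+-identityʳ L) (≡.sym (ℕ.*-identityʳ L))) (p^×∈ I-p L whole))
  powerSum-∣ (suc t) _ = ≡.subst (powerSum (suc t) ∈I^_) (≡.sym (ℕ.*-zeroʳ L)) whole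

  private
    els = elements F F-order
    tups = tuples F F-order

  ∑-elements : ∀ t → ∑ els (λ u → [ u ^ᶠ t ]) ≋ powerSum t
  ∑-elements t = ∑-tabulate to (λ u → [ u ^ᶠ t ]) (λ u → [ u ] ^ t) (λ u → A.sym ([]-^ u t))
    where
    ∑-tabulate : ∀ {n} (v : Fin n → Carrier) (Φ Ψ : Carrier → Element) → (∀ u → Φ u ≋ Ψ u) →
                 ∑ (List.tabulate v) Φ ≋ Algebra.Properties.Semiring.Sum.sum A.semiring (λ i → Ψ (v i))
    ∑-tabulate {zero}  v Φ Ψ e = A.refl
    ∑-tabulate {suc n} v Φ Ψ e = A.+-cong (e (v Fin.zero)) (∑-tabulate (v ∘ Fin.suc) Φ Ψ e)

  monomialSum : ∀ {k} → Vec ℕ k → Element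
  monomialSum {k} M = ∑ (tups k) (λ x → [ monomial F M x ])

  monomialSum-∷ : ∀ {k} m (M : Vec ℕ k) → monomialSum (m Vec.∷ M) ≋ powerSum m ⊗ monomialSum M
  monomialSum-∷ {k} m M = A.trans
    (∑-cartesianProductWith Vec._∷_ els (tups k) _ (λ u → [ u ^ᶠ m ]) (λ x → [ monomial F M x ]) (λ u x → A.refl))
    (A.*-congʳ (∑-elements m))

  monomialSum-∣ : ∀ {k} (M : Vec ℕ k) → (∀ i → Q ∣ lookup M i) → monomialSum M ∈I^ (L ℕ.* zeros M)
  monomialSum-∣ Vec.[]      _   = ≡.subst (monomialSum Vec.[] ∈I^_) (≡.sym (ℕ.*-zeroʳ L)) whole
  monomialSum-∣ (m Vec.∷ M) Q∣M = ≡.subst (monomialSum (m Vec.∷ M) ∈I^_) (≡.sym (ℕ.*-distribˡ-+ L (isZero m) (zeros M)))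
    (resp (A.sym (monomialSum-∷ m M)) (*∈^ (powerSum-∣ m (Q∣M Fin.zero)) (monomialSum-∣ M (Q∣M ∘ Fin.suc))))

  monomialSum-∤ : ∀ {k} (M : Vec ℕ k) i → ¬ Q ∣ lookup M i → ∀ b → monomialSum M ∈I^ b
  monomialSum-∤ (m Vec.∷ M) Fin.zero    Q∤m b = resp (A.sym (monomialSum-∷ m M))
    (resp (A.*-comm (monomialSum M) (powerSum m)) (absorb (monomialSum M) (powerSum-∤ m Q∤m b)))
  monomialSum-∤ (m Vec.∷ M) (Fin.suc i) Q∤m b = resp (A.sym (monomialSum-∷ m M))
    (absorb (powerSum m) (monomialSum-∤ M i Q∤m b))

  points : ∀ k → List (Vec Carrier k × Carrier)
  points k = cartesianProduct (tups k) els

  pointSum : ∀ {k} → ℕ → Vec ℕ k → Element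
  pointSum {k} t M = ∑ (points k) (λ z → [ proj₂ z ^ᶠ t * monomial F M (proj₁ z) ])

  pointSum-⊗ : ∀ {k} t (M : Vec ℕ k) → pointSum t M ≋ powerSum t ⊗ monomialSum M
  pointSum-⊗ {k} t M = A.trans
    (∑-cartesianProductWith _,_ (tups k) els _ (λ x → [ monomial F M x ]) (λ y → [ y ^ᶠ t ])
      (λ x y → []-cong (*-comm _ _)))
    (A.trans (A.*-comm (monomialSum M) _) (A.*-congʳ (∑-elements t)))

  pointSum-∣ : ∀ {k} t (M : Vec ℕ k) → Q ∣ t → (∀ i → Q ∣ lookup M i) →
               pointSum t M ∈I^ (L ℕ.* (isZero t ℕ.+ zeros M))
  pointSum-∣ t M Q∣t Q∣M = ≡.subst (pointSum t M ∈I^_) (≡.sym (ℕ.*-distribˡ-+ L (isZero t) (zeros M)))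
    (resp (A.sym (pointSum-⊗ t M)) (*∈^ (powerSum-∣ t Q∣t) (monomialSum-∣ M Q∣M)))

  monomial-combination : ∀ {k} (zs : List (Vec ℕ k × ℕ)) x →
    List.foldr (λ z a → monomial F (proj₁ z) x ^ᶠ proj₂ z * a) 1# zs ≈ monomial F (combination (λ j → j) zs) x
  monomial-combination {k} zs x = trans (go zs) (∏.sum-cong-≋ {k} λ i →
      ^-congʳ (lookup x i) (≡.sym (Vec.lookup∘tabulate (λ i → total (λ z → proj₂ z ℕ.* lookup (proj₁ z) i) zs) i)))
    where
    open import Relation.Binary.Reasoning.Setoid setoid
    exponent : List (Vec ℕ k × ℕ) → Fin k → ℕ
    exponent zs i = total (λ z → proj₂ z ℕ.* lookup (proj₁ z) i) zs

    product-^ : ∀ {k} (t : Fin k → Carrier) j → ∏.sum t ^ᶠ j ≈ ∏.sum (λ i → t i ^ᶠ j)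
    product-^ {zero}  t zero    = refl
    product-^ {zero}  t (suc j) = trans (*-identityˡ _) (product-^ {zero} t j)
    product-^ {suc k} t j       = trans (^-distrib-* _ _ j) (*-congˡ (product-^ (t ∘ Fin.suc) j))

    go : ∀ zs → List.foldr (λ z a → monomial F (proj₁ z) x ^ᶠ proj₂ z * a) 1# zs ≈
                ∏.sum (λ i → lookup x i ^ᶠ exponent zs i)
    go []             = sym (∏.sum-replicate-zero k)
    go ((μ , j) ∷ zs) = begin
      monomial F μ x ^ᶠ j * List.foldr (λ z a → monomial F (proj₁ z) x ^ᶠ proj₂ z * a) 1# zs
        ≈⟨ *-cong (product-^ (λ i → lookup x i ^ᶠ lookup μ i) j) (go zs) ⟩
      ∏.sum (λ i → (lookup x i ^ᶠ lookup μ i) ^ᶠ j) * ∏.sum (λ i → lookup x i ^ᶠ exponent zs i)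
        ≈⟨ ∏.∑-distrib-+ {k} _ _ ⟨
      ∏.sum (λ i → (lookup x i ^ᶠ lookup μ i) ^ᶠ j * lookup x i ^ᶠ exponent zs i)
        ≈⟨ ∏.sum-cong-≋ {k} (λ i → trans (^-homo-* (lookup x i) (j ℕ.* lookup μ i) (exponent zs i)) (*-congʳ
             (trans (^-congʳ (lookup x i) (ℕ.*-comm j (lookup μ i))) (sym (^-assocʳ (lookup x i) (lookup μ i) j))))) ⟨
      ∏.sum (λ i → lookup x i ^ᶠ (j ℕ.* lookup μ i ℕ.+ exponent zs i))
        ∎

  module _ {k : ℕ} (f : Polynomial F k) (d e r K C B : ℕ) .{{_ : NonZero d}}
    (degree : ∀ μ → ¬ Polynomial.coeff f μ ≈ 0# → Vec.sum μ ℕ.≤ d)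
    (r≡ : suc r ≡ p ℕ.^ e) (Q≡Kr : Q ≡ K ℕ.* r)
    (C-least : ∀ t → k ℕ.* Q ℕ.≤ t ℕ.* (d ℕ.* r) → C ℕ.≤ t)
    (B-least : ∀ t → (L ℕ.* r) ℕ.* C ℕ.≤ t ℕ.* Q → B ℕ.≤ t) where

    open Polynomial f
    open Rotation.TermBound o pr L Q Q≡ e r K d k C B r≡ Q≡Kr C-least B-least using (q; B≤Lk; term-bound)

    private
      Point = Vec Carrier k × Carrier
      module Fun = CommutativeSemiring (Pointwise.commutativeSemiring Point A.commutativeSemiring)
      open Algebra.Properties.CommutativeSemiring.Exp (Pointwise.commutativeSemiring Point A.commutativeSemiring)
        using () renaming (_^_ to _^ᴾ_)
      open Algebra.Properties.Semiring.Mult Fun.semiring using () renaming (_×_ to infixr 8 _×ᴾ_)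

      ^-point : ∀ Φ n z → (Φ ^ᴾ n) z ≡ Φ z ^ n
      ^-point Φ zero    z = ≡.refl
      ^-point Φ (suc n) z = ≡.cong (Φ z ⊗_) (^-point Φ n z)

      ×-point : ∀ n Φ z → (n ×ᴾ Φ) z ≡ n ×ᴬ Φ z
      ×-point zero    Φ z = ≡.refl
      ×-point (suc n) Φ z = ≡.cong (Φ z ⊕_) (×-point n Φ z)

    nonzero? : Unary.Decidable (λ μ → ¬ coeff μ ≈ 0#)
    nonzero? μ = ¬? (_≟_ F F-order (coeff μ) 0#)

    -- The support may contain exponents of degree > d with coefficient zero.
    exponents : List (Vec ℕ k)
    exponents = filter nonzero? support

    term : Vec ℕ k → Point → Element
    term μ (x , _) = [ coeff μ * monomial F μ x ]

    Y Yq G : Point → Element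
    Y  (_ , y) = [ y ]
    -- The sign stands inside the bracket, so every summand of G is a single bracket and every
    -- multinomial term an integer times a single bracket.
    Yq (_ , y) = [ - 1# * y ^ᶠ q ]
    -- The Teichmüller lift, monomial by monomial, of f - y ^ q + y.
    G = Y Fun.+ (Yq Fun.+ List.foldr Fun._+_ Fun.0# (List.map term exponents))

    E : ℕ
    E = Q ℕ.* p ℕ.^ B

    -- The expansion takes place in the ring of functions on the points, because a multinomial term
    -- is controlled only after summation over all points.
    Small : (Point → Element) → Set _
    Small Φ = ∑ (points k) Φ ∈I^ B

    open Multinomial (Pointwise.commutativeSemiring Point A.commutativeSemiring) Small
      (λ e → resp (∑-cong (points k) e)) (resp (A.sym (∑-zero (points k))) 0∈)
      (λ p q → resp (A.sym (∑-+ (points k) _ _)) (+∈ p q))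

    coefficient : List (Vec ℕ k × ℕ) → Carrier
    coefficient = List.foldr (λ z a → coeff (proj₁ z) ^ᶠ proj₂ z * a) 1#

    powers-point : ∀ zs z → powers term zs z ≋ [ coefficient zs * monomial F (combination (λ j → j) zs) (proj₁ z) ]
    powers-point zs z@(x , y) = A.trans (go zs) ([]-cong (*-congˡ (monomial-combination zs x)))
      where
      open import Algebra.Properties.CommutativeSemigroup *-commutativeSemigroup using (interchange)
      go : ∀ zs → powers term zs z ≋ [ coefficient zs * List.foldr (λ z a → monomial F (proj₁ z) x ^ᶠ proj₂ z * a) 1# zs ]
      go []             = []-cong (sym (*-identityˡ 1#))
      go ((μ , j) ∷ zs) = A.trans
        (A.*-cong (A.trans (A.reflexive (^-point (term μ) j z)) ([]-^ (coeff μ * monomial F μ x) j)) (go zs))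
        ([]-cong (trans (*-congʳ (^-distrib-* (coeff μ) (monomial F μ x) j)) (interchange _ _ _ _)))

    multinomialTerm-point : ∀ a b zs w z →
      (w ×ᴾ (((Fun.1# Fun.* Y ^ᴾ a) Fun.* Yq ^ᴾ b) Fun.* powers term zs)) z ≋
      w ×ᴬ ([ (- 1#) ^ᶠ b * coefficient zs ] ⊗
            [ proj₂ z ^ᶠ (a ℕ.+ q ℕ.* b) * monomial F (combination (λ j → j) zs) (proj₁ z) ])
    multinomialTerm-point a b zs w z@(x , y) = A.trans (A.reflexive (×-point w _ z)) (A×.×-congʳ w
      (A.trans (A.*-cong (A.*-cong
          (A.trans (A.*-identityˡ ((Y ^ᴾ a) z)) (A.trans (A.reflexive (^-point Y a z)) ([]-^ y a)))
          (A.trans (A.reflexive (^-point Yq b z)) ([]-^ _ b)))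
        (powers-point zs z))
        ([]-cong (trans (*-congʳ (*-congˡ (^-distrib-* (- 1#) (y ^ᶠ q) b)))
          (trans (*-congʳ (*-congˡ (*-congˡ (^-assocʳ y q b))))
          (trans (regroup (y ^ᶠ a) ((- 1#) ^ᶠ b) (y ^ᶠ (q ℕ.* b)) (coefficient zs) _)
                 (*-congˡ (*-congʳ (sym (^-homo-* y a (q ℕ.* b)))))))))))
      where
      open Integers.Solver R using (solve; _:=_; _:*_)
      regroup : ∀ a s b c m → (a * (s * b)) * (c * m) ≈ (s * c) * ((a * b) * m)
      regroup = solve 5 (λ a s b c m → (a :* (s :* b)) :* (c :* m) := (s :* c) :* ((a :* b) :* m)) refl

    multinomialTerm-small : ∀ a b zs w → All (λ z → Vec.sum (proj₁ z) ℕ.≤ d) zs →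
      a ℕ.+ (b ℕ.+ total proj₂ zs) ≡ E →
      w ℕ.* (a ! ℕ.* (b ! ℕ.* List.foldr (λ z x → proj₂ z ! ℕ.* x) 1 zs)) ≡ E ! →
      Small (w ×ᴾ (((Fun.1# Fun.* Y ^ᴾ a) Fun.* Yq ^ᴾ b) Fun.* powers term zs))
    multinomialTerm-small a b zs w deg ∑≡ w≡ = resp (A.sym sum≋) small
      where
      M = combination (λ j → j) zs
      t = a ℕ.+ q ℕ.* b
      κ = (- 1#) ^ᶠ b * coefficient zs
      sum≋ : ∑ (points k) (w ×ᴾ (((Fun.1# Fun.* Y ^ᴾ a) Fun.* Yq ^ᴾ b) Fun.* powers term zs)) ≋
             w ×ᴬ ([ κ ] ⊗ pointSum t M)
      sum≋ = A.trans (∑-cong (points k) (multinomialTerm-point a b zs w))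
        (A.trans (∑-× w (points k) _) (A×.×-congʳ w (∑-*ˡ [ κ ] (points k) _)))

      pointSum-small : ¬ (Q ∣ t × (∀ i → Q ∣ lookup M i)) → pointSum t M ∈I^ B
      pointSum-small ¬Q∣ with Q ∣? t | Fin.all? (λ i → Q ∣? lookup M i)
      ... | no Q∤t  | _       = resp (A.sym (pointSum-⊗ t M)) (resp (A.*-comm (monomialSum M) (powerSum t))
              (absorb (monomialSum M) (powerSum-∤ t Q∤t B)))
      ... | yes Q∣t | yes Q∣M = ⊥-elim (¬Q∣ (Q∣t , Q∣M))
      ... | yes Q∣t | no ¬Q∣M = let i , Q∤m = Fin.¬∀⟶∃¬ k _ (λ i → Q ∣? lookup M i) ¬Q∣M in
              resp (A.sym (pointSum-⊗ t M)) (absorb (powerSum t) (monomialSum-∤ M i Q∤m B))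

      small : w ×ᴬ ([ κ ] ⊗ pointSum t M) ∈I^ B
      small with Q ∣? t | Fin.all? (λ i → Q ∣? lookup M i)
      -- The coefficient w supplies `v` powers of I, and the power sums supply L more for every
      -- variable with exponent 0.
      ... | yes Q∣t | yes Q∣M = let v , p^v∣w , B≤ = term-bound B zs a b w deg Q∣t Q∣M ∑≡ w≡ in
              ≤∈ B≤ (∣×∈ I-p v p^v∣w (absorb [ κ ] (pointSum-∣ t M Q∣t Q∣M)))
      ... | no Q∤t  | _       = ×∈ w (absorb [ κ ] (pointSum-small (Q∤t ∘ proj₁)))
      ... | yes _   | no ¬Q∣M = ×∈ w (absorb [ κ ] (pointSum-small (¬Q∣M ∘ proj₂)))

    G^E-small : ∑ (points k) (λ z → G z ^ E) ∈I^ B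
    G^E-small = resp (∑-cong (points k) λ z →
        A.trans (A.+-identityʳ _) (A.trans (A.*-identityˡ _) (A.reflexive (^-point G E z))))
      (binomial-step 1 Fun.1# Y _ E λ a j₁ w₁ a+j₁≡E w₁≡ →
       binomial-step w₁ (Fun.1# Fun.* Y ^ᴾ a) Yq _ j₁ λ b j₂ w₂ b+j₂≡j₁ w₂≡ →
       multinomial-closed term exponents j₂ w₂ ((Fun.1# Fun.* Y ^ᴾ a) Fun.* Yq ^ᴾ b) λ zs w₃ map≡ ∑≡j₂ w₃≡ →
       multinomialTerm-small a b zs w₃
         (All.map⁻ (≡.subst (All (λ μ → Vec.sum μ ℕ.≤ d)) (≡.sym map≡) (All.map (degree _) (All.all-filter nonzero? support))))
         (≡.trans (≡.cong (λ t → a ℕ.+ (b ℕ.+ t)) ∑≡j₂) (≡.trans (≡.cong (a ℕ.+_) b+j₂≡j₁) a+j₁≡E))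
         (factorials {a !} {b !} w₁ w₂ w₃ w₁≡ w₂≡ w₃≡))
      where
      open ≡.≡-Reasoning
      factorials : ∀ {x y} w₁ w₂ w₃ {z j₁ j₂ e} → w₁ ℕ.* (x ℕ.* j₁) ≡ 1 ℕ.* e → w₂ ℕ.* (y ℕ.* j₂) ≡ w₁ ℕ.* j₁ →
                   w₃ ℕ.* z ≡ w₂ ℕ.* j₂ → w₃ ℕ.* (x ℕ.* (y ℕ.* z)) ≡ e
      factorials {x} {y} w₁ w₂ w₃ {z} {j₁} {j₂} {e} e₁ e₂ e₃ = begin
        w₃ ℕ.* (x ℕ.* (y ℕ.* z))   ≡⟨ pull w₃ x y z ⟩
        x ℕ.* (y ℕ.* (w₃ ℕ.* z))   ≡⟨ ≡.cong (λ t → x ℕ.* (y ℕ.* t)) e₃ ⟩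
        x ℕ.* (y ℕ.* (w₂ ℕ.* j₂))  ≡⟨ ≡.cong (x ℕ.*_) (swap y w₂ j₂) ⟩
        x ℕ.* (w₂ ℕ.* (y ℕ.* j₂))  ≡⟨ ≡.cong (x ℕ.*_) e₂ ⟩
        x ℕ.* (w₁ ℕ.* j₁)          ≡⟨ swap x w₁ j₁ ⟩
        w₁ ℕ.* (x ℕ.* j₁)          ≡⟨ ≡.trans e₁ (ℕ.*-identityˡ e) ⟩
        e                          ∎
        where
        pull : ∀ w x y z → w ℕ.* (x ℕ.* (y ℕ.* z)) ≡ x ℕ.* (y ℕ.* (w ℕ.* z))
        pull = ℕ-Solver.solve-∀
        swap : ∀ x y z → x ℕ.* (y ℕ.* z) ≡ y ℕ.* (x ℕ.* z)
        swap = ℕ-Solver.solve-∀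

    -- The constant 1 is the monomial with all exponents 0, so `B≤Lk` applies to its sum over the
    -- points.
    ones-small : ∑ (points k) (λ _ → A.1#) ∈I^ B
    ones-small = resp (∑-cong (points k) λ z → []-cong (trans (*-identityˡ _) (sym (monomial-combination [] (proj₁ z)))))
      (≤∈ (ℕ.≤-trans B≤Lk (ℕ.*-monoʳ-≤ L (ℕ.≤-trans (ℕ.≤-reflexive (≡.sym (zeros-0 k))) (ℕ.n≤1+n _))))
        (pointSum-∣ 0 (combination (λ j → j) []) (Q ∣0)
          (λ i → ≡.subst (Q ∣_) (≡.sym (Vec.lookup∘tabulate {n = k} (λ _ → 0) i)) (Q ∣0))))
      where
      zeros-0 : ∀ k → zeros (Vec.tabulate {n = k} (λ _ → 0)) ≡ k
      zeros-0 zero    = ≡.refl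
      zeros-0 (suc k) = ≡.cong suc (zeros-0 k)

    solution? : Unary.Decidable (λ (z : Point) → eval F f (proj₁ z) ≈ (proj₂ z ^ᶠ q) - proj₂ z)
    solution? (x , y) = _≟_ F F-order (eval F f x) ((y ^ᶠ q) - y)

    πG : ∀ z → π (G z) ≈ eval F f (proj₁ z) - ((proj₂ z ^ᶠ q) - proj₂ z)
    πG z@(x , y) = trans (+-congˡ (+-cong (-1*x≈-x (y ^ᶠ q)) (sum-exponents support))) (rearrange y (y ^ᶠ q) (eval F f x))
      where
      open import Algebra.Properties.Ring ring using (-1*x≈-x)
      open Integers.Solver R using (solve; _:=_; _:+_; _:-_; :-_)
      rearrange : ∀ y u v → y + (- u + v) ≈ v - (u - y)
      rearrange = solve 3 (λ y u v → y :+ (:- u :+ v) := v :- (u :- y)) refl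
      sumOver : List (Vec ℕ k) → Carrier
      sumOver μs = π (List.foldr Fun._+_ Fun.0# (List.map term μs) z)
      sum-exponents : ∀ μs → sumOver (filter nonzero? μs) ≈
                      List.foldr _+_ 0# (List.map (λ μ → coeff μ * monomial F μ x) μs)
      sum-exponents []       = refl
      sum-exponents (μ ∷ μs) = go (_≟_ F F-order (coeff μ) 0#)
        where
        go : Dec (coeff μ ≈ 0#) → sumOver (filter nonzero? (μ ∷ μs)) ≈
             coeff μ * monomial F μ x + List.foldr _+_ 0# (List.map (λ μ → coeff μ * monomial F μ x) μs)
        go (no  c≉0) = trans (reflexive (≡.cong sumOver (List.filter-accept nonzero? c≉0))) (+-congˡ (sum-exponents μs))
        go (yes c≈0) = trans (reflexive (≡.cong sumOver (List.filter-reject nonzero? (λ c≉0 → c≉0 c≈0))))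
          (trans (sum-exponents μs) (sym (trans (+-congʳ (trans (*-congʳ c≈0) (zeroˡ _))) (+-identityˡ _))))

    χ : Point → Element
    χ z with solution? z
    ... | yes _ = A.1#
    ... | no  _ = 0ᴱ

    B≤E : B ℕ.≤ E
    B≤E = ℕ.≤-trans (ℕ.<⇒≤ (n<m^n (Legendre.1<p o pr) B)) (ℕ.m≤n*m (p ℕ.^ B) Q)

    -- At a solution `G z` lies in I, so its E-th power lies in I ^ E and E ≥ B. Elsewhere Fermat's
    -- theorem gives G ^ Q ≡ 1 modulo I, and raising to the power p ^ B improves this to a
    -- congruence modulo I ^ (B + 1).
    χ≡1-G^E : ∀ z → (χ z ⊕ G z ^ E) A.- A.1# ∈I^ B
    χ≡1-G^E z with solution? z
    ... | yes e = resp (cancel A.1# (G z ^ E)) (≤∈ B≤E (^∈ (trans (πG z) (x≈y⇒x∙y⁻¹≈ε e)) E))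
      where
      open import Algebra.Properties.Group +-group using (x≈y⇒x∙y⁻¹≈ε)
      open Integers.Solver monoidRing using (solve; _:=_; _:+_; _:-_)
      cancel : ∀ e g → g ≋ (e ⊕ g) A.- e
      cancel = solve 2 (λ e g → g := (e :+ g) :- e) A.refl
    ... | no ¬e = resp (A.+-congʳ (A.trans (A^.^-assocʳ (G z) Q (p ℕ.^ B)) (A.sym (A.+-identityˡ _))))
          (≤∈ (ℕ.n≤1+n B) (^p^n≡1 I-p pr B (trans (+-congʳ (trans (π-^ (G z) Q)
            (fermat (λ πG≈0 → ¬e (x∙y⁻¹≈ε⇒x≈y _ _ (trans (sym (πG z)) πG≈0)))))) (-‿inverseʳ 1#))))
      where open import Algebra.Properties.Group +-group using (x∙y⁻¹≈ε⇒x≈y)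

    ∑χ : N F F-order f q ×ᴬ A.1# ≋ ∑ (points k) χ
    ∑χ = length-filter _ (points k) χ χ₁ χ₀
      where
      χ₁ : ∀ z → eval F f (proj₁ z) ≈ (proj₂ z ^ᶠ q) - proj₂ z → χ z ≋ A.1#
      χ₁ z e with solution? z
      ... | yes _ = A.refl
      ... | no ¬e = ⊥-elim (¬e e)
      χ₀ : ∀ z → ¬ eval F f (proj₁ z) ≈ (proj₂ z ^ᶠ q) - proj₂ z → χ z ≋ 0ᴱ
      χ₀ z ¬e with solution? z
      ... | yes e = ⊥-elim (¬e e)
      ... | no  _ = A.refl

    p^B∣N : p ℕ.^ B ∣ N F F-order f q
    p^B∣N = ∈I^⇒∣ B _ (resp (A.trans sum≋ (A.sym ∑χ)) (-∈ (+∈ differences ones-small) G^E-small))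
      where
      D : Point → Element
      D z = (χ z ⊕ G z ^ E) A.- A.1#
      differences : ∑ (points k) D ∈I^ B
      differences = ∑-closed (_∈I^ B) 0∈ +∈ (points k) D χ≡1-G^E
      open Integers.Solver monoidRing using (solve; _:=_; _:+_; _:-_)
      restore : ∀ c g e → ((c ⊕ g) A.- e) ⊕ e ≋ c ⊕ g
      restore = solve 3 (λ c g e → ((c :+ g) :- e) :+ e := c :+ g) A.refl
      cancel : ∀ c g → (c ⊕ g) A.- g ≋ c
      cancel = solve 2 (λ c g → (c :+ g) :- g := c) A.refl
      sum≋ : (∑ (points k) D ⊕ ∑ (points k) (λ _ → A.1#)) A.- ∑ (points k) (λ z → G z ^ E) ≋ ∑ (points k) χ
      sum≋ = A.trans (A.+-congʳ (A.trans (A.sym (∑-+ (points k) D (λ _ → A.1#)))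
          (A.trans (∑-cong (points k) (λ z → restore (χ z) (G z ^ E) A.1#)) (∑-+ (points k) χ (λ z → G z ^ E)))))
        (cancel _ _)

-- Ceilings and valuations

open import Data.Integer.Base using () renaming (_≤_ to _≤ℤ_)
open import Data.Nat.Base using (_^_)
open import Relation.Binary.Construct.Add.Supremum.NonStrict _≤ℤ_ using (_≤⁺_; _≤⊤⁺) renaming ([_] to [_]⁺)
open import Relation.Nullary.Construct.Add.Supremum using ([_])

-- `ceiling` is minus the floor of the negated fraction, so the claim becomes -t ≤ x for that floor
-- x and follows from -t < 1 + x.
ceiling-least : ∀ i n .{{_ : NonZero n}} t → i ≤ℤ t ℤ.* + n → ceiling (i ℚᵘ./ n) ≤ℤ t
ceiling-least i n@(suc _) t i≤tn = ≡.subst (_≤ℤ t) (≡.cong ℤ.-_ (≡.sym (ℤ.div-pos-is-/ℕ (ℤ.- i) n)))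
  (≡.subst (ℤ.- x ≤ℤ_) (ℤ.neg-involutive t) (ℤ.neg-mono-≤ -t≤x))
  where
  x = (ℤ.- i) ℤ./ℕ n
  -t<1+x : ℤ.- t ℤ.< ℤ.suc x
  -t<1+x = ℤ.*-cancelʳ-<-nonNeg (+ n) (ℤ.≤-<-trans
    (≡.subst (_≤ℤ ℤ.- i) (ℤ.neg-distribˡ-* t (+ n)) (ℤ.neg-mono-≤ i≤tn))
    (ℤ.n<s[n/ℕd]*d (ℤ.- i) n))
  -t≤x : ℤ.- t ≤ℤ x
  -t≤x = ≡.subst (ℤ.- t ≤ℤ_) (ℤ.pred-suc x) (ℤ.i<j⇒i≤pred[j] -t<1+x)

ceiling-*-least : ∀ X Y .{{_ : NonZero Y}} i t → X ℤ.* i ≤ℤ t ℤ.* + Y →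
                  ceiling ((X ℚᵘ./ Y) ℚᵘ.* (i ℚᵘ./ 1)) ≤ℤ t
ceiling-*-least X Y@(suc y) i t le = ceiling-least (X ℤ.* i) (Y ℕ.* 1) t
  (≡.subst (λ n → X ℤ.* i ≤ℤ t ℤ.* + n) (≡.sym (ℕ.*-identityʳ Y)) le)

-- Makes an integer ceiling usable as an exponent of p. Clamping at 0 only increases it and
-- preserves its leastness among natural upper bounds.
positivePart : ℤ → ℕ
positivePart (+ n)    = n
positivePart -[1+ _ ] = 0

≤positivePart : ∀ i → i ≤ℤ + positivePart i
≤positivePart (+ n)    = ℤ.≤-refl
≤positivePart -[1+ _ ] = ℤ.-≤+

positivePart-least : ∀ i {n} → i ≤ℤ + n → positivePart i ℕ.≤ n
positivePart-least (+ _)    i≤n = ℤ.drop‿+≤+ i≤n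
positivePart-least -[1+ _ ] _   = z≤n

multiplicity-largest : ∀ b p n j → j ℕ.≤ b → p ^ j ∣ n → j ℕ.≤ multiplicity≤ b p n
multiplicity-largest zero    p n zero j≤b _ = z≤n
multiplicity-largest (suc b) p n j j≤b p^j∣n with p ^ suc b ∣? n
... | yes _       = j≤b
... | no  p^b∤n   = multiplicity-largest b p n j (ℕ.≤-pred (ℕ.≤∧≢⇒< j≤b λ { ≡.refl → p^b∤n p^j∣n })) p^j∣n

ν-≥ : ∀ p n i → 1 ℕ.< p → p ^ positivePart i ∣ n → [ i ] ≤⁺ ν p n
ν-≥ p zero      i 1<p _       = [ i ] ≤⊤⁺
ν-≥ p n@(suc _) i 1<p p^j∣n = [ ℤ.≤-trans (≤positivePart i) (ℤ.+≤+
  -- The exponent j lies in the range searched by `multiplicity≤`, because j < p ^ j ≤ n.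
  (multiplicity-largest n p n _ (ℕ.≤-trans (ℕ.<⇒≤ (n<m^n 1<p _)) (∣⇒≤ p^j∣n)) p^j∣n)) ]⁺

theorem5p4 : ∀ {c ℓ₁ ℓ₂} (p e m k d : ℕ) (pr : Prime p) →
    .{{_ : NonZero e}} → .{{_ : NonZero m}} → .{{_ : NonZero k}} → .{{_ : NonZero d}} →
    (F : HeytingField c ℓ₁ ℓ₂) (F-order : HasOrder F ((p ^ e) ^ m)) →
    (f : Polynomial F k) → HasDegree F f d →
    [ bound p e m k d pr ] ≤⁺ ν p (N F F-order f (p ^ e))
theorem5p4 zero e m k d pr F F-order f deg = ⊥-elim (¬prime[0] pr)
theorem5p4 p@(suc o) e m k d pr F F-order f deg =
  ν-≥ p (N F F-order f (p ^ e)) (bound p e m k d pr) 1<p (divisibility (≡.sym 1+Q≡q^m) F-order)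
  where
  open Legendre o pr using (1<p)
  r = p ^ e ℕ.∸ 1
  Q = (p ^ e) ^ m ℕ.∸ 1
  L = e ℕ.* m

  1<b^i : ∀ b i → .{{ℕ.NonTrivial b}} → .{{NonZero i}} → 1 ℕ.< b ^ i
  1<b^i b i = ℕ.^-monoʳ-< b (ℕ.nonTrivial⇒n>1 b) (ℕ.>-nonZero⁻¹ i)

  instance
    p-nonTrivial : ℕ.NonTrivial p
    p-nonTrivial = prime⇒nonTrivial pr
    q-nonTrivial : ℕ.NonTrivial (p ^ e)
    q-nonTrivial = ℕ.n>1⇒nonTrivial (1<b^i p e)
    r≢0 : NonZero r
    r≢0 = ℕ.>-nonZero (ℕ.m<n⇒0<n∸m (1<b^i p e))
    Q≢0 : NonZero Q
    Q≢0 = ℕ.>-nonZero (ℕ.m<n⇒0<n∸m (1<b^i (p ^ e) m))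
    L≢0 : NonZero L
    L≢0 = ℕ.m*n≢0 e m
    dr≢0 : NonZero (d ℕ.* r)
    dr≢0 = ℕ.m*n≢0 d r

  1+r≡q : suc r ≡ p ^ e
  1+r≡q = ℕ.m+[n∸m]≡n (ℕ.m^n>0 p e)

  1+Q≡q^m : suc Q ≡ (p ^ e) ^ m
  1+Q≡q^m = ℕ.m+[n∸m]≡n (ℕ.<⇒≤ (1<b^i (p ^ e) m))

  geometric : ∃[ K ] suc r ^ m ≡ 1 ℕ.+ K ℕ.* r
  geometric = suc^≡1 r m

  K = proj₁ geometric

  Q≡Kr : Q ≡ K ℕ.* r
  Q≡Kr = ℕ.suc-injective (≡.trans 1+Q≡q^m (≡.trans (≡.cong (_^ m) (≡.sym 1+r≡q)) (proj₂ geometric)))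

  innerCeiling : ℤ
  innerCeiling = ceiling (+ (k ℕ.* Q) ℚᵘ./ (d ℕ.* r))

  inner = positivePart innerCeiling
  outer = positivePart (bound p e m k d pr)

  inner-least : ∀ t → k ℕ.* Q ℕ.≤ t ℕ.* (d ℕ.* r) → inner ℕ.≤ t
  inner-least t le = positivePart-least innerCeiling (ceiling-least (+ (k ℕ.* Q)) (d ℕ.* r) (+ t)
    (≡.subst (+ (k ℕ.* Q) ≤ℤ_) (ℤ.pos-* t (d ℕ.* r)) (ℤ.+≤+ le)))

  outer-least : ∀ t → (L ℕ.* r) ℕ.* inner ℕ.≤ t ℕ.* Q → outer ℕ.≤ t
  outer-least t le = positivePart-least (bound p e m k d pr) (ceiling-*-least (+ (L ℕ.* r)) Q innerCeiling (+ t)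
    (ℤ.≤-trans (ℤ.*-monoˡ-≤-nonNeg (+ (L ℕ.* r)) (≤positivePart innerCeiling))
      (≡.subst₂ _≤ℤ_ (ℤ.pos-* (L ℕ.* r) inner) (ℤ.pos-* t Q) (ℤ.+≤+ le))))

  -- `Counting` expects the order in the form `suc Q`. With the order generalised to n, matching on
  -- `refl` transports `F-order` and the count `N` that depends on it.
  divisibility : ∀ {n} → n ≡ suc Q → (F-order : HasOrder F n) → p ^ outer ∣ N F F-order f (p ^ e)
  divisibility ≡.refl F-order = ≡.subst (λ q → p ^ outer ∣ N F F-order f q) 1+r≡q
    (p^B∣N F F-order o pr L (≡.trans 1+Q≡q^m (ℕ.^-*-assoc p e m)) f d e r K inner outer (proj₁ deg) 1+r≡q Q≡Kr inner-least outer-least)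
    where open Counting
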